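{- Let $M=(E(M),\mathcal{I}(M))$ be a regular matroid of rank $r$ with a standard ordering $e_1<\cdots <e_n$ of its ground set (so that $B=\{e_{n-r+1},\ldots,e_n\}$ is a basis of $M$). Let further $\{e_n,e_{n-r}\}$ be a cocircuit of $M$. If $k(\Delta_{\mathrm{BC}}(M\setminus e_n))$ and $k(\Delta_{\mathrm{BC}}(M/e_n))$ have NBC bases in their induced standard orderings $e_1<\cdots<e_{n-1}$, then so does $k(\Delta_{\mathrm{BC}}(M))$.
   Context: $k$ is a field. For a matroid $M$ with linearly ordered ground set, the broken circuit complex $\Delta_{\mathrm{BC}}(M)$ consists of the subsets of $E(M)$ containing no broken circuit $C\setminus\{\min C\}$ ($C$ a circuit); $k[\Delta_{\mathrm{BC}}(M)]$ is its Stanley-Reisner ring, with variable $x_i$ for $e_i$. A standard ordering $e_1<\cdots<e_n$ of $E(M)$ for a rank $r$ matroid is one in which the last $r$ elements form a basis $B$. For $b\in B$, the fundamental cocircuit $\mathrm{coc}(B,b)$ is the unique cocircuit contained in $(E\setminus B)\cup\{b\}$ containing $b$; the fundamental circuit $\mathrm{ci}(B,e)$ for $e\notin B$ is the unique circuit in $B\cup\{e\}$. For regular $M$, take a signing $(a^*_{ji})$ of the fundamental cocircuit incidence matrix w.r.t. $B$ (entries $\pm1$ if $e_i\in\mathrm{coc}(B,e_j)$, $0$ otherwise) that is orthogonal over $k$ to some signing of the circuit incidence matrix, and set $\theta_{e_j}=\sum_{e_i\in\mathrm{coc}(B,e_j)}a^*_{ji}x_i$ for $e_j\in B$; $\Theta^B=\{\theta_e: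 e\in B\}$ is a linear system of parameters for $k[\Delta_{\mathrm{BC}}(M)]$, and $k(\Delta_{\mathrm{BC}}(M))=k[\Delta_{\mathrm{BC}}(M)]/\Theta^B$. Label circuits $C_i=\mathrm{ci}(B,e_i)$ for $1\le i\le n-r$ and the others $C_{n-r+1},\ldots,C_m$; set $d_j=j$ if $j\le n-r$ and $d_j=\min\{i: e_i\in\mathrm{coc}(B,e_j)\}$ if $j\ge n-r+1$; set $m_{C_i}=x_i^{|\overline{C}_i|}$ if $i\le n-r$ and $m_{C_i}=\prod_{e_j\in\overline{C}_i}x_{d_j}$ otherwise, where $\overline{C}=C\setminus\{\min C\}$. Let $U(M)$ be the set of monomials divisible by some $m_C$ and $L(M)$ the set of monomials not in $U(M)$. $M$ has an NBC basis (in the given ordering) if $L(M)$ is a basis of $k(\Delta_{\mathrm{BC}}(M))$. $M\setminus e$ and $M/e$ denote deletion and contraction. -}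

module Defs where

open import Level using (0ℓ)
open import Data.Bool.Base using (Bool; true; false; if_then_else_; _∨_)
open import Data.Nat.Base using (ℕ; zero; suc; _∸_; _≤_; _≤ᵇ_; _≡ᵇ_)
open import Data.Nat.Properties using (_≟_)
open import Data.Fin.Base using (Fin; toℕ)
open import Data.Fin.Subset using (Subset; _∈_; _∉_; _⊆_; _∪_; ∁; ⁅_⁆; ∣_∣; ⊥) renaming (_-_ to _∖ₛ_)
open import Data.Vec.Base using (Vec; tabulate; zipWith; _∷ʳ_) renaming (lookup to vlookup)
import Data.Vec.Properties as VecP
open import Data.List.Base using (List; []; _∷_; _++_; map; concatMap; allFin)
open import Data.List.Relation.Unary.All using (All)
open import Data.Product.Base using (Σ; ∃; ∃-syntax; _×_; _,_; proj₁; proj₂)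
open import Data.Sum.Base using (_⊎_)
open import Relation.Nullary using (¬_; Dec; yes; no)
open import Relation.Binary.PropositionalEquality using (_≡_)
open import Algebra.Bundles using (CommutativeRing)
open import Function.Bundles using (_⇔_)

record Field : Set₁ where
  field
    commRing : CommutativeRing 0ℓ 0ℓ
  open CommutativeRing commRing public
  field
    1≉0     : ¬ (1# ≈ 0#)
    inverse : ∀ x → ¬ (x ≈ 0#) → ∃[ y ] (x * y ≈ 1#)

-- Matroids on the ground set Fin n = {e_1 < ... < e_n}
-- (Fin index i stands for the element e_(i+1); the order is that of Fin).

IndepSys : ℕ → Set₁
IndepSys n = Subset n → Set

record IsMatroid {n : ℕ} (Indep : IndepSys n) : Set where
  field
    indep?    : ∀ S → Dec (Indep S)
    indep-∅   : Indep ⊥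
    hereditary : ∀ {S T} → S ⊆ T → Indep T → Indep S
    exchange  : ∀ {S T} → Indep S → Indep T → ∣ S ∣ Data.Nat.Base.< ∣ T ∣ →
                ∃[ x ] (x ∈ T × x ∉ S × Indep (S ∪ ⁅ x ⁆))

module _ {n : ℕ} (Indep : IndepSys n) where

  IsBasis : Subset n → Set
  IsBasis S = Indep S × (∀ T → S ⊆ T → Indep T → T ⊆ S)

  IsCircuit : Subset n → Set
  IsCircuit C = ¬ Indep C × (∀ D → D ⊆ C → ¬ Indep D → C ⊆ D)

  -- cocircuits: minimal sets meeting every basis (= circuits of the dual)
  MeetsAllBases : Subset n → Set
  MeetsAllBases D = ∀ B → IsBasis B → ∃[ x ] (x ∈ D × x ∈ B)

  IsCocircuit : Subset n → Set
  IsCocircuit D = MeetsAllBases D × (∀ D′ → D′ ⊆ D → MeetsAllBases D′ → D ⊆ D′)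

  IsFundCocircuit : Subset n → Fin n → Subset n → Set
  IsFundCocircuit B b D = IsCocircuit D × D ⊆ (∁ B ∪ ⁅ b ⁆) × b ∈ D

  -- ci(B,e): the circuit contained in B ∪ {e} (for e ∉ B); it contains e
  IsFundCircuit : Subset n → Fin n → Subset n → Set
  IsFundCircuit B e C = e ∉ B × IsCircuit C × C ⊆ (B ∪ ⁅ e ⁆)

  IsMin : Subset n → Fin n → Set
  IsMin C c = c ∈ C × (∀ x → x ∈ C → toℕ c ≤ toℕ x)

  IsBrokenCircuit : Subset n → Set
  IsBrokenCircuit D = ∃[ C ] ∃[ c ] (IsCircuit C × IsMin C c × D ≡ C ∖ₛ c)

  IsBCFace : Subset n → Set
  IsBCFace F = ∀ D → IsBrokenCircuit D → ¬ (D ⊆ F)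

module _ (K : Field) where
  open Field K

  sumK : ∀ {m} → (Fin m → Carrier) → Carrier
  sumK {zero}  f = 0#
  sumK {suc m} f = f Fin.zero + sumK (λ i → f (Fin.suc i))
    where import Data.Fin.Base as Fin

  ColsIndep : ∀ {m n} → (Fin m → Fin n → Carrier) → Subset n → Set
  ColsIndep {m} {n} A S =
    ∀ (c : Fin n → Carrier) → (∀ i → i ∉ S → c i ≈ 0#) →
    (∀ row → sumK (λ i → c i * A row i) ≈ 0#) → ∀ i → c i ≈ 0#

  RepresentableOver : ∀ {n} → IndepSys n → Set
  RepresentableOver {n} Indep =
    ∃[ m ] Σ (Fin m → Fin n → Carrier) λ A → ∀ S → Indep S ⇔ ColsIndep A S

IsRegular : ∀ {n} → IndepSys n → Set₁
IsRegular Indep = ∀ (K : Field) → RepresentableOver K Indep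

-- Standard ordering: B = {e_(n-r+1),...,e_n}, i.e. the Fin indices ≥ n ∸ r.

lastR : ∀ n → ℕ → Subset n
lastR n r = tabulate (λ i → (n ∸ r) ≤ᵇ toℕ i)

-- Polynomials over K in variables x_1..x_n (x_(i+1) ↔ Fin index i),
-- as finite lists of terms (coefficient , exponent vector).

Mono : ℕ → Set
Mono n = Vec ℕ n

module Poly (K : Field) (n : ℕ) where
  open Field K

  Pol : Set
  Pol = List (Carrier × Mono n)

  coeff : Pol → Mono n → Carrier
  coeff [] α = 0#
  coeff ((c , β) ∷ p) α with VecP.≡-dec _≟_ β α
  ... | yes _ = c + coeff p α
  ... | no  _ = coeff p α

  _≈ₚ_ : Pol → Pol → Set
  p ≈ₚ q = ∀ α → coeff p α ≈ coeff q α

  IsZero : Pol → Set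
  IsZero p = ∀ α → coeff p α ≈ 0#

  _+ₚ_ : Pol → Pol → Pol
  p +ₚ q = p ++ q

  -ₚ_ : Pol → Pol
  -ₚ p = map (λ t → (- proj₁ t , proj₂ t)) p

  _*ₚ_ : Pol → Pol → Pol
  p *ₚ q = concatMap (λ t → map (λ u → (proj₁ t * proj₁ u , zipWith Data.Nat.Base._+_ (proj₂ t) (proj₂ u))) q) p

  unitVec : Fin n → Mono n
  unitVec i = tabulate (λ j → if toℕ i ≡ᵇ toℕ j then 1 else 0)

  monoOf : Subset n → Mono n
  monoOf F = tabulate (λ j → if vlookup F j then 1 else 0)

  linForm : (Fin n → Carrier) → Pol
  linForm a = map (λ i → (a i , unitVec i)) (allFin n)

  sumₚ : List Pol → Pol
  sumₚ [] = []
  sumₚ (p ∷ ps) = p +ₚ sumₚ ps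

  InIdeal : (Pol → Set) → Pol → Set
  InIdeal G f = ∃[ hs ] (All (λ hg → G (proj₂ hg)) hs ×
                         f ≈ₚ sumₚ (map (λ hg → proj₁ hg *ₚ proj₂ hg) hs))

  _≤ₘ_ : Mono n → Mono n → Set
  μ ≤ₘ α = ∀ i → vlookup μ i ≤ vlookup α i

  SupportedIn : (Mono n → Set) → Pol → Set
  SupportedIn L g = All (λ t → L (proj₂ t)) g

  IsMonomialBasisOfQuotient : (Pol → Set) → (Mono n → Set) → Set
  IsMonomialBasisOfQuotient G L =
    (∀ f → ∃[ g ] (SupportedIn L g × InIdeal G (f +ₚ (-ₚ g)))) ×
    (∀ g → SupportedIn L g → InIdeal G g → IsZero g)

module NBC (K : Field) {n : ℕ} (Indep : IndepSys n) (r : ℕ) where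
  open Field K
  open Poly K n

  B : Subset n
  B = lastR n r

  PlusMinusOne : Carrier → Set
  PlusMinusOne a = (a ≈ 1#) ⊎ (a ≈ - 1#)

  -- signing of the fundamental cocircuit incidence matrix w.r.t. B
  -- (row j used for e_j ∈ B)
  IsCocircuitSigning : (Fin n → Fin n → Carrier) → Set
  IsCocircuitSigning A = ∀ j → j ∈ B → ∀ D → IsFundCocircuit Indep B j D →
    ∀ i → (i ∈ D → PlusMinusOne (A j i)) × (i ∉ D → A j i ≈ 0#)

  -- signing of the circuit incidence matrix (row C used for circuits C)
  IsCircuitSigning : (Subset n → Fin n → Carrier) → Set
  IsCircuitSigning σ = ∀ C → IsCircuit Indep C →
    ∀ i → (i ∈ C → PlusMinusOne (σ C i)) × (i ∉ C → σ C i ≈ 0#)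

  IsValidSigning : (Fin n → Fin n → Carrier) → Set
  IsValidSigning A = IsCocircuitSigning A ×
    ∃[ σ ] (IsCircuitSigning σ × (∀ j → j ∈ B → ∀ C → IsCircuit Indep C →
                                   sumK K (λ i → A j i * σ C i) ≈ 0#))

  -- generators of  I_Δ + (Θ^B) : monomials x^F, F a non-face, and θ_j
  Generators : (Fin n → Fin n → Carrier) → Pol → Set
  Generators A g =
    (∃[ F ] (¬ IsBCFace Indep F × g ≡ ((1# , monoOf F) ∷ []))) ⊎
    (∃[ j ] (j ∈ B × g ≡ linForm (A j)))

  IsD : Fin n → Fin n → Set
  IsD j i = (j ∉ B × i ≡ j) ⊎
            (j ∈ B × ∃[ D ] (IsFundCocircuit Indep B j D × IsMin Indep D i))

  IsMC : Subset n → Mono n → Set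
  IsMC C μ = ∃[ c ] (IsMin Indep C c × (
    (∃[ i ] (IsFundCircuit Indep B i C ×
       μ ≡ tabulate (λ l → if toℕ i ≡ᵇ toℕ l then ∣ C ∖ₛ c ∣ else 0))) ⊎
    ((∀ i → ¬ IsFundCircuit Indep B i C) ×
       (∀ l → ∃[ S ] ((∀ j → (j ∈ S) ⇔ (j ∈ (C ∖ₛ c) × IsD j l)) ×
                      vlookup μ l ≡ ∣ S ∣)))))

  InU : Mono n → Set
  InU α = ∃[ C ] ∃[ μ ] (IsCircuit Indep C × IsMC C μ × μ ≤ₘ α)

  InL : Mono n → Set
  InL α = (∀ i → i ∈ B → vlookup α i ≡ 0) × ¬ InU α

  HasNBCBasis : Set
  HasNBCBasis = ∀ A → IsValidSigning A →
    IsMonomialBasisOfQuotient (Generators A) InL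

deleteLast : ∀ {n′} → IndepSys (suc n′) → IndepSys n′
deleteLast Indep S = Indep (S ∷ʳ false)

contractLast : ∀ {n′} → IndepSys (suc n′) → IndepSys n′
contractLast {n′} Indep S =
  (Indep (⊥ ∷ʳ true) × Indep (S ∷ʳ true)) ⊎ (¬ Indep (⊥ ∷ʳ true) × Indep (S ∷ʳ false))

-- the subset {e_n , e_(n-r)} of E = Fin (suc n′)  (Fin indices n′ and n′ ∸ r)
pairLast : ∀ n′ → ℕ → Subset (suc n′)
pairLast n′ r = tabulate (λ i → (toℕ i ≡ᵇ n′) ∨ (toℕ i ≡ᵇ (n′ ∸ r)))

-- Write e for the last element and p for its partner in the series pair. A circuit contains e iff it contains p, and
-- the linear form of e reads ±xₑ ± xₚ, so xₑ = s xₚ in k(M) with s = ±1. On monomials this gives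
-- L(M) = L(M \ e) ⊔ xₚ L(M / e), and on rings the sequence k(M / e) → k(M) → k(M \ e) → 0, whose first map is
-- multiplication by xₚ. Right exactness yields that L(M) spans.
--
-- For independence, multiplication by xₚ has to be injective, which by the snake lemma follows once every relation
-- between the forms Θ modulo I + (xₑ) is trivial, where I is the broken circuit ideal: the first Koszul homology of Θ
-- vanishes there. This vanishing passes from I + (x) and I : x to I. Adding or inverting the variables from the last
-- to the first, and adding xᵢ only if a basis survives among the elements not deleted, one ends at the unit ideal or
-- at an ideal (xᵢ : i ∉ F) with F a basis. Modulo the latter Θ is an invertible linear transform of the variables
-- xᵢ, i ∈ F, whose relations are trivial.

{-# OPTIONS --safe #-}
module Submission where

open import Defs
open import Level using (0ℓ)
open import Data.Bool.Base using (Bool; true; false; if_then_else_; _∨_)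
import Data.Bool.Properties as BoolP
open import Data.Nat.Base as ℕ using (ℕ; zero; suc; _≤_; _<_; _∸_; z≤n; s≤s; _≡ᵇ_)
import Data.Nat.Properties as ℕP
open import Data.Fin.Base as Fin using (Fin; zero; suc; toℕ; inject₁; fromℕ)
import Data.Fin.Properties as FinP
open import Data.Fin.Subset using (Subset; _∈_; _∉_; _⊆_; _⊂_; _∪_; ∁; ⁅_⁆; ∣_∣; ⊥; inside; outside) renaming (_-_ to _∖_)
import Data.Fin.Subset.Properties as SubP
import Data.Fin.Subset.Induction as SubI
open import Data.Vec.Base as Vec using (Vec; []; _∷_; tabulate; zipWith; _∷ʳ_; here; there)
import Data.Vec.Properties as VecP
open import Data.List.Base as List using (List; []; _∷_; _++_)
import Data.List.Properties as ListP
import Data.List.Relation.Unary.All.Properties as AllP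
open import Data.List.Relation.Unary.All as All using (All; []; _∷_)
open import Data.Product.Base using (Σ; ∃; ∃-syntax; _×_; _,_; proj₁; proj₂)
open import Data.Sum.Base using (_⊎_; inj₁; inj₂; [_,_]′)
open import Data.Empty using (⊥-elim)
open import Data.Maybe.Base using (Maybe; just; nothing)
open import Relation.Nullary using (¬_; Dec; yes; no; contradiction)
import Relation.Nullary.Decidable as Dec
open import Relation.Binary.PropositionalEquality as ≡ using (_≡_; _≢_; refl)
open import Algebra.Bundles using (CommutativeRing; RawRing)
open import Function.Base using (_∘_; id)
open import Function.Bundles using (_⇔_; mk⇔; Equivalence)
open import Algebra.Solver.Ring.AlmostCommutativeRing using (fromCommutativeRing; _-Raw-AlmostCommutative⟶_)
import Algebra.Solver.Ring as RingSolver
import Algebra.Properties.Ring as RingProperties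
import Algebra.Properties.AbelianGroup as AbelianGroupProperties
import Algebra.Properties.CommutativeSemigroup as CommutativeSemigroupProperties
import Algebra.Properties.Semiring.Mult as SemiringMult
import Algebra.Properties.Semiring.Exp as SemiringExp
import Algebra.Properties.Semiring.Sum as SemiringSum
import Relation.Binary.Reasoning.Setoid as SetoidReasoning

-- Multiplication by x gives the exact sequence 0 → R/(I : x) → R/I → R/(I + (x)) → 0, and modulo Θ
-- its first map stays injective once the first Koszul homology of the right-hand term vanishes.
-- That homology is used rather than regularity of the sequence Θ because it refers to no order of
-- the forms, survives an invertible linear change, and passes from the outer terms to the middle
-- one. The recursion must respect the condition that a basis survives: without one, Θ has more
-- forms than the quotient has dimension, and nontrivial relations have to be expected. It is not
-- stuck there: if every basis left contains e, then I : xₑ = I, and inverting xₑ costs nothing.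
-- This is where the order from last to first enters. A broken circuit through e has lost an element
-- smaller than e, which has not been treated yet and so has not been deleted; hence the complete
-- circuit is still available, and exchanging e along it would produce a basis without e.

-- Identities with integer coefficients in a commutative ring.

module IntegerSolver (R : CommutativeRing 0ℓ 0ℓ) where
  open CommutativeRing R
  open RingProperties ring using (-‿distribˡ-*; -‿distribʳ-*)
  open AbelianGroupProperties +-abelianGroup using () renaming (⁻¹-∙-comm to -‿+-comm; ⁻¹-involutive to -‿involutive; ε⁻¹≈ε to -0#≈0#)
  open SemiringMult semiring using (×-homo-+; ×1-homo-*) renaming (_×_ to _·_)
  open CommutativeSemigroupProperties +-commutativeSemigroup using (interchange)
  open SetoidReasoning setoid

  private
    -- The integer a − b is coded by the pair (a , b).
    coefficients : RawRing 0ℓ 0ℓ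
    coefficients = record
      { Carrier = ℕ × ℕ
      ; _≈_ = _≡_
      ; _+_ = λ (a , b) (c , d) → a ℕ.+ c , b ℕ.+ d
      ; _*_ = λ (a , b) (c , d) → a ℕ.* c ℕ.+ b ℕ.* d , a ℕ.* d ℕ.+ b ℕ.* c
      ; -_  = λ (a , b) → b , a
      ; 0#  = 0 , 0
      ; 1#  = 1 , 0
      }

    ⟦_⟧ : ℕ × ℕ → Carrier
    ⟦ a , b ⟧ = a · 1# - b · 1#

    sub-interchange : ∀ x y z w → (x + z) - (y + w) ≈ (x - y) + (z - w)
    sub-interchange x y z w = trans (+-congˡ (sym (-‿+-comm y w))) (interchange x z (- y) (- w))

    sub-* : ∀ x y z w → (x * z + y * w) - (x * w + y * z) ≈ (x - y) * (z - w)
    sub-* x y z w = begin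
      (x * z + y * w) - (x * w + y * z)          ≈⟨ sub-interchange _ _ _ _ ⟩
      (x * z - x * w) + (y * w - y * z)          ≈⟨ +-cong (+-congˡ (-‿distribʳ-* x w)) (trans (+-comm _ _) (+-cong (-‿distribˡ-* y z)
                                                      (trans (sym (-‿involutive _)) (trans (-‿cong (-‿distribˡ-* y w)) (-‿distribʳ-* (- y) w))))) ⟩
      (x * z + x * - w) + (- y * z + - y * - w)  ≈⟨ +-cong (sym (distribˡ _ _ _)) (sym (distribˡ _ _ _)) ⟩
      x * (z - w) + - y * (z - w)                ≈⟨ distribʳ _ _ _ ⟨
      (x - y) * (z - w)                          ∎

    morphism : coefficients -Raw-AlmostCommutative⟶ fromCommutativeRing R
    morphism = record
      { ⟦_⟧ = ⟦_⟧
      ; +-homo = λ (a , b) (c , d) → trans (+-cong (×-homo-+ 1# a c) (-‿cong (×-homo-+ 1# b d))) (sub-interchange _ _ _ _)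
      ; *-homo = λ (a , b) (c , d) → trans
          (+-cong (trans (×-homo-+ 1# (a ℕ.* c) (b ℕ.* d)) (+-cong (×1-homo-* a c) (×1-homo-* b d)))
                  (-‿cong (trans (×-homo-+ 1# (a ℕ.* d) (b ℕ.* c)) (+-cong (×1-homo-* a d) (×1-homo-* b c)))))
          (sub-* _ _ _ _)
      ; -‿homo = λ (a , b) → trans (+-comm _ _) (trans (+-congˡ (sym (-‿involutive _))) (-‿+-comm _ _))
      ; 0-homo = -‿inverseʳ 0#
      ; 1-homo = trans (+-congˡ -0#≈0#) (trans (+-identityʳ _) (+-identityʳ _))
      }

    sub-equal : ∀ x y z w → x + w ≈ z + y → x - y ≈ z - w
    sub-equal x y z w eq = begin
      x - y              ≈⟨ +-identityʳ _ ⟨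
      (x - y) + 0#       ≈⟨ +-congˡ (-‿inverseʳ w) ⟨
      (x - y) + (w - w)  ≈⟨ interchange _ _ _ _ ⟩
      (x + w) + (- y - w) ≈⟨ +-cong eq (+-comm _ _) ⟩
      (z + y) + (- w - y) ≈⟨ interchange _ _ _ _ ⟩
      (z - w) + (y - y)  ≈⟨ +-congˡ (-‿inverseʳ y) ⟩
      (z - w) + 0#       ≈⟨ +-identityʳ _ ⟩
      z - w              ∎

    -- Different pairs may code the same integer, so a + d is compared with c + b. A failed test
    -- refutes nothing, since the ring may have positive characteristic.
    decide : ∀ p q → Maybe (⟦ p ⟧ ≈ ⟦ q ⟧)
    decide (a , b) (c , d) with a ℕ.+ d ℕP.≟ c ℕ.+ b
    ... | yes eq = just (sub-equal _ _ _ _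
            (trans (sym (×-homo-+ 1# a d)) (trans (reflexive (≡.cong (_· 1#) eq)) (×-homo-+ 1# c b))))
    ... | no _   = nothing

  open RingSolver coefficients (fromCommutativeRing R) morphism decide public
    using (solve; _:=_; _:+_; _:*_; _:-_; :-_)

-- Finite sums and the Kronecker delta.

module RingSums (R : CommutativeRing 0ℓ 0ℓ) where
  open CommutativeRing R hiding (zero) renaming (refl to ≈-refl)
  open SemiringSum semiring public
    using (sum; sum-cong-≋; ∑-distrib-+; ∑-comm; *-distribˡ-sum; *-distribʳ-sum; sum-init-last; sum-replicate-zero)
  open AbelianGroupProperties +-abelianGroup using (⁻¹-∙-comm; ε⁻¹≈ε)

  sum-cong : ∀ {n} {f g : Fin n → Carrier} → (∀ i → f i ≈ g i) → sum f ≈ sum g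
  sum-cong = sum-cong-≋

  sum-zero : ∀ {n} {f : Fin n → Carrier} → (∀ i → f i ≈ 0#) → sum f ≈ 0#
  sum-zero {n} f≈0 = trans (sum-cong f≈0) (sum-replicate-zero n)

  sum-neg : ∀ {n} (f : Fin n → Carrier) → sum (λ i → - f i) ≈ - sum f
  sum-neg {zero}  f = sym ε⁻¹≈ε
  sum-neg {suc n} f = trans (+-congˡ (sum-neg (f ∘ suc))) (⁻¹-∙-comm _ _)

  sum-sub : ∀ {n} (f g : Fin n → Carrier) → sum (λ i → f i - g i) ≈ sum f - sum g
  sum-sub f g = trans (∑-distrib-+ f (λ i → - g i)) (+-congˡ (sum-neg g))

  -- Recursion on both indices, rather than an equality test, lets `sum-δ` follow the recursion of
  -- `sum`.
  δ : ∀ {n} → Fin n → Fin n → Carrier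
  δ zero    zero    = 1#
  δ zero    (suc j) = 0#
  δ (suc i) zero    = 0#
  δ (suc i) (suc j) = δ i j

  δ-refl : ∀ {n} (i : Fin n) → δ i i ≈ 1#
  δ-refl zero    = ≈-refl
  δ-refl (suc i) = δ-refl i

  δ-≢ : ∀ {n} {i j : Fin n} → i ≢ j → δ i j ≈ 0#
  δ-≢ {i = zero}  {zero}  i≢j = contradiction refl i≢j
  δ-≢ {i = zero}  {suc j} i≢j = ≈-refl
  δ-≢ {i = suc i} {zero}  i≢j = ≈-refl
  δ-≢ {i = suc i} {suc j} i≢j = δ-≢ (i≢j ∘ ≡.cong suc)

  sum-δ : ∀ {n} (e : Fin n) (g : Fin n → Carrier) → sum (λ i → δ i e * g i) ≈ g e
  sum-δ zero    g = trans (+-cong (*-identityˡ _) (sum-zero λ i → zeroˡ (g (suc i)))) (+-identityʳ _)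
  sum-δ (suc e) g = trans (+-cong (zeroˡ _) (sum-δ e (g ∘ suc))) (+-identityˡ _)

  sum-δʳ : ∀ {n} (e : Fin n) (g : Fin n → Carrier) → sum (λ i → g i * δ i e) ≈ g e
  sum-δʳ e g = trans (sum-cong λ i → *-comm (g i) (δ i e)) (sum-δ e g)

-- Ideals, colon ideals and quotient rings.

module Ideals (R : CommutativeRing 0ℓ 0ℓ) where
  open CommutativeRing R hiding (zero) renaming (refl to ≈-refl)
  open RingSums R
  open RingProperties ring using (-1*x≈-x)
  open IntegerSolver R

  record IsIdeal (I : Carrier → Set) : Set where
    field
      resp : ∀ {x y} → x ≈ y → I x → I y
      0∈   : I 0#
      +∈   : ∀ {x y} → I x → I y → I (x + y)
      *∈   : ∀ x {y} → I y → I (x * y)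

    neg∈ : ∀ {x} → I x → I (- x)
    neg∈ Ix = resp (-1*x≈-x _) (*∈ (- 1#) Ix)

    sub∈ : ∀ {x y} → I x → I y → I (x - y)
    sub∈ Ix Iy = +∈ Ix (neg∈ Iy)

    *∈ʳ : ∀ {x} y → I x → I (x * y)
    *∈ʳ y Ix = resp (*-comm _ _) (*∈ y Ix)

    ≈0∈ : ∀ {x} → x ≈ 0# → I x
    ≈0∈ x≈0 = resp (sym x≈0) 0∈

    ≈⇒∈ : ∀ {x y} → x ≈ y → I (x - y)
    ≈⇒∈ x≈y = ≈0∈ (trans (+-congʳ x≈y) (-‿inverseʳ _))

    sum∈ : ∀ {n} (f : Fin n → Carrier) → (∀ i → I (f i)) → I (sum f)
    sum∈ {zero}  f f∈ = 0∈
    sum∈ {suc n} f f∈ = +∈ (f∈ zero) (sum∈ (f ∘ suc) (f∈ ∘ suc))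

    -- By `sum-δ` the value `f e` is itself a sum, so the difference can be taken termwise: the term
    -- at `e` becomes zero and the others are in `I` already.
    sum-except∈ : ∀ {n} (e : Fin n) (f : Fin n → Carrier) → (∀ i → i ≢ e → I (f i)) → I (sum f - f e)
    sum-except∈ e f f∈ = resp
      (trans (sum-sub f _) (+-congˡ (-‿cong (sum-δ e f))))
      (sum∈ _ term)
      where
      term : ∀ i → I (f i - δ i e * f i)
      term i with i FinP.≟ e
      ... | yes refl = ≈0∈ (trans (+-congˡ (-‿cong (trans (*-congʳ (δ-refl i)) (*-identityˡ _)))) (-‿inverseʳ _))
      ... | no i≢e   = sub∈ (f∈ i i≢e) (≈0∈ (trans (*-congʳ (δ-≢ i≢e)) (zeroˡ _)))

  colon : (Carrier → Set) → Carrier → Carrier → Set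
  colon I x z = I (x * z)

  colon-isIdeal : ∀ {I} → IsIdeal I → ∀ x → IsIdeal (colon I x)
  colon-isIdeal {I} isI x = record
    { resp = λ eq → resp (*-congˡ eq)
    ; 0∈   = ≈0∈ (zeroʳ x)
    ; +∈   = λ Iy Iz → resp (sym (distribˡ _ _ _)) (+∈ Iy Iz)
    ; *∈   = λ w {y} Iy → resp (solve 3 (λ w x y → w :* (x :* y) := x :* (w :* y)) ≈-refl w x y) (*∈ w Iy)
    }
    where open IsIdeal isI

  -- The carrier is kept and only the equality is coarsened, so statements proved for all rings
  -- apply modulo `I` to the same elements.
  quotient : ∀ {I} → IsIdeal I → CommutativeRing 0ℓ 0ℓ
  quotient {I} isI = record
    { Carrier = Carrier
    ; _≈_ = λ x y → I (x - y)
    ; _+_ = _+_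
    ; _*_ = _*_
    ; -_ = -_
    ; 0# = 0#
    ; 1# = 1#
    ; isCommutativeRing = record
      { isRing = record
        { +-isAbelianGroup = record
          { isGroup = record
            { isMonoid = record
              { isSemigroup = record
                { isMagma = record
                  { isEquivalence = record
                    { refl  = ≈⇒∈ ≈-refl
                    ; sym   = λ {x} {y} p → resp (solve 2 (λ x y → :- (x :- y) := y :- x) ≈-refl x y) (neg∈ p)
                    ; trans = λ {x} {y} {z} p q → resp (solve 3 (λ x y z → (x :- y) :+ (y :- z) := x :- z) ≈-refl x y z) (+∈ p q)
                    }
                  ; ∙-cong = λ {x} {y} {u} {v} p q → resp
                      (solve 4 (λ x y u v → (x :- y) :+ (u :- v) := (x :+ u) :- (y :+ v)) ≈-refl x y u v) (+∈ p q)
                  }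
                ; assoc = λ x y z → ≈⇒∈ (+-assoc x y z)
                }
              ; identity = (λ x → ≈⇒∈ (+-identityˡ x)) , (λ x → ≈⇒∈ (+-identityʳ x))
              }
            ; inverse = (λ x → ≈⇒∈ (-‿inverseˡ x)) , (λ x → ≈⇒∈ (-‿inverseʳ x))
            ; ⁻¹-cong = λ {x} {y} p → resp (solve 2 (λ x y → :- (x :- y) := (:- x) :- (:- y)) ≈-refl x y) (neg∈ p)
            }
          ; comm = λ x y → ≈⇒∈ (+-comm x y)
          }
        ; *-cong = λ {x} {y} {u} {v} p q → resp
            (solve 4 (λ x y u v → u :* (x :- y) :+ y :* (u :- v) := (x :* u) :- (y :* v)) ≈-refl x y u v)
            (+∈ (*∈ u p) (*∈ y q))
        ; *-assoc = λ x y z → ≈⇒∈ (*-assoc x y z)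
        ; *-identity = (λ x → ≈⇒∈ (*-identityˡ x)) , (λ x → ≈⇒∈ (*-identityʳ x))
        ; distrib = (λ x y z → ≈⇒∈ (distribˡ x y z)) , (λ x y z → ≈⇒∈ (distribʳ x y z))
        }
      ; *-comm = λ x y → ≈⇒∈ (*-comm x y)
      }
    }
    where
    open IsIdeal isI

-- Trivial relations and invertible linear changes.

module Koszul (R : CommutativeRing 0ℓ 0ℓ) where
  open CommutativeRing R hiding (zero) renaming (refl to ≈-refl)
  open RingSums R
  open IntegerSolver R
  open SetoidReasoning setoid

  -- The j-th coefficient of the trivial relation Σᵢⱼ fᵢⱼ (θᵢ eⱼ − θⱼ eᵢ).
  koszul : ∀ {n} → (Fin n → Carrier) → (Fin n → Fin n → Carrier) → Fin n → Carrier
  koszul θ f j = sum (λ i → (f i j - f j i) * θ i)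

  -- Vanishing of the first Koszul homology of (θⱼ), j ∈ S: every relation is trivial.
  Exact : ∀ {n} → (Fin n → Carrier) → Subset n → Set
  Exact {n} θ S = ∀ (b : Fin n → Carrier) → sum (λ j → b j * θ j) ≈ 0# →
                  Σ (Fin n → Fin n → Carrier) λ f → ∀ j → j ∈ S → b j ≈ koszul θ f j

  koszul-split : ∀ {n} (θ : Fin n → Carrier) f j →
                 koszul θ f j ≈ sum (λ i → f i j * θ i) - sum (λ i → f j i * θ i)
  koszul-split θ f j = trans
    (sum-cong λ i → solve 3 (λ x y t → (x :- y) :* t := x :* t :- y :* t) ≈-refl (f i j) (f j i) (θ i))
    (sum-sub (λ i → f i j * θ i) (λ i → f j i * θ i))

  -- The coefficients are antisymmetric in i and j while θᵢθⱼ is symmetric, so the two halves of the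
  -- double sum agree after exchanging the summations.
  koszul-relation : ∀ {n} (θ : Fin n → Carrier) f → sum (λ j → koszul θ f j * θ j) ≈ 0#
  koszul-relation θ f = begin
    sum (λ j → koszul θ f j * θ j)
      ≈⟨ sum-cong (λ j → trans (*-distribʳ-sum (θ j) (λ i → (f i j - f j i) * θ i)) (sum-cong λ i →
           solve 4 (λ x y t u → (x :- y) :* t :* u := x :* (t :* u) :- y :* (u :* t)) ≈-refl (f i j) (f j i) (θ i) (θ j))) ⟩
    sum (λ j → sum (λ i → T i j - T j i))
      ≈⟨ trans (sum-cong λ j → sum-sub (λ i → T i j) (T j)) (sum-sub (λ j → sum (λ i → T i j)) (λ j → sum (T j))) ⟩
    sum (λ j → sum (λ i → T i j)) - sum (λ j → sum (λ i → T j i))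
      ≈⟨ +-congʳ (∑-comm (λ j i → T i j)) ⟩
    sum (λ i → sum (λ j → T i j)) - sum (λ j → sum (λ i → T j i))
      ≈⟨ -‿inverseʳ _ ⟩
    0# ∎
    where
    T = λ i j → f i j * (θ i * θ j)

  koszul-+* : ∀ {n} (θ : Fin n → Carrier) f x g j →
              koszul θ (λ i k → f i k + x * g i k) j ≈ koszul θ f j + x * koszul θ g j
  koszul-+* θ f x g j = begin
    koszul θ (λ i k → f i k + x * g i k) j
      ≈⟨ sum-cong (λ i → solve 6 (λ f f′ x g g′ t → ((f :+ x :* g) :- (f′ :+ x :* g′)) :* t
           := (f :- f′) :* t :+ x :* ((g :- g′) :* t)) ≈-refl (f i j) (f j i) x (g i j) (g j i) (θ i)) ⟩
    sum (λ i → (f i j - f j i) * θ i + x * ((g i j - g j i) * θ i))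
      ≈⟨ trans (∑-distrib-+ (λ i → (f i j - f j i) * θ i) (λ i → x * ((g i j - g j i) * θ i)))
                (+-congˡ (sym (*-distribˡ-sum x (λ i → (g i j - g j i) * θ i)))) ⟩
    koszul θ f j + x * koszul θ g j ∎

  module _ {m n : ℕ} (a : Fin m → Fin n → Carrier) (G : Fin n → Fin m → Carrier) (S : Subset m) (F : Subset n)
           (aG≈δ : ∀ l j → j ∈ S → sum (λ i → a l i * G i j) ≈ δ l j)
           (Ga≈δ : ∀ k i → k ∈ F → i ∈ F → sum (λ l → G k l * a l i) ≈ δ k i)
           (G≈0 : ∀ k l → k ∉ F → G k l ≈ 0#)
           {X : Fin n → Carrier} (X≈0 : ∀ i → i ∉ F → X i ≈ 0#)
           {θ : Fin m → Carrier} (θ≈aX : ∀ j → θ j ≈ sum (λ i → a j i * X i)) where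

    private
      -- Only the block of Ga indexed by `F` is known to be the identity; every other entry meets
      -- some `X i` with i outside `F`, which is zero.
      Gθ≈X : ∀ k → sum (λ l → G k l * θ l) ≈ X k
      Gθ≈X k with k SubP.∈? F
      ... | no k∉F  = trans (sum-zero λ l → trans (*-congʳ (G≈0 k l k∉F)) (zeroˡ _)) (sym (X≈0 k k∉F))
      ... | yes k∈F = begin
        sum (λ l → G k l * θ l)
          ≈⟨ sum-cong (λ l → trans (*-congˡ (θ≈aX l)) (trans (*-distribˡ-sum (G k l) (λ i → a l i * X i)) (sum-cong λ i → sym (*-assoc (G k l) (a l i) (X i))))) ⟩
        sum (λ l → sum (λ i → G k l * a l i * X i))
          ≈⟨ ∑-comm (λ l i → G k l * a l i * X i) ⟩
        sum (λ i → sum (λ l → G k l * a l i * X i))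
          ≈⟨ sum-cong (λ i → trans (sym (*-distribʳ-sum (X i) (λ l → G k l * a l i))) (row i)) ⟩
        sum (λ i → X i * δ i k)
          ≈⟨ sum-δʳ k X ⟩
        X k ∎
        where
        row : ∀ i → sum (λ l → G k l * a l i) * X i ≈ X i * δ i k
        row i with i SubP.∈? F
        ... | no i∉F  = trans (trans (*-congˡ (X≈0 i i∉F)) (zeroʳ _)) (sym (trans (*-congʳ (X≈0 i i∉F)) (zeroˡ _)))
        ... | yes i∈F with k FinP.≟ i
        ...   | yes refl = trans (*-congʳ (Ga≈δ k k k∈F k∈F)) (*-comm _ _)
        ...   | no k≢i   = trans (*-congʳ (trans (Ga≈δ k i k∈F i∈F) (trans (δ-≢ k≢i) (sym (δ-≢ (k≢i ∘ ≡.sym)))))) (*-comm _ _)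

      contract : ∀ (c : Fin n → Fin n → Carrier) →
                 sum (λ l → sum (λ i → sum (λ k → G k l * c i k)) * θ l) ≈ sum (λ i → sum (λ k → c i k * X k))
      contract c = begin
        sum (λ l → sum (λ i → sum (λ k → G k l * c i k)) * θ l)
          ≈⟨ sum-cong (λ l → trans (*-distribʳ-sum (θ l) (λ i → sum (λ k → G k l * c i k))) (sum-cong λ i → trans (*-distribʳ-sum (θ l) (λ k → G k l * c i k)) (sum-cong λ k →
               solve 3 (λ g c t → g :* c :* t := c :* (g :* t)) ≈-refl (G k l) (c i k) (θ l)))) ⟩
        sum (λ l → sum (λ i → sum (λ k → c i k * (G k l * θ l))))
          ≈⟨ ∑-comm (λ l i → sum (λ k → c i k * (G k l * θ l))) ⟩
        sum (λ i → sum (λ l → sum (λ k → c i k * (G k l * θ l))))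
          ≈⟨ sum-cong (λ i → trans (∑-comm (λ l k → c i k * (G k l * θ l))) (sum-cong λ k →
               trans (sym (*-distribˡ-sum (c i k) (λ l → G k l * θ l))) (*-congˡ (Gθ≈X k)))) ⟩
        sum (λ i → sum (λ k → c i k * X k)) ∎

    -- A relation b among the θ becomes the relation β = ba among the X. If φ shows that β is
    -- trivial, then Gᵗ φ G shows it for b: each Gθ contracts to X, and b is recovered as βG =
    -- b(aG).
    exact-linear-change : Exact X F → Exact θ S
    exact-linear-change exactX b bθ≈0 = f , λ j j∈S → sym (begin
      koszul θ f j
        ≈⟨ koszul-split θ f j ⟩
      sum (λ l → f l j * θ l) - sum (λ l → f j l * θ l)
        ≈⟨ +-cong (contract (λ i k → φ k i * G i j))
                  (-‿cong (trans (sum-cong λ l → *-congʳ (transpose l j)) (contract (λ i k → φ i k * G i j)))) ⟩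
      sum (λ i → sum (λ k → φ k i * G i j * X k)) - sum (λ i → sum (λ k → φ i k * G i j * X k))
        ≈⟨ trans (sym (sum-sub (λ i → sum (λ k → φ k i * G i j * X k)) (λ i → sum (λ k → φ i k * G i j * X k))))
                (sum-cong λ i → sym (sum-sub (λ k → φ k i * G i j * X k) (λ k → φ i k * G i j * X k))) ⟩
      sum (λ i → sum (λ k → φ k i * G i j * X k - φ i k * G i j * X k))
        ≈⟨ sum-cong (λ i → trans (sum-cong λ k → solve 4 (λ p q g x → p :* g :* x :- q :* g :* x := g :* ((p :- q) :* x))
                                                    ≈-refl (φ k i) (φ i k) (G i j) (X k))
                                 (sym (*-distribˡ-sum (G i j) (λ k → (φ k i - φ i k) * X k)))) ⟩
      sum (λ i → G i j * koszul X φ i)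
        ≈⟨ sum-cong (λ i → row i j) ⟩
      sum (λ i → G i j * β i)
        ≈⟨ sum-cong (λ i → trans (*-distribˡ-sum (G i j) (λ l → b l * a l i)) (sum-cong λ l →
             solve 3 (λ g b a → g :* (b :* a) := b :* (a :* g)) ≈-refl (G i j) (b l) (a l i))) ⟩
      sum (λ i → sum (λ l → b l * (a l i * G i j)))
        ≈⟨ ∑-comm (λ i l → b l * (a l i * G i j)) ⟩
      sum (λ l → sum (λ i → b l * (a l i * G i j)))
        ≈⟨ sum-cong (λ l → trans (sym (*-distribˡ-sum (b l) (λ i → a l i * G i j))) (*-congˡ (aG≈δ l j j∈S))) ⟩
      sum (λ l → b l * δ l j)
        ≈⟨ sum-δʳ j b ⟩
      b j ∎)
      where
      β : Fin n → Carrier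
      β i = sum (λ l → b l * a l i)

      βX≈0 : sum (λ i → β i * X i) ≈ 0#
      βX≈0 = begin
        sum (λ i → β i * X i)
          ≈⟨ sum-cong (λ i → trans (*-distribʳ-sum (X i) (λ l → b l * a l i)) (sum-cong λ l → *-assoc (b l) (a l i) (X i))) ⟩
        sum (λ i → sum (λ l → b l * (a l i * X i)))
          ≈⟨ ∑-comm (λ i l → b l * (a l i * X i)) ⟩
        sum (λ l → sum (λ i → b l * (a l i * X i)))
          ≈⟨ sum-cong (λ l → trans (sym (*-distribˡ-sum (b l) (λ i → a l i * X i))) (*-congˡ (sym (θ≈aX l)))) ⟩
        sum (λ l → b l * θ l)
          ≈⟨ bθ≈0 ⟩
        0# ∎

      φ = proj₁ (exactX β βX≈0)

      f : Fin m → Fin m → Carrier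
      f l j = sum (λ i → sum (λ k → G k l * (φ k i * G i j)))

      transpose : ∀ l j → f j l ≈ sum (λ i → sum (λ k → G k l * (φ i k * G i j)))
      transpose l j = trans (∑-comm (λ i k → G k j * (φ k i * G i l)))
        (sum-cong λ k → sum-cong λ i → solve 3 (λ g p h → g :* (p :* h) := h :* (p :* g)) ≈-refl (G k j) (φ k i) (G i l))

      -- Exactness for X says nothing about β outside `F`, but there G vanishes.
      row : ∀ i j → G i j * koszul X φ i ≈ G i j * β i
      row i j with i SubP.∈? F
      ... | yes i∈F = *-congˡ (sym (proj₂ (exactX β βX≈0) i i∈F))
      ... | no i∉F  = trans (*-congʳ (G≈0 i j i∉F)) (trans (zeroˡ _) (sym (trans (*-congʳ (G≈0 i j i∉F)) (zeroˡ _))))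

-- Koszul exactness modulo a varying ideal.

module KoszulModulo (R : CommutativeRing 0ℓ 0ℓ) where
  open CommutativeRing R hiding (zero) renaming (refl to ≈-refl)
  open RingSums R
  open Ideals R
  open Koszul R
  open IntegerSolver R
  open SetoidReasoning setoid

  -- Exactness over the quotient by `I`, phrased by membership so that the ideal can vary while the
  -- ring stays fixed.
  ExactMod : ∀ {n} → (Carrier → Set) → (Fin n → Carrier) → Subset n → Set
  ExactMod {n} I θ S = ∀ (b : Fin n → Carrier) → I (sum (λ j → b j * θ j)) →
                       Σ (Fin n → Fin n → Carrier) λ f → ∀ j → j ∈ S → I (b j - koszul θ f j)

  module _ {I : Carrier → Set} (isI : IsIdeal I) where
    open IsIdeal isI

    private
      sub-0 : ∀ x → x - 0# ≈ x
      sub-0 x = trans (+-congˡ (trans (sym (+-identityˡ _)) (-‿inverseʳ 0#))) (+-identityʳ x)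

    exact⇒exactMod : ∀ {n} {θ : Fin n → Carrier} {S} → Koszul.Exact (quotient isI) θ S → ExactMod I θ S
    exact⇒exactMod exact b bθ∈ = exact b (resp (sym (sub-0 _)) bθ∈)

    exactMod⇒exact : ∀ {n} {θ : Fin n → Carrier} {S} → ExactMod I θ S → Koszul.Exact (quotient isI) θ S
    exactMod⇒exact exact b bθ∈ = exact b (resp (sub-0 _) bθ∈)

    -- The connecting map: a relation modulo I + (x) is, up to trivial relations, x times a family modulo I.
    record Division {n} (θ : Fin n → Carrier) (S : Subset n) (x : Carrier) (b : Fin n → Carrier) : Set where
      field
        trivial   : Fin n → Fin n → Carrier
        quot      : Fin n → Carrier
        remainder : ∀ j → j ∈ S → I (b j - koszul θ trivial j - x * quot j)

      sum-remainder : sum (λ j → (b j - koszul θ trivial j - x * quot j) * θ j) ≈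
                      sum (λ j → b j * θ j) - x * sum (λ j → quot j * θ j)
      sum-remainder = begin
        sum (λ j → (b j - κ j - x * quot j) * θ j)
          ≈⟨ sum-cong (λ j → solve 5 (λ b k x q t → (b :- k :- x :* q) :* t := (b :* t :- k :* t) :- x :* (q :* t)) ≈-refl
                                   (b j) (κ j) x (quot j) (θ j)) ⟩
        sum (λ j → (b j * θ j - κ j * θ j) - x * (quot j * θ j))
          ≈⟨ trans (sum-sub (λ j → b j * θ j - κ j * θ j) (λ j → x * (quot j * θ j)))
                   (+-cong (sum-sub (λ j → b j * θ j) (λ j → κ j * θ j)) (-‿cong (sym (*-distribˡ-sum x (λ j → quot j * θ j))))) ⟩
        sum (λ j → b j * θ j) - sum (λ j → κ j * θ j) - x * sum (λ j → quot j * θ j)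
          ≈⟨ +-congʳ (trans (+-congˡ (-‿cong (koszul-relation θ trivial))) (sub-0 _)) ⟩
        sum (λ j → b j * θ j) - x * sum (λ j → quot j * θ j) ∎
        where κ = koszul θ trivial

    -- The remainder is controlled only at indices in `S`; at the others `θ j` itself lies in `I`.
    division-sum : ∀ {n} {θ : Fin n → Carrier} {S x b} → (∀ j → j ∉ S → I (θ j)) → (d : Division θ S x b) →
                   I (sum (λ j → b j * θ j) - x * sum (λ j → Division.quot d j * θ j))
    division-sum {θ = θ} {S} {x} {b} θ∈ d = resp sum-remainder (sum∈ _ term)
      where
      open Division d
      term : ∀ j → I ((b j - koszul θ trivial j - x * quot j) * θ j)
      term j with j SubP.∈? S
      ... | yes j∈S = *∈ʳ (θ j) (remainder j j∈S)
      ... | no j∉S  = *∈ _ (θ∈ j j∉S)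

    module _ {n : ℕ} {θ : Fin n → Carrier} {S : Subset n} {J : Carrier → Set} {x : Carrier}
             (split : ∀ {y} → J y → ∃[ z ] I (y - x * z)) (exactJ : ExactMod J θ S) where

      divide : ∀ b → J (sum (λ j → b j * θ j)) → Division θ S x b
      divide b bθ∈ = record
        { trivial   = proj₁ relation
        ; quot      = proj₁ ∘ quots
        ; remainder = proj₂ ∘ quots
        }
        where
        relation = exactJ b bθ∈
        quots : ∀ j → ∃[ q ] (j ∈ S → I (b j - koszul θ (proj₁ relation) j - x * q))
        quots j with j SubP.∈? S
        -- Indices outside `S` carry no condition, so any quotient serves.
        ... | no j∉S  = 0# , λ j∈S → contradiction j∈S j∉S
        ... | yes j∈S with split (proj₂ relation j j∈S)
        ...   | q , q∈ = q , λ _ → q∈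

      -- The family `quot` from the division is a relation modulo I : x. If it agrees there with the
      -- trivial relation of `f`, then x times it agrees modulo I with the trivial relation of x f,
      -- and the two trivial parts add up.
      exact-extension : (∀ {y} → I y → J y) → (∀ j → j ∉ S → I (θ j)) → ExactMod (colon I x) θ S → ExactMod I θ S
      exact-extension I⊆J θ∈ exactColon b bθ∈ = (λ i k → trivial i k + x * f i k) , λ j j∈S →
          resp (trans (solve 5 (λ b k x q l → (b :- k :- x :* q) :+ x :* (q :- l) := b :- (k :+ x :* l)) ≈-refl
                         (b j) (koszul θ trivial j) x (quot j) (koszul θ f j))
                      (+-congˡ (-‿cong (sym (koszul-+* θ trivial x f j)))))
               (+∈ (remainder j j∈S) (f∈ j j∈S))
        where
        d = divide b (I⊆J bθ∈)
        open Division d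
        quotθ∈ : I (x * sum (λ j → quot j * θ j))
        quotθ∈ = resp (solve 2 (λ s t → s :- (s :- t) := t) ≈-refl _ _) (sub∈ bθ∈ (division-sum θ∈ d))
        f = proj₁ (exactColon quot quotθ∈)
        f∈ = proj₂ (exactColon quot quotθ∈)

    -- The induction step for regular sequences, with `θ e` as the nonzerodivisor modulo `I`.
    -- Division leaves multiples `θ e * quot j`; trivial relations between e and j absorb them, and
    -- the coefficient at e is then forced because `θ e` can be cancelled.
    exact-insert : ∀ {n} {θ : Fin n → Carrier} {S : Subset n} {J : Carrier → Set} {e : Fin n} →
                   (∀ {y} → J y → ∃[ z ] I (y - θ e * z)) → (∀ {y} → I y → J y) →
                   (∀ {z} → I (θ e * z) → I z) → (∀ j → j ∉ S → I (θ j)) →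
                   ExactMod J θ (S ∖ e) → ExactMod I θ S
    exact-insert {n} {θ} {S} {J} {e} split I⊆J regular θ∈ exactJ b bθ∈ = extend (divide split exactJ b (I⊆J bθ∈))
      where
      x = θ e

      extend : Division θ (S ∖ e) x b → Σ (Fin n → Fin n → Carrier) λ f → ∀ j → j ∈ S → I (b j - koszul θ f j)
      extend d = f̂ , λ j j∈S → resp (sym (residue j)) (residue∈ j j∈S)
        where
        open Division d

        f̂ : Fin n → Fin n → Carrier
        -- The added matrix contributes `θ e * quot j` at every j and, at e, also minus the sum of
        -- all `quot i * θ i`. The factor `1#` fits `koszul-+*`.
        f̂ i j = trivial i j + 1# * (δ i e * quot j)

        r : Fin n → Carrier
        r j = b j - koszul θ trivial j - x * quot j

        quotθ = sum (λ i → quot i * θ i)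

        residue : ∀ j → b j - koszul θ f̂ j ≈ r j + δ j e * quotθ
        residue j = begin
          b j - koszul θ f̂ j
            ≈⟨ +-congˡ (-‿cong (trans (koszul-+* θ trivial 1# (λ i j → δ i e * quot j) j) (+-congˡ (*-identityˡ _)))) ⟩
          b j - (koszul θ trivial j + koszul θ (λ i j → δ i e * quot j) j)
            ≈⟨ +-congˡ (-‿cong (+-congˡ (trans (koszul-split θ (λ i j → δ i e * quot j) j) (+-cong
                 (trans (sum-cong λ i → *-assoc (δ i e) (quot j) (θ i)) (sum-δ e (λ i → quot j * θ i)))
                 (-‿cong (trans (sum-cong λ i → *-assoc (δ j e) (quot i) (θ i)) (sym (*-distribˡ-sum (δ j e) (λ i → quot i * θ i))))))))) ⟩
          b j - (koszul θ trivial j + (quot j * x - δ j e * quotθ))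
            ≈⟨ solve 5 (λ b k q x t → b :- (k :+ (q :* x :- t)) := b :- k :- x :* q :+ t) ≈-refl
                     (b j) (koszul θ trivial j) (quot j) x (δ j e * quotθ) ⟩
          r j + δ j e * quotθ ∎

        others∈ : ∀ j → j ≢ e → I (r j * θ j)
        others∈ j j≢e with j SubP.∈? S
        ... | yes j∈S = *∈ʳ (θ j) (remainder j (SubP.x∈p∧x≢y⇒x∈p-y j∈S j≢e))
        ... | no j∉S  = *∈ _ (θ∈ j j∉S)

        residue∈ : ∀ j → j ∈ S → I (r j + δ j e * quotθ)
        residue∈ j j∈S with j FinP.≟ e
        ... | no j≢e   = +∈ (remainder j (SubP.x∈p∧x≢y⇒x∈p-y j∈S j≢e)) (≈0∈ (trans (*-congʳ (δ-≢ j≢e)) (zeroˡ _)))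
        -- Multiplied by `θ e`, the residue at e equals the sum of all `b j * θ j` minus the terms
        -- `r i * θ i` with i other than e; both lie in `I`, and regularity removes the factor.
        ... | yes refl = resp (+-congˡ (sym (trans (*-congʳ (δ-refl j)) (*-identityˡ _)))) (regular (resp
          (trans (+-congˡ (-‿cong (+-congʳ sum-remainder)))
            (solve 4 (λ s x q r → s :- ((s :- x :* q) :- r :* x) := x :* (r :+ q)) ≈-refl
               (sum (λ j → b j * θ j)) x quotθ (r j)))
          (sub∈ bθ∈ (sum-except∈ j (λ i → r i * θ i) others∈))))

-- The polynomial ring on lists of terms.

module PolyRing (K : Field) (n : ℕ) where
  open Field K hiding (zero) renaming (refl to ≈-refl)
  open Poly K n
  open IntegerSolver commRing
  open RingProperties ring using (-‿distribˡ-*)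
  open AbelianGroupProperties +-abelianGroup using (⁻¹-∙-comm; ε⁻¹≈ε; x∙y⁻¹≈ε⇒x≈y)
  open SetoidReasoning setoid

  infixl 6 _⊕_
  _⊕_ : Mono n → Mono n → Mono n
  _⊕_ = zipWith ℕ._+_

  𝟎 : Mono n
  𝟎 = Vec.replicate n 0

  _≟ₘ_ : (α β : Mono n) → Dec (α ≡ β)
  _≟ₘ_ = VecP.≡-dec ℕP._≟_

  ⊕-comm : ∀ α β → α ⊕ β ≡ β ⊕ α
  ⊕-comm = VecP.zipWith-comm ℕP.+-comm

  ⊕-assoc : ∀ α β γ → (α ⊕ β) ⊕ γ ≡ α ⊕ (β ⊕ γ)
  ⊕-assoc = VecP.zipWith-assoc ℕP.+-assoc

  ⊕-identityˡ : ∀ α → 𝟎 ⊕ α ≡ α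
  ⊕-identityˡ = VecP.zipWith-identityˡ ℕP.+-identityˡ

  -- The linear functional on polynomials with prescribed values g on monomials.
  ev : Pol → (Mono n → Carrier) → Carrier
  ev [] g = 0#
  ev ((c , β) ∷ p) g = c * g β + ev p g

  ev-cong : ∀ p {g h} → (∀ β → g β ≈ h β) → ev p g ≈ ev p h
  ev-cong [] g≈h = ≈-refl
  ev-cong ((c , β) ∷ p) g≈h = +-cong (*-congˡ (g≈h β)) (ev-cong p g≈h)

  ev-++ : ∀ p q g → ev (p ++ q) g ≈ ev p g + ev q g
  ev-++ [] q g = sym (+-identityˡ _)
  ev-++ (t ∷ p) q g = trans (+-congˡ (ev-++ p q g)) (sym (+-assoc _ _ _))

  ev-neg : ∀ p g → ev (-ₚ p) g ≈ - ev p g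
  ev-neg [] g = sym ε⁻¹≈ε
  ev-neg ((c , β) ∷ p) g = trans (+-cong (sym (-‿distribˡ-* c (g β))) (ev-neg p g)) (⁻¹-∙-comm _ _)

  ev-scale : ∀ p c g → ev p (λ β → c * g β) ≈ c * ev p g
  ev-scale [] c g = sym (zeroʳ c)
  ev-scale ((d , β) ∷ p) c g = trans (+-congˡ (ev-scale p c g))
    (solve 4 (λ d c x y → d :* (c :* x) :+ c :* y := c :* (d :* x :+ y)) ≈-refl d c (g β) (ev p g))

  ev-+ : ∀ p g h → ev p (λ β → g β + h β) ≈ ev p g + ev p h
  ev-+ [] g h = sym (+-identityˡ 0#)
  ev-+ ((d , β) ∷ p) g h = trans (+-congˡ (ev-+ p g h))
    (solve 5 (λ d x y u v → d :* (x :+ y) :+ (u :+ v) := (d :* x :+ u) :+ (d :* y :+ v)) ≈-refl d (g β) (h β) (ev p g) (ev p h))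

  ev-0 : ∀ p → ev p (λ _ → 0#) ≈ 0#
  ev-0 [] = ≈-refl
  ev-0 ((d , β) ∷ p) = trans (+-cong (zeroʳ d) (ev-0 p)) (+-identityˡ 0#)

  ev-swap : ∀ p q (h : Mono n → Mono n → Carrier) → ev p (λ β → ev q (h β)) ≈ ev q (λ γ → ev p (λ β → h β γ))
  ev-swap [] q h = sym (ev-0 q)
  ev-swap ((c , β) ∷ p) q h = trans (+-cong (sym (ev-scale q c (h β))) (ev-swap p q h))
    (sym (ev-+ q (λ γ → c * h β γ) (λ γ → ev p (λ β → h β γ))))

  ev-mulTerm : ∀ c β q g → ev (List.map (λ u → c * proj₁ u , β ⊕ proj₂ u) q) g ≈ c * ev q (λ γ → g (β ⊕ γ))
  ev-mulTerm c β [] g = sym (zeroʳ c)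
  ev-mulTerm c β ((d , γ) ∷ q) g = trans (+-congˡ (ev-mulTerm c β q g))
    (solve 4 (λ c d x y → c :* d :* x :+ c :* y := c :* (d :* x :+ y)) ≈-refl c d (g (β ⊕ γ)) (ev q (λ γ → g (β ⊕ γ))))

  -- A product evaluates by iterated evaluation in which exponents are added, so the ring laws
  -- reduce to laws of `⊕` and to exchanging two evaluations.
  ev-* : ∀ p q g → ev (p *ₚ q) g ≈ ev p (λ β → ev q (λ γ → g (β ⊕ γ)))
  ev-* [] q g = ≈-refl
  ev-* ((c , β) ∷ p) q g = trans (ev-++ (List.map (λ u → c * proj₁ u , β ⊕ proj₂ u) q) (p *ₚ q) g)
    (+-cong (ev-mulTerm c β q g) (ev-* p q g))

  indicator : Mono n → Mono n → Carrier
  indicator α β with β ≟ₘ α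
  ... | yes _ = 1#
  ... | no  _ = 0#

  coeff-ev : ∀ p α → coeff p α ≈ ev p (indicator α)
  coeff-ev [] α = ≈-refl
  coeff-ev ((c , β) ∷ p) α with β ≟ₘ α
  ... | yes _ = +-cong (sym (*-identityʳ c)) (coeff-ev p α)
  ... | no  _ = trans (coeff-ev p α) (sym (trans (+-congʳ (zeroʳ c)) (+-identityˡ _)))

  private
    remove : Mono n → Pol → Pol
    remove β [] = []
    remove β ((c , γ) ∷ p) with γ ≟ₘ β
    ... | yes _ = remove β p
    ... | no  _ = (c , γ) ∷ remove β p

    length-remove : ∀ β p → List.length (remove β p) ≤ List.length p
    length-remove β [] = z≤n
    length-remove β ((c , γ) ∷ p) with γ ≟ₘ β
    ... | yes _ = ℕP.m≤n⇒m≤1+n (length-remove β p)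
    ... | no  _ = s≤s (length-remove β p)

    ev-remove : ∀ β p g → ev p g ≈ coeff p β * g β + ev (remove β p) g
    ev-remove β [] g = sym (trans (+-identityʳ _) (zeroˡ _))
    ev-remove β ((c , γ) ∷ p) g with γ ≟ₘ β
    ... | yes refl = trans (+-congˡ (ev-remove β p g))
            (solve 4 (λ c d x y → c :* x :+ (d :* x :+ y) := (c :+ d) :* x :+ y) ≈-refl c (coeff p β) (g β) (ev (remove β p) g))
    ... | no _     = trans (+-congˡ (ev-remove β p g))
            (solve 3 (λ a b c → a :+ (b :+ c) := b :+ (a :+ c)) ≈-refl (c * g γ) (coeff p β * g β) (ev (remove β p) g))

    coeff-remove-≡ : ∀ β p → coeff (remove β p) β ≈ 0#
    coeff-remove-≡ β [] = ≈-refl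
    coeff-remove-≡ β ((c , γ) ∷ p) with γ ≟ₘ β
    ... | yes _ = coeff-remove-≡ β p
    ... | no γ≢β with γ ≟ₘ β
    ...   | yes γ≡β = contradiction γ≡β γ≢β
    ...   | no _    = coeff-remove-≡ β p

    coeff-remove-≢ : ∀ β p {α} → β ≢ α → coeff (remove β p) α ≈ coeff p α
    coeff-remove-≢ β [] β≢α = ≈-refl
    coeff-remove-≢ β ((c , γ) ∷ p) {α} β≢α with γ ≟ₘ β
    coeff-remove-≢ β ((c , γ) ∷ p) {α} β≢α | yes refl with γ ≟ₘ α
    ... | yes γ≡α = contradiction γ≡α β≢α
    ... | no _    = coeff-remove-≢ β p β≢α
    coeff-remove-≢ β ((c , γ) ∷ p) {α} β≢α | no _ with γ ≟ₘ α
    ... | yes _ = +-congˡ (coeff-remove-≢ β p β≢α)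
    ... | no _  = coeff-remove-≢ β p β≢α

    -- All terms sharing the first exponent are removed together: they evaluate to their total
    -- coefficient times the value of g, which is zero, and the other coefficients do not change.
    -- The bound on the length carries the induction, as `remove` is not structurally smaller.
    ev-vanish-bounded : ∀ k p g → List.length p ≤ k → (∀ γ → coeff p γ * g γ ≈ 0#) → ev p g ≈ 0#
    ev-vanish-bounded k [] g _ _ = ≈-refl
    ev-vanish-bounded (suc k) ((c , β) ∷ p) g (s≤s le) pg≈0 = begin
      ev ((c , β) ∷ p) g
        ≈⟨ ev-remove β ((c , β) ∷ p) g ⟩
      coeff ((c , β) ∷ p) β * g β + ev (remove β ((c , β) ∷ p)) g
        ≈⟨ +-cong (pg≈0 β) (ev-vanish-bounded k (remove β ((c , β) ∷ p)) g shorter rest) ⟩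
      0# + 0#
        ≈⟨ +-identityˡ 0# ⟩
      0# ∎
      where
      shorter : List.length (remove β ((c , β) ∷ p)) ≤ k
      shorter with β ≟ₘ β
      ... | yes _  = ℕP.≤-trans (length-remove β p) le
      ... | no β≢β = contradiction refl β≢β
      rest : ∀ γ → coeff (remove β ((c , β) ∷ p)) γ * g γ ≈ 0#
      rest γ with β ≟ₘ γ
      ... | yes refl = trans (*-congʳ (coeff-remove-≡ β ((c , β) ∷ p))) (zeroˡ _)
      ... | no β≢γ   = trans (*-congʳ (coeff-remove-≢ β ((c , β) ∷ p) β≢γ)) (pg≈0 γ)

  ev-vanish : ∀ p g → (∀ γ → coeff p γ * g γ ≈ 0#) → ev p g ≈ 0#
  ev-vanish p g = ev-vanish-bounded (List.length p) p g ℕP.≤-refl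

  -- Equivalent to coefficientwise equality, but compatible with products without any case distinction.
  _≋_ : Pol → Pol → Set
  p ≋ q = ∀ g → ev p g ≈ ev q g

  -- Wrapped in a record so that the two polynomials can be inferred from the type.
  infix 4 _≈ᴾ_
  record _≈ᴾ_ (p q : Pol) : Set where
    constructor coeffwise
    field coeffs : p ≈ₚ q
  open _≈ᴾ_ public

  ≋⇒≈ᴾ : ∀ p q → p ≋ q → p ≈ᴾ q
  ≋⇒≈ᴾ p q p≋q = coeffwise λ α → trans (coeff-ev p α) (trans (p≋q (indicator α)) (sym (coeff-ev q α)))

  -- The difference has zero coefficients although its list need not be empty; `ev-vanish` bridges
  -- this gap.
  ≈ᴾ⇒≋ : ∀ {p q} → p ≈ᴾ q → p ≋ q
  ≈ᴾ⇒≋ {p} {q} (coeffwise p≈q) g = x∙y⁻¹≈ε⇒x≈y _ _ (begin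
    ev p g - ev q g       ≈⟨ +-congˡ (ev-neg q g) ⟨
    ev p g + ev (-ₚ q) g  ≈⟨ ev-++ p (-ₚ q) g ⟨
    ev (p +ₚ (-ₚ q)) g    ≈⟨ ev-vanish (p +ₚ (-ₚ q)) g (λ γ → trans (*-congʳ (difference γ)) (zeroˡ _)) ⟩
    0#                    ∎)
    where
    difference : ∀ γ → coeff (p +ₚ (-ₚ q)) γ ≈ 0#
    difference γ = begin
      coeff (p +ₚ (-ₚ q)) γ                         ≈⟨ coeff-ev (p +ₚ (-ₚ q)) γ ⟩
      ev (p +ₚ (-ₚ q)) (indicator γ)                ≈⟨ trans (ev-++ p (-ₚ q) _) (+-congˡ (ev-neg q _)) ⟩
      ev p (indicator γ) - ev q (indicator γ)       ≈⟨ +-cong (sym (coeff-ev p γ)) (-‿cong (sym (coeff-ev q γ))) ⟩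
      coeff p γ - coeff q γ                         ≈⟨ +-congʳ (p≈q γ) ⟩
      coeff q γ - coeff q γ                         ≈⟨ -‿inverseʳ _ ⟩
      0#                                            ∎

  oneₚ : Pol
  oneₚ = (1# , 𝟎) ∷ []

  private
    ev-*-cong : ∀ {p p′ q q′} → p ≋ p′ → q ≋ q′ → (p *ₚ q) ≋ (p′ *ₚ q′)
    ev-*-cong {p} {p′} {q} {q′} p≋p′ q≋q′ g = begin
      ev (p *ₚ q) g                             ≈⟨ ev-* p q g ⟩
      ev p (λ β → ev q (λ γ → g (β ⊕ γ)))       ≈⟨ ev-cong p (λ β → q≋q′ (λ γ → g (β ⊕ γ))) ⟩
      ev p (λ β → ev q′ (λ γ → g (β ⊕ γ)))      ≈⟨ p≋p′ (λ β → ev q′ (λ γ → g (β ⊕ γ))) ⟩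
      ev p′ (λ β → ev q′ (λ γ → g (β ⊕ γ)))     ≈⟨ ev-* p′ q′ g ⟨
      ev (p′ *ₚ q′) g                           ∎

    ev-*-comm : ∀ p q → (p *ₚ q) ≋ (q *ₚ p)
    ev-*-comm p q g = begin
      ev (p *ₚ q) g                             ≈⟨ ev-* p q g ⟩
      ev p (λ β → ev q (λ γ → g (β ⊕ γ)))       ≈⟨ ev-swap p q (λ β γ → g (β ⊕ γ)) ⟩
      ev q (λ γ → ev p (λ β → g (β ⊕ γ)))       ≈⟨ ev-cong q (λ γ → ev-cong p (λ β → reflexive (≡.cong g (⊕-comm β γ)))) ⟩
      ev q (λ γ → ev p (λ β → g (γ ⊕ β)))       ≈⟨ ev-* q p g ⟨
      ev (q *ₚ p) g                             ∎

    ev-*-assoc : ∀ p q s → ((p *ₚ q) *ₚ s) ≋ (p *ₚ (q *ₚ s))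
    ev-*-assoc p q s g = begin
      ev ((p *ₚ q) *ₚ s) g
        ≈⟨ trans (ev-* (p *ₚ q) s g) (ev-* p q _) ⟩
      ev p (λ β → ev q (λ γ → ev s (λ ε → g ((β ⊕ γ) ⊕ ε))))
        ≈⟨ ev-cong p (λ β → ev-cong q (λ γ → ev-cong s (λ ε → reflexive (≡.cong g (⊕-assoc β γ ε))))) ⟩
      ev p (λ β → ev q (λ γ → ev s (λ ε → g (β ⊕ (γ ⊕ ε)))))
        ≈⟨ ev-cong p (λ β → sym (ev-* q s (λ γ → g (β ⊕ γ)))) ⟩
      ev p (λ β → ev (q *ₚ s) (λ γ → g (β ⊕ γ)))
        ≈⟨ ev-* p (q *ₚ s) g ⟨
      ev (p *ₚ (q *ₚ s)) g ∎

    ev-*-identityˡ : ∀ p → (oneₚ *ₚ p) ≋ p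
    ev-*-identityˡ p g = begin
      ev (oneₚ *ₚ p) g                     ≈⟨ ev-* oneₚ p g ⟩
      1# * ev p (λ γ → g (𝟎 ⊕ γ)) + 0#     ≈⟨ trans (+-identityʳ _) (*-identityˡ _) ⟩
      ev p (λ γ → g (𝟎 ⊕ γ))               ≈⟨ ev-cong p (λ γ → reflexive (≡.cong g (⊕-identityˡ γ))) ⟩
      ev p g                               ∎

    ev-distribʳ : ∀ p q s → ((q +ₚ s) *ₚ p) ≋ ((q *ₚ p) +ₚ (s *ₚ p))
    ev-distribʳ p q s g = begin
      ev ((q +ₚ s) *ₚ p) g                  ≈⟨ trans (ev-* (q +ₚ s) p g) (ev-++ q s _) ⟩
      ev q _ + ev s _                       ≈⟨ +-cong (ev-* q p g) (ev-* s p g) ⟨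
      ev (q *ₚ p) g + ev (s *ₚ p) g         ≈⟨ ev-++ (q *ₚ p) (s *ₚ p) g ⟨
      ev ((q *ₚ p) +ₚ (s *ₚ p)) g           ∎

    ev-+-comm : ∀ p q → (p +ₚ q) ≋ (q +ₚ p)
    ev-+-comm p q g = trans (ev-++ p q g) (trans (+-comm _ _) (sym (ev-++ q p g)))

    ev-+-cong : ∀ {p p′ q q′} → p ≋ p′ → q ≋ q′ → (p +ₚ q) ≋ (p′ +ₚ q′)
    ev-+-cong {p} {p′} {q} {q′} p≋p′ q≋q′ g = trans (ev-++ p q g) (trans (+-cong (p≋p′ g) (q≋q′ g)) (sym (ev-++ p′ q′ g)))

    ev-inverseʳ : ∀ p → (p +ₚ (-ₚ p)) ≋ []
    ev-inverseʳ p g = trans (ev-++ p (-ₚ p) g) (trans (+-congˡ (ev-neg p g)) (-‿inverseʳ _))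

    ≋-refl : ∀ {p q} → p ≡ q → p ≋ q
    ≋-refl refl g = ≈-refl

    ≋-trans : ∀ {p q s} → p ≋ q → q ≋ s → p ≋ s
    ≋-trans p≋q q≋s g = trans (p≋q g) (q≋s g)

  polyRing : CommutativeRing 0ℓ 0ℓ
  polyRing = record
    { Carrier = Pol
    ; _≈_ = _≈ᴾ_
    ; _+_ = _+ₚ_
    ; _*_ = _*ₚ_
    ; -_ = -ₚ_
    ; 0# = []
    ; 1# = oneₚ
    ; isCommutativeRing = record
      { isRing = record
        { +-isAbelianGroup = record
          { isGroup = record
            { isMonoid = record
              { isSemigroup = record
                { isMagma = record
                  { isEquivalence = record
                    { refl  = coeffwise λ _ → ≈-refl
                    ; sym   = λ p≈q → coeffwise λ α → sym (coeffs p≈q α)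
                    ; trans = λ p≈q q≈s → coeffwise λ α → trans (coeffs p≈q α) (coeffs q≈s α)
                    }
                  ; ∙-cong = λ {p} {p′} {q} {q′} p≈p′ q≈q′ → ≋⇒≈ᴾ (p +ₚ q) (p′ +ₚ q′) (ev-+-cong {p} {p′} {q} {q′} (≈ᴾ⇒≋ p≈p′) (≈ᴾ⇒≋ q≈q′))
                  }
                ; assoc = λ p q s → ≋⇒≈ᴾ _ _ (≋-refl (ListP.++-assoc p q s))
                }
              ; identity = (λ p → ≋⇒≈ᴾ p p (≋-refl {p} refl)) , (λ p → ≋⇒≈ᴾ (p +ₚ []) p (≋-refl (ListP.++-identityʳ p)))
              }
            ; inverse = (λ p → ≋⇒≈ᴾ ((-ₚ p) +ₚ p) [] (≋-trans {(-ₚ p) +ₚ p} {p +ₚ (-ₚ p)} {[]} (ev-+-comm (-ₚ p) p) (ev-inverseʳ p)))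
                      , (λ p → ≋⇒≈ᴾ (p +ₚ (-ₚ p)) [] (ev-inverseʳ p))
            ; ⁻¹-cong = λ {p} {q} p≈q → ≋⇒≈ᴾ (-ₚ p) (-ₚ q) (λ g → trans (ev-neg p g) (trans (-‿cong (≈ᴾ⇒≋ p≈q g)) (sym (ev-neg q g))))
            }
          ; comm = λ p q → ≋⇒≈ᴾ (p +ₚ q) (q +ₚ p) (ev-+-comm p q)
          }
        ; *-cong = λ {p} {p′} {q} {q′} p≈p′ q≈q′ → ≋⇒≈ᴾ (p *ₚ q) (p′ *ₚ q′) (ev-*-cong {p} {p′} {q} {q′} (≈ᴾ⇒≋ p≈p′) (≈ᴾ⇒≋ q≈q′))
        ; *-assoc = λ p q s → ≋⇒≈ᴾ ((p *ₚ q) *ₚ s) (p *ₚ (q *ₚ s)) (ev-*-assoc p q s)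
        ; *-identity = (λ p → ≋⇒≈ᴾ (oneₚ *ₚ p) p (ev-*-identityˡ p))
                     , (λ p → ≋⇒≈ᴾ (p *ₚ oneₚ) p (≋-trans {p *ₚ oneₚ} {oneₚ *ₚ p} {p} (ev-*-comm p oneₚ) (ev-*-identityˡ p)))
        ; distrib = (λ p q s → ≋⇒≈ᴾ (p *ₚ (q +ₚ s)) ((p *ₚ q) +ₚ (p *ₚ s)) (≋-trans {p *ₚ (q +ₚ s)} {(q +ₚ s) *ₚ p} {(p *ₚ q) +ₚ (p *ₚ s)} (ev-*-comm p (q +ₚ s))
                       (≋-trans {(q +ₚ s) *ₚ p} {(q *ₚ p) +ₚ (s *ₚ p)} {(p *ₚ q) +ₚ (p *ₚ s)} (ev-distribʳ p q s)
                         (ev-+-cong {q *ₚ p} {p *ₚ q} {s *ₚ p} {p *ₚ s} (ev-*-comm q p) (ev-*-comm s p)))))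
                  , (λ p q s → ≋⇒≈ᴾ ((q +ₚ s) *ₚ p) ((q *ₚ p) +ₚ (s *ₚ p)) (ev-distribʳ p q s))
        }
      ; *-comm = λ p q → ≋⇒≈ᴾ (p *ₚ q) (q *ₚ p) (ev-*-comm p q)
      }
    }

-- Monomials, monomial ideals and ideals given by generators.

vec-ext : ∀ {A : Set} {n} {u v : Vec A n} → (∀ i → Vec.lookup u i ≡ Vec.lookup v i) → u ≡ v
vec-ext {u = u} {v} eq = ≡.trans (≡.sym (VecP.tabulate∘lookup u)) (≡.trans (VecP.tabulate-cong eq) (VecP.tabulate∘lookup v))

≡ᵇ-refl : ∀ m → (m ≡ᵇ m) ≡ true
≡ᵇ-refl zero    = refl
≡ᵇ-refl (suc m) = ≡ᵇ-refl m

≡ᵇ-≢ : ∀ {m n} → m ≢ n → (m ≡ᵇ n) ≡ false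
≡ᵇ-≢ {zero}  {zero}  m≢n = contradiction refl m≢n
≡ᵇ-≢ {zero}  {suc n} m≢n = refl
≡ᵇ-≢ {suc m} {zero}  m≢n = refl
≡ᵇ-≢ {suc m} {suc n} m≢n = ≡ᵇ-≢ (m≢n ∘ ≡.cong suc)

module Polynomials (K : Field) (n : ℕ) where
  private module K = Field K
  open Poly K n
  open PolyRing K n public
  open CommutativeRing polyRing hiding (zero) renaming (refl to ≈-refl)
  open RingSums polyRing
  open Ideals polyRing
  open SetoidReasoning setoid
  private
    module KS = RingSums K.commRing

  monomial : K.Carrier → Mono n → Pol
  monomial c α = (c , α) ∷ []

  ι : K.Carrier → Pol
  ι c = monomial c 𝟎

  X : Fin n → Pol
  X i = monomial K.1# (unitVec i)

  lookup-unit-refl : ∀ i → Vec.lookup (unitVec i) i ≡ 1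
  lookup-unit-refl i = ≡.trans (VecP.lookup∘tabulate _ i) (≡.cong (if_then 1 else 0) (≡ᵇ-refl (toℕ i)))

  lookup-unit-≢ : ∀ {i j} → i ≢ j → Vec.lookup (unitVec i) j ≡ 0
  lookup-unit-≢ {i} {j} i≢j = ≡.trans (VecP.lookup∘tabulate _ j)
    (≡.cong (if_then 1 else 0) (≡ᵇ-≢ (i≢j ∘ FinP.toℕ-injective)))

  lookup-⊕ : ∀ α β i → Vec.lookup (α ⊕ β) i ≡ Vec.lookup α i ℕ.+ Vec.lookup β i
  lookup-⊕ α β i = VecP.lookup-zipWith ℕ._+_ i α β

  ⊕-cancelˡ : ∀ α {β γ} → α ⊕ β ≡ α ⊕ γ → β ≡ γ
  ⊕-cancelˡ α {β} {γ} eq = vec-ext λ i → ℕP.+-cancelˡ-≡ (Vec.lookup α i) _ _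
    (≡.trans (≡.sym (lookup-⊕ α β i)) (≡.trans (≡.cong (λ v → Vec.lookup v i) eq) (lookup-⊕ α γ i)))

  ≤ₘ⇒⊕ : ∀ μ α → μ ≤ₘ α → ∃[ ν ] α ≡ ν ⊕ μ
  ≤ₘ⇒⊕ μ α μ≤α = ν , vec-ext λ i → ≡.sym (≡.trans (lookup-⊕ ν μ i)
      (≡.trans (≡.cong (ℕ._+ Vec.lookup μ i) (VecP.lookup∘tabulate _ i)) (ℕP.m∸n+n≡m (μ≤α i))))
    where ν = tabulate λ i → Vec.lookup α i ∸ Vec.lookup μ i

  unit≤ : ∀ e α → 0 < Vec.lookup α e → unitVec e ≤ₘ α
  unit≤ e α 0<α i with e FinP.≟ i
  ... | yes refl = ≡.subst (_≤ Vec.lookup α i) (≡.sym (lookup-unit-refl i)) 0<α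
  ... | no e≢i   = ≡.subst (_≤ Vec.lookup α i) (≡.sym (lookup-unit-≢ e≢i)) z≤n

  ι-cong : ∀ {a b} → a K.≈ b → ι a ≈ ι b
  ι-cong a≈b = ≋⇒≈ᴾ _ _ λ g → K.+-congʳ (K.*-congʳ a≈b)

  ι-+ : ∀ a b → ι (a K.+ b) ≈ ι a + ι b
  ι-+ a b = ≋⇒≈ᴾ (ι (a K.+ b)) (ι a + ι b) λ g → K.trans (K.+-congʳ (K.distribʳ (g 𝟎) a b)) (K.+-assoc _ _ _)

  ι-* : ∀ a b → ι (a K.* b) ≈ ι a * ι b
  ι-* a b = ≋⇒≈ᴾ (ι (a K.* b)) (ι a * ι b) λ g → K.+-congʳ (K.*-congˡ (K.reflexive (≡.cong g (≡.sym (⊕-identityˡ 𝟎)))))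

  ι-0 : ι K.0# ≈ 0#
  ι-0 = ≋⇒≈ᴾ (ι K.0#) 0# λ g → K.trans (K.+-congʳ (K.zeroˡ _)) (K.+-identityˡ _)

  ι-sum : ∀ {m} (f : Fin m → K.Carrier) → ι (KS.sum f) ≈ sum (λ i → ι (f i))
  ι-sum {zero}  f = ι-0
  ι-sum {suc m} f = trans (ι-+ _ _) (+-congˡ (ι-sum (f ∘ suc)))

  ι-δ : ∀ {m} (i j : Fin m) → ι (KS.δ i j) ≈ δ i j
  ι-δ zero    zero    = ≈-refl
  ι-δ zero    (suc j) = ι-0
  ι-δ (suc i) zero    = ι-0
  ι-δ (suc i) (suc j) = ι-δ i j

  ev-monomial : ∀ c α g → ev (monomial c α) g K.≈ c K.* g α
  ev-monomial c α g = K.+-identityʳ _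

  ev-monomial-* : ∀ c α p g → ev (monomial c α * p) g K.≈ c K.* ev p (λ γ → g (α ⊕ γ))
  ev-monomial-* c α p g = K.trans (ev-* (monomial c α) p g) (ev-monomial c α (λ β → ev p (λ γ → g (β ⊕ γ))))

  ev-X* : ∀ e p g → ev (X e * p) g K.≈ ev p (λ γ → g (unitVec e ⊕ γ))
  ev-X* e p g = K.trans (ev-monomial-* K.1# (unitVec e) p g) (K.*-identityˡ _)

  monomial-X : ∀ c e α → monomial c (unitVec e ⊕ α) ≈ X e * monomial c α
  monomial-X c e α = ≋⇒≈ᴾ (monomial c (unitVec e ⊕ α)) (X e * monomial c α) λ g → K.+-congʳ (K.*-congʳ (K.sym (K.*-identityˡ c)))

  ev-allFin : ∀ {m} (c : Fin m → K.Carrier) (β : Fin m → Mono n) g →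
              ev (List.tabulate (λ i → c i , β i)) g K.≈ KS.sum (λ i → c i K.* g (β i))
  ev-allFin {zero}  c β g = K.refl
  ev-allFin {suc m} c β g = K.+-congˡ (ev-allFin (c ∘ suc) (β ∘ suc) g)

  ev-linForm : ∀ a g → ev (linForm a) g K.≈ KS.sum (λ i → a i K.* g (unitVec i))
  ev-linForm a g = K.trans (K.reflexive (≡.cong (λ p → ev p g) (ListP.map-tabulate id (λ i → a i , unitVec i))))
    (ev-allFin a unitVec g)

  ev-sum : ∀ {m} (f : Fin m → Pol) g → ev (sum f) g K.≈ KS.sum (λ i → ev (f i) g)
  ev-sum {zero}  f g = K.refl
  ev-sum {suc m} f g = K.trans (ev-++ (f zero) _ g) (K.+-congˡ (ev-sum (f ∘ suc) g))

  linForm-sum : ∀ a → linForm a ≈ sum (λ i → ι (a i) * X i)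
  linForm-sum a = ≋⇒≈ᴾ (linForm a) (sum (λ i → ι (a i) * X i)) λ g → K.trans (ev-linForm a g)
    (K.trans (KS.sum-cong λ i → K.sym (K.trans (K.trans (ev-monomial-* (a i) 𝟎 (X i) g) (K.*-congˡ (K.trans (ev-monomial K.1# (unitVec i) (λ γ → g (𝟎 ⊕ γ))) (K.*-identityˡ _))))
                                     (K.*-congˡ (K.reflexive (≡.cong g (⊕-identityˡ (unitVec i)))))))
             (K.sym (ev-sum (λ i → ι (a i) * X i) g)))

  coeff-0 : ∀ {T : Mono n → Set} {p α} → All (λ t → T (proj₂ t)) p → ¬ T α → coeff p α K.≈ K.0#
  coeff-0 [] ¬Tα = K.refl
  coeff-0 {p = (c , β) ∷ p} {α} (Tβ ∷ Tp) ¬Tα with β ≟ₘ α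
  ... | yes refl = contradiction Tβ ¬Tα
  ... | no _     = coeff-0 Tp ¬Tα

  -- Membership in the span of the monomials in T, in a form that does not require T to be decidable.
  record Span (T : Mono n → Set) (p : Pol) : Set where
    constructor spanned
    field vanishes : ∀ α → ¬ T α → coeff p α K.≈ K.0#
  open Span public

  UpClosed : (Mono n → Set) → Set
  UpClosed T = ∀ {α} β → T α → T (β ⊕ α)

  Span-mono : ∀ {T T′ : Mono n → Set} → (∀ {α} → T α → T′ α) → ∀ {p} → Span T p → Span T′ p
  Span-mono T⊆T′ p∈ = spanned λ α ¬T′α → vanishes p∈ α (¬T′α ∘ T⊆T′)

  private
    indicator-≢ : ∀ {α β} → β ≢ α → indicator α β K.≈ K.0#
    indicator-≢ {α} {β} β≢α with β ≟ₘ α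
    ... | yes β≡α = contradiction β≡α β≢α
    ... | no _    = K.refl

    indicator-cancel : ∀ μ α γ → indicator (μ ⊕ α) (μ ⊕ γ) K.≈ indicator α γ
    indicator-cancel μ α γ with γ ≟ₘ α
    ... | no γ≢α   = indicator-≢ (γ≢α ∘ ⊕-cancelˡ μ)
    ... | yes refl with (μ ⊕ γ) ≟ₘ (μ ⊕ γ)
    ...   | yes _  = K.refl
    ...   | no neq = contradiction refl neq

  -- Computes a coefficient of a monomial multiple of p, with `h` the shift of exponents: whatever
  -- is shifted onto α has an exponent outside T, hence coefficient zero.
  ev-indicator-vanish : ∀ p (T : Mono n → Set) → Span T p → ∀ α (h : Mono n → Mono n) →
                        (∀ {γ} → h γ ≡ α → ¬ T γ) → ev p (λ γ → indicator α (h γ)) K.≈ K.0#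
  ev-indicator-vanish p T p∈ α h ¬T = ev-vanish p _ vanish
    where
    vanish : ∀ γ → coeff p γ K.* indicator α (h γ) K.≈ K.0#
    vanish γ with h γ ≟ₘ α
    ... | yes hγ≡α = K.trans (K.*-congʳ (vanishes p∈ γ (¬T hγ≡α))) (K.zeroˡ _)
    ... | no _     = K.zeroʳ _

  coeff-+ : ∀ p q α → coeff (p + q) α K.≈ coeff p α K.+ coeff q α
  coeff-+ p q α = K.trans (coeff-ev (p + q) α) (K.trans (ev-++ p q _) (K.+-cong (K.sym (coeff-ev p α)) (K.sym (coeff-ev q α))))

  coeff-neg : ∀ p α → coeff (- p) α K.≈ K.- coeff p α
  coeff-neg p α = K.trans (coeff-ev (- p) α) (K.trans (ev-neg p _) (K.-‿cong (K.sym (coeff-ev p α))))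

  Span-isIdeal : ∀ {T} → UpClosed T → IsIdeal (Span T)
  Span-isIdeal {T} up = record
    { resp = λ p≈q p∈ → spanned λ α ¬Tα → K.trans (K.sym (coeffs p≈q α)) (vanishes p∈ α ¬Tα)
    ; 0∈   = spanned λ _ _ → K.refl
    ; +∈   = λ {p} {q} p∈ q∈ → spanned λ α ¬Tα → K.trans (coeff-+ p q α) (K.trans (K.+-cong (vanishes p∈ α ¬Tα) (vanishes q∈ α ¬Tα)) (K.+-identityˡ _))
    ; *∈   = λ p {q} q∈ → spanned λ α ¬Tα → K.trans (coeff-ev (p * q) α) (K.trans (ev-* p q _) (K.trans
               (ev-cong p (λ β → ev-indicator-vanish q T q∈ α (β ⊕_) λ { refl Tγ → ¬Tα (up β Tγ) }))
               (ev-0 p)))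
    }

  coeff-X* : ∀ e p α → coeff (X e * p) (unitVec e ⊕ α) K.≈ coeff p α
  coeff-X* e p α = K.trans (coeff-ev (X e * p) _) (K.trans (ev-X* e p _)
    (K.trans (ev-cong p (indicator-cancel (unitVec e) α)) (K.sym (coeff-ev p α))))

  -- With `Span-colon⁻`: the colon of a monomial ideal by a variable is again monomial, with shifted
  -- exponents.
  Span-colon⁺ : ∀ {T} e {p} → Span T (X e * p) → Span (λ α → T (unitVec e ⊕ α)) p
  Span-colon⁺ e {p} Xp∈ = spanned λ α ¬T → K.trans (K.sym (coeff-X* e p α)) (vanishes Xp∈ _ ¬T)

  Span-colon⁻ : ∀ {T} e {p} → Span (λ α → T (unitVec e ⊕ α)) p → Span T (X e * p)
  Span-colon⁻ {T} e {p} p∈ = spanned λ α ¬Tα → K.trans (coeff-ev (X e * p) α) (K.trans (ev-X* e p _)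
    (ev-indicator-vanish p (λ α → T (unitVec e ⊕ α)) p∈ α (unitVec e ⊕_) λ { refl Tγ → ¬Tα Tγ }))

  record Involves (e : Fin n) (α : Mono n) : Set where
    constructor positive
    field exponent>0 : 0 < Vec.lookup α e
  open Involves public

  involves? : ∀ e α → Dec (Involves e α)
  involves? e α = Dec.map′ positive exponent>0 (0 ℕP.<? Vec.lookup α e)

  involves-⊕ : ∀ {i} β {α} → Involves i α → Involves i (β ⊕ α)
  involves-⊕ {i} β {α} (positive 0<α) = positive (≡.subst (0 <_) (≡.sym (lookup-⊕ β α i)) (ℕP.≤-trans 0<α (ℕP.m≤n+m _ _)))

  involves-self : ∀ e → Involves e (unitVec e)
  involves-self e = positive (≡.subst (0 <_) (≡.sym (lookup-unit-refl e)) (s≤s z≤n))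

  involves-unit : ∀ e {α} → Involves e (unitVec e ⊕ α)
  involves-unit e {α} = ≡.subst (Involves e) (⊕-comm α (unitVec e)) (involves-⊕ α (involves-self e))

  involves-unit⁻ : ∀ {i e α} → e ≢ i → Involves i (unitVec e ⊕ α) → Involves i α
  involves-unit⁻ {i} {e} {α} e≢i (positive 0<) = positive
    (≡.subst (0 <_) (≡.trans (lookup-⊕ (unitVec e) α i) (≡.cong (ℕ._+ Vec.lookup α i) (lookup-unit-≢ e≢i))) 0<)

  private
    divideBy : ∀ e p → ∃[ q ] ∃[ z ] (p ≈ q + X e * z × All (λ t → ¬ Involves e (proj₂ t)) q)
    divideBy e [] = [] , [] , sym (trans (+-identityˡ _) (zeroʳ (X e))) , []
    divideBy e ((c , β) ∷ p) with divideBy e p | involves? e β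
    ... | q , z , p≈ , q∌ | no ¬e = (c , β) ∷ q , z , trans (+-congˡ {x = monomial c β} p≈) (sym (+-assoc (monomial c β) q (X e * z))) , ¬e ∷ q∌
    ... | q , z , p≈ , q∌ | yes e∈ with ≤ₘ⇒⊕ (unitVec e) β (unit≤ e β (exponent>0 e∈))
    ...   | ν , refl = q , monomial c ν + z , (begin
              monomial c (ν ⊕ unitVec e) + p             ≈⟨ +-cong (trans (reflexive (≡.cong (monomial c) (⊕-comm ν (unitVec e)))) (monomial-X c e ν)) p≈ ⟩
              X e * monomial c ν + (q + X e * z)         ≈⟨ trans (sym (+-assoc (X e * monomial c ν) q (X e * z))) (+-congʳ (+-comm (X e * monomial c ν) q)) ⟩
              q + X e * monomial c ν + X e * z           ≈⟨ trans (+-assoc q _ _) (+-congˡ (sym (distribˡ (X e) (monomial c ν) z))) ⟩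
              q + X e * (monomial c ν + z)               ∎) , q∌

  -- The part q of p free of xₑ has the coefficients of p on exponents free of e, where they vanish
  -- outside T, and zero coefficients elsewhere. So q lies in the smaller span without any decision
  -- about T.
  Span-split : ∀ {T} e {p} → UpClosed T → Span (λ α → T α ⊎ Involves e α) p → ∃[ z ] Span T (p - X e * z)
  Span-split {T} e {p} up p∈ with divideBy e p
  ... | q , z , p≈ , q∌ = z , IsIdeal.resp (Span-isIdeal up) q≈ q∈
    where
    q≈ : q ≈ p - X e * z
    q≈ = sym (trans (+-congʳ p≈) (trans (+-assoc q (X e * z) _) (trans (+-congˡ (-‿inverseʳ (X e * z))) (+-identityʳ q))))
    q∈ : Span T q
    q∈ = spanned q-vanishes
      where
      q-vanishes : ∀ α → ¬ T α → coeff q α K.≈ K.0#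
      q-vanishes α ¬Tα with involves? e α
      ... | yes e∈α = coeff-0 q∌ (λ ¬e → ¬e e∈α)
      ... | no e∉α  = K.trans (coeffs q≈ α) (K.trans (coeff-+ p (- (X e * z)) α) (K.trans
        (K.+-cong (vanishes p∈ α [ ¬Tα , e∉α ]′) (K.trans (coeff-neg (X e * z) α) (K.-‿cong
            (vanishes (Span-colon⁻ {Involves e} e {z} (spanned λ β ¬e → contradiction (involves-unit e) ¬e)) α e∉α))))
        (K.-‿inverseʳ _)))

  -- The list of p may contain terms outside T that cancel each other. They are discarded here, so
  -- that a map can be applied term by term.
  Span-terms : ∀ {T} → (∀ α → Dec (T α)) → ∀ {p} → Span T p → ∃[ q ] (p ≈ q × All (λ t → T (proj₂ t)) q)
  Span-terms {T} T? {p} p∈ with partition p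
    where
    partition : ∀ p → ∃[ q ] ∃[ s ] (p ≈ q + s × All (λ t → T (proj₂ t)) q × All (λ t → ¬ T (proj₂ t)) s)
    partition [] = [] , [] , ≈-refl , [] , []
    partition ((c , β) ∷ p) with partition p | T? β
    ... | q , s , p≈ , q∈ , s∉ | yes Tβ = (c , β) ∷ q , s , trans (+-congˡ {x = monomial c β} p≈) (sym (+-assoc (monomial c β) q s)) , Tβ ∷ q∈ , s∉
    ... | q , s , p≈ , q∈ , s∉ | no ¬Tβ = q , (c , β) ∷ s , (begin
            monomial c β + p        ≈⟨ +-congˡ p≈ ⟩
            monomial c β + (q + s)  ≈⟨ +-assoc (monomial c β) q s ⟨
            monomial c β + q + s    ≈⟨ +-congʳ (+-comm (monomial c β) q) ⟩
            q + monomial c β + s    ≈⟨ +-assoc q (monomial c β) s ⟩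
            q + (monomial c β + s)  ∎) , q∈ , ¬Tβ ∷ s∉
  ... | q , s , p≈ , q∈ , s∉ = q , trans p≈ (trans (+-congˡ s≈0) (+-identityʳ q)) , q∈
    where
    s≈0 : s ≈ 0#
    s≈0 = coeffwise λ α → vanish α (T? α)
      where
      vanish : ∀ α → Dec (T α) → coeff s α K.≈ K.0#
      vanish α (yes Tα) = coeff-0 s∉ (λ ¬Tα → ¬Tα Tα)
      vanish α (no ¬Tα) = K.trans (K.sym (K.+-identityˡ _)) (K.trans (K.+-congʳ (K.sym (coeff-0 q∈ ¬Tα)))
        (K.trans (K.sym (coeff-+ q s α)) (K.trans (K.sym (coeffs p≈ α)) (vanishes p∈ α ¬Tα))))

  record Ideal⟨_⟩ (G : Pol → Set) (f : Pol) : Set where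
    constructor member
    field inIdeal : InIdeal G f
  open Ideal⟨_⟩ public

  module _ {G : Pol → Set} where
    private
      combination : List (Pol × Pol) → Pol
      combination hs = sumₚ (List.map (λ hg → proj₁ hg *ₚ proj₂ hg) hs)

      combination-++ : ∀ hs hs′ → combination (hs ++ hs′) ≈ combination hs + combination hs′
      combination-++ [] hs′ = sym (+-identityˡ (combination hs′))
      combination-++ ((h , g) ∷ hs) hs′ = trans (+-congˡ (combination-++ hs hs′)) (sym (+-assoc (h * g) (combination hs) (combination hs′)))

      scale : Pol → List (Pol × Pol) → List (Pol × Pol)
      scale x = List.map λ hg → x * proj₁ hg , proj₂ hg

      combination-scale : ∀ x hs → combination (scale x hs) ≈ x * combination hs
      combination-scale x [] = sym (zeroʳ x)
      combination-scale x ((h , g) ∷ hs) = trans (+-cong (*-assoc x h g) (combination-scale x hs)) (sym (distribˡ x (h * g) (combination hs)))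

      All-scale : ∀ x {hs : List (Pol × Pol)} → All (λ hg → G (proj₂ hg)) hs → All (λ hg → G (proj₂ hg)) (scale x hs)
      All-scale x [] = []
      All-scale x (p ∷ ps) = p ∷ All-scale x ps

    generated-isIdeal : IsIdeal Ideal⟨ G ⟩
    generated-isIdeal = record
      { resp = λ {p} p≈q (member (hs , hs∈ , p≈hs)) → member (hs , hs∈ , coeffs (trans (sym p≈q) (coeffwise {p} {combination hs} p≈hs)))
      ; 0∈   = member ([] , [] , λ _ → K.refl)
      ; +∈   = λ {p} {q} (member (hs , hs∈ , p≈hs)) (member (hs′ , hs′∈ , q≈hs′)) → member (hs ++ hs′ , AllP.++⁺ hs∈ hs′∈ ,
                 coeffs (trans (+-cong {p} {combination hs} {q} {combination hs′} (coeffwise p≈hs) (coeffwise q≈hs′)) (sym (combination-++ hs hs′))))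
      ; *∈   = λ x {q} (member (hs , hs∈ , q≈hs)) → member (scale x hs , All-scale x hs∈ ,
                 coeffs (trans (*-congˡ {x} {q} {combination hs} (coeffwise q≈hs)) (sym (combination-scale x hs))))
      }

    generator∈ : ∀ {g} → G g → Ideal⟨ G ⟩ g
    generator∈ {g} Gg = member ((oneₚ , g) ∷ [] , Gg ∷ [] , coeffs (sym (trans (+-identityʳ (oneₚ * g)) (*-identityˡ g))))

    -- Serves as induction on membership: a property of polynomials is shown to define an ideal and
    -- to hold for the generators.
    generated-minimal : ∀ {I} → IsIdeal I → (∀ {g} → G g → I g) → ∀ {f} → Ideal⟨ G ⟩ f → I f
    generated-minimal {I} isI G⊆I {f} (member (hs , hs∈ , f≈hs)) = resp (sym (coeffwise {f} {combination hs} f≈hs)) (combination∈ hs hs∈)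
      where
      open IsIdeal isI
      combination∈ : ∀ (hs : List (Pol × Pol)) → All (λ hg → G (proj₂ hg)) hs → I (combination hs)
      combination∈ [] [] = 0∈
      combination∈ ((h , g) ∷ hs) (g∈ ∷ hs∈) = +∈ (*∈ h (G⊆I g∈)) (combination∈ hs hs∈)

-- Finite subsets.

module _ {n : ℕ} where

  ∈∪⁅⁆⁻ : ∀ {S : Subset n} {x y} → y ∈ S ∪ ⁅ x ⁆ → y ∈ S ⊎ y ≡ x
  ∈∪⁅⁆⁻ {S} {x} y∈ with SubP.x∈p∪q⁻ S ⁅ x ⁆ y∈
  ... | inj₁ y∈S = inj₁ y∈S
  ... | inj₂ y∈x = inj₂ (SubP.x∈⁅y⁆⇒x≡y x y∈x)

  ∈∪ˡ : ∀ {S T : Subset n} {y} → y ∈ S → y ∈ S ∪ T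
  ∈∪ˡ y∈S = SubP.x∈p∪q⁺ (inj₁ y∈S)

  ∈∪ʳ : ∀ {S T : Subset n} {y} → y ∈ T → y ∈ S ∪ T
  ∈∪ʳ y∈T = SubP.x∈p∪q⁺ (inj₂ y∈T)

  x∈∪⁅x⁆ : ∀ (S : Subset n) x → x ∈ S ∪ ⁅ x ⁆
  x∈∪⁅x⁆ S x = ∈∪ʳ {S} (SubP.x∈⁅x⁆ x)

  ∪⁅⁆⊆ : ∀ {S T : Subset n} {x} → S ⊆ T → x ∈ T → S ∪ ⁅ x ⁆ ⊆ T
  ∪⁅⁆⊆ S⊆T x∈T y∈ with ∈∪⁅⁆⁻ y∈
  ... | inj₁ y∈S  = S⊆T y∈S
  ... | inj₂ refl = x∈T

  ∈∖ : ∀ {S : Subset n} {x y} → y ∈ S → y ≢ x → y ∈ S ∖ x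
  ∈∖ = SubP.x∈p∧x≢y⇒x∈p-y

  ∈∖⇒∈ : ∀ {S : Subset n} x {y} → y ∈ S ∖ x → y ∈ S
  ∈∖⇒∈ {S} x = SubP.p─q⊆p S ⁅ x ⁆

∈─⇒∉ : ∀ {n} (S T : Subset n) {y} → y ∈ S Data.Fin.Subset.─ T → y ∉ T
∈─⇒∉ (inside ∷ S)  (outside ∷ T) here      ()
∈─⇒∉ (inside ∷ S)  (inside ∷ T)  (there p) (there q) = ∈─⇒∉ S T p q
∈─⇒∉ (inside ∷ S)  (outside ∷ T) (there p) (there q) = ∈─⇒∉ S T p q
∈─⇒∉ (outside ∷ S) (inside ∷ T)  (there p) (there q) = ∈─⇒∉ S T p q
∈─⇒∉ (outside ∷ S) (outside ∷ T) (there p) (there q) = ∈─⇒∉ S T p q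

module _ {n : ℕ} where

  ∈∖⇒≢ : ∀ {S : Subset n} {x y} → y ∈ S ∖ x → y ≢ x
  ∈∖⇒≢ {S} {x} y∈ refl = ∈─⇒∉ S ⁅ x ⁆ y∈ (SubP.x∈⁅x⁆ x)

  x∉∖x : ∀ {S : Subset n} {x} → x ∉ S ∖ x
  x∉∖x x∈ = ∈∖⇒≢ x∈ refl

  ∖-mono : ∀ {S T : Subset n} {x} → S ⊆ T → S ∖ x ⊆ T ∖ x
  ∖-mono {x = x} S⊆T y∈ = ∈∖ (S⊆T (∈∖⇒∈ x y∈)) (∈∖⇒≢ y∈)

  ⊆∖∪ : ∀ {S : Subset n} x → S ⊆ (S ∖ x) ∪ ⁅ x ⁆
  ⊆∖∪ {S} x {y} y∈ with y FinP.≟ x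
  ... | yes refl = x∈∪⁅x⁆ (S ∖ x) x
  ... | no y≢x   = ∈∪ˡ (∈∖ y∈ y≢x)

∣∪⁅⁆∣ : ∀ {n} (S : Subset n) x → x ∉ S → ∣ S ∪ ⁅ x ⁆ ∣ ≡ suc ∣ S ∣
∣∪⁅⁆∣ (inside ∷ S)  zero    x∉S = contradiction here x∉S
∣∪⁅⁆∣ (outside ∷ S) zero    x∉S = ≡.cong (suc ∘ ∣_∣) (SubP.⊆-antisym (λ y∈ → [ id , ⊥-elim ∘ SubP.∉⊥ ]′ (SubP.x∈p∪q⁻ S ⊥ y∈)) ∈∪ˡ)
∣∪⁅⁆∣ (inside ∷ S)  (suc x) x∉S = ≡.cong suc (∣∪⁅⁆∣ S x (x∉S ∘ there))
∣∪⁅⁆∣ (outside ∷ S) (suc x) x∉S = ∣∪⁅⁆∣ S x (x∉S ∘ there)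

∖∪≡ : ∀ {n} {S : Subset n} {x} → x ∈ S → (S ∖ x) ∪ ⁅ x ⁆ ≡ S
∖∪≡ {S = S} {x} x∈S = SubP.⊆-antisym (∪⁅⁆⊆ (∈∖⇒∈ x) x∈S) (⊆∖∪ x)

∣∖∣ : ∀ {n} (S : Subset n) {x} → x ∈ S → suc ∣ S ∖ x ∣ ≡ ∣ S ∣
∣∖∣ S {x} x∈S = ≡.trans (≡.sym (∣∪⁅⁆∣ (S ∖ x) x x∉∖x)) (≡.cong ∣_∣ (∖∪≡ x∈S))

⊈⇒∃ : ∀ {n} {S T : Subset n} → ¬ S ⊆ T → ∃[ x ] (x ∈ S × x ∉ T)
⊈⇒∃ {S = S} {T} S⊈T with FinP.any? (λ x → SubP._∈?_ x S Dec.×-dec Dec.¬? (x SubP.∈? T))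
... | yes found = found
... | no none   = contradiction (λ {x} x∈S → Dec.decidable-stable (x SubP.∈? T) (λ x∉T → none (x , x∈S , x∉T))) S⊈T

setOf : ∀ {n} {P : Fin n → Set} → (∀ i → Dec (P i)) → Subset n
setOf P? = tabulate λ i → Dec.isYes (P? i)

∈setOf : ∀ {n} {P : Fin n → Set} (P? : ∀ i → Dec (P i)) i → i ∈ setOf P? ⇔ P i
∈setOf P? i = mk⇔
  (λ i∈ → Dec.toWitness {a? = P? i} (Equivalence.from BoolP.T-≡ (≡.trans (≡.sym (VecP.lookup∘tabulate _ i)) (VecP.[]=⇒lookup i∈))))
  (λ p → VecP.lookup⇒[]= i _ (≡.trans (VecP.lookup∘tabulate _ i) (Equivalence.to BoolP.T-≡ (Dec.fromWitness {a? = P? i} p))))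

-- Bases, circuits and fundamental cocircuits of a matroid.

module Matroid {n : ℕ} {Indep : IndepSys n} (M : IsMatroid Indep) where
  open IsMatroid M

  augment : ∀ {S T} → Indep S → Indep T → ∣ S ∣ ≤ ∣ T ∣ → ∃[ S′ ] (Indep S′ × S ⊆ S′ × S′ ⊆ S ∪ T × ∣ S′ ∣ ≡ ∣ T ∣)
  augment {S} {T} = go (∣ T ∣ ∸ ∣ S ∣) S refl
    where
    go : ∀ k S → ∣ T ∣ ∸ ∣ S ∣ ≡ k → Indep S → Indep T → ∣ S ∣ ≤ ∣ T ∣ →
         ∃[ S′ ] (Indep S′ × S ⊆ S′ × S′ ⊆ S ∪ T × ∣ S′ ∣ ≡ ∣ T ∣)
    go zero    S eq iS iT le = S , iS , id , ∈∪ˡ , ℕP.≤-antisym le (ℕP.m∸n≡0⇒m≤n eq)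
    go (suc k) S eq iS iT le with exchange iS iT (ℕP.m∸n≢0⇒n<m (λ eq0 → ℕP.1+n≢0 (≡.trans (≡.sym eq) eq0)))
    ... | x , x∈T , x∉S , iSx with go k (S ∪ ⁅ x ⁆) shorter iSx iT
                                     (≡.subst (_≤ ∣ T ∣) (≡.sym (∣∪⁅⁆∣ S x x∉S)) (ℕP.m∸n≢0⇒n<m (λ eq0 → ℕP.1+n≢0 (≡.trans (≡.sym eq) eq0))))
      where
      shorter : ∣ T ∣ ∸ ∣ S ∪ ⁅ x ⁆ ∣ ≡ k
      shorter = ≡.trans (≡.cong (∣ T ∣ ∸_) (∣∪⁅⁆∣ S x x∉S)) (≡.trans (≡.sym (ℕP.pred[m∸n]≡m∸[1+n] ∣ T ∣ ∣ S ∣)) (≡.cong ℕ.pred eq))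
    ...   | S′ , iS′ , Sx⊆S′ , S′⊆ , card = S′ , iS′ , (λ y∈S → Sx⊆S′ (∈∪ˡ y∈S)) , S′⊆S∪T , card
      where
      S′⊆S∪T : S′ ⊆ S ∪ T
      S′⊆S∪T y∈ with SubP.x∈p∪q⁻ (S ∪ ⁅ x ⁆) T (S′⊆ y∈)
      ... | inj₂ y∈T = ∈∪ʳ y∈T
      ... | inj₁ y∈Sx with ∈∪⁅⁆⁻ y∈Sx
      ...   | inj₁ y∈S  = ∈∪ˡ y∈S
      ...   | inj₂ refl = ∈∪ʳ x∈T

  indep-card≤ : ∀ {B S} → IsBasis Indep B → Indep S → ∣ S ∣ ≤ ∣ B ∣
  indep-card≤ {B} {S} (iB , maxB) iS with ∣ B ∣ ℕP.<? ∣ S ∣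
  ... | no ≮   = ℕP.≮⇒≥ ≮
  ... | yes lt with exchange iB iS lt
  ...   | x , _ , x∉B , iBx = contradiction (maxB _ ∈∪ˡ iBx (x∈∪⁅x⁆ B x)) x∉B

  basis-card : ∀ {B B′} → IsBasis Indep B → IsBasis Indep B′ → ∣ B ∣ ≡ ∣ B′ ∣
  basis-card b b′ = ℕP.≤-antisym (indep-card≤ b′ (proj₁ b)) (indep-card≤ b (proj₁ b′))

  card⇒basis : ∀ {B S} → IsBasis Indep B → Indep S → ∣ S ∣ ≡ ∣ B ∣ → IsBasis Indep S
  card⇒basis {B} {S} b iS card = iS , maximal
    where
    maximal : ∀ T → S ⊆ T → Indep T → T ⊆ S
    maximal T S⊆T iT {x} x∈T = Dec.decidable-stable (x SubP.∈? S) λ x∉S →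
      ℕP.<⇒≱ (SubP.p⊂q⇒∣p∣<∣q∣ (S⊆T , x , x∈T , x∉S)) (≡.subst (∣ T ∣ ≤_) (≡.sym card) (indep-card≤ b iT))

  extend-to-basis : ∀ {S T} → Indep S → IsBasis Indep T → ∃[ S′ ] (IsBasis Indep S′ × S ⊆ S′ × S′ ⊆ S ∪ T)
  extend-to-basis iS bT with augment iS (proj₁ bT) (indep-card≤ bT iS)
  ... | S′ , iS′ , S⊆S′ , S′⊆ , card = S′ , card⇒basis bT iS′ card , S⊆S′ , S′⊆

  -- A basis between S and S ∪ T has to meet D, and j is the only candidate.
  extend-through : ∀ {S T D j} → Indep S → IsBasis Indep T → MeetsAllBases Indep D →
                   (∀ {x} → x ∈ S → x ∉ D) → (∀ {x} → x ∈ T → x ∈ D → x ≡ j) → Indep (S ∪ ⁅ j ⁆)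
  extend-through iS bT meets S∩D T∩D with extend-to-basis iS bT
  ... | S′ , bS′ , S⊆S′ , S′⊆ with meets S′ bS′
  ...   | x , x∈D , x∈S′ with SubP.x∈p∪q⁻ _ _ (S′⊆ x∈S′)
  ...     | inj₁ x∈S = contradiction x∈D (S∩D x∈S)
  ...     | inj₂ x∈T with T∩D x∈T x∈D
  ...       | refl = hereditary (∪⁅⁆⊆ S⊆S′ x∈S′) (proj₁ bS′)

  basis-exchange : ∀ {B T j} → IsBasis Indep B → IsBasis Indep T → j ∈ B →
                   ∃[ x ] (x ∈ T × x ∉ B ∖ j × IsBasis Indep ((B ∖ j) ∪ ⁅ x ⁆))
  basis-exchange {B} {T} {j} bB bT j∈B
    with exchange (hereditary (∈∖⇒∈ j) (proj₁ bB)) (proj₁ bT) (ℕP.≤-reflexive (≡.trans (∣∖∣ B j∈B) (basis-card bB bT)))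
  ... | x , x∈T , x∉ , i = x , x∈T , x∉ , card⇒basis bB i (≡.trans (∣∪⁅⁆∣ (B ∖ j) x x∉) (∣∖∣ B j∈B))

  circuit-remove : ∀ {C j} → IsCircuit Indep C → j ∈ C → Indep (C ∖ j)
  circuit-remove {C} {j} (_ , minimal) j∈C = Dec.decidable-stable (indep? (C ∖ j)) λ ¬i →
    x∉∖x (minimal (C ∖ j) (∈∖⇒∈ j) ¬i j∈C)

  -- Minimality has to be tested only on `C` minus one element, which makes being a circuit a finite
  -- check.
  circuit-intro : ∀ {C} → ¬ Indep C → (∀ e → e ∈ C → Indep (C ∖ e)) → IsCircuit Indep C
  circuit-intro ¬iC remove = ¬iC , λ D D⊆C ¬iD {x} x∈C → Dec.decidable-stable (x SubP.∈? D) λ x∉D →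
    ¬iD (hereditary (λ y∈D → ∈∖ (D⊆C y∈D) λ { refl → x∉D y∈D }) (remove x x∈C))

  circuit? : ∀ C → Dec (IsCircuit Indep C)
  circuit? C = Dec.map′ (λ (¬iC , remove) → circuit-intro ¬iC remove) (λ c → proj₁ c , λ e → circuit-remove c)
    (Dec.¬? (indep? C) Dec.×-dec FinP.all? λ e → (e SubP.∈? C) Dec.→-dec indep? (C ∖ e))

  dependent⇒circuit : ∀ {S} → ¬ Indep S → ∃[ C ] (IsCircuit Indep C × C ⊆ S)
  dependent⇒circuit {S} = go S (SubI.⊂-wellFounded S)
    where
    go : ∀ S → SubI.Acc _⊂_ S → ¬ Indep S → ∃[ C ] (IsCircuit Indep C × C ⊆ S)
    go S (SubI.acc smaller) ¬iS with FinP.any? (λ e → (e SubP.∈? S) Dec.×-dec Dec.¬? (indep? (S ∖ e)))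
    ... | no none = S , circuit-intro ¬iS (λ e e∈S → Dec.decidable-stable (indep? (S ∖ e)) λ ¬i → none (e , e∈S , ¬i)) , id
    ... | yes (e , e∈S , ¬i) with go (S ∖ e) (smaller (SubP.x∈p⇒p-x⊂p e∈S)) ¬i
    ...   | C , c , C⊆ = C , c , λ x∈C → ∈∖⇒∈ e (C⊆ x∈C)

  module FundamentalCocircuit {B : Subset n} (bB : IsBasis Indep B) {j : Fin n} (j∈B : j ∈ B) where

    -- The exchange description of coc(B, j): all i for which B - j + i is a basis. As `i ∉ B ∖ j`
    -- fixes the cardinality, independence suffices.
    Replaces : Fin n → Set
    Replaces i = i ∉ B ∖ j × Indep ((B ∖ j) ∪ ⁅ i ⁆)

    replaces⇒basis : ∀ {i} → Replaces i → IsBasis Indep ((B ∖ j) ∪ ⁅ i ⁆)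
    replaces⇒basis {i} (i∉ , ind) = card⇒basis bB ind (≡.trans (∣∪⁅⁆∣ (B ∖ j) i i∉) (∣∖∣ B j∈B))

    replaces? : ∀ i → Dec (Replaces i)
    replaces? i = Dec.¬? (i SubP.∈? (B ∖ j)) Dec.×-dec indep? _

    j-replaces : Replaces j
    j-replaces = x∉∖x , hereditary (∪⁅⁆⊆ (∈∖⇒∈ j) j∈B) (proj₁ bB)

    private
      ∉∖⇒∈ : ∀ {i} → i ∉ B ∖ j → i ∈ ∁ B ∪ ⁅ j ⁆
      ∉∖⇒∈ {i} i∉ with i FinP.≟ j
      ... | yes refl = x∈∪⁅x⁆ (∁ B) i
      ... | no i≢j   = ∈∪ˡ (SubP.x∉p⇒x∈∁p λ i∈B → i∉ (∈∖ i∈B i≢j))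

      ∈⇒∉∖ : ∀ {i} → i ∈ ∁ B ∪ ⁅ j ⁆ → i ∉ B ∖ j
      ∈⇒∉∖ i∈ i∈B∖j with ∈∪⁅⁆⁻ i∈
      ... | inj₁ i∈∁B = SubP.x∈∁p⇒x∉p i∈∁B (∈∖⇒∈ j i∈B∖j)
      ... | inj₂ i≡j  = ∈∖⇒≢ i∈B∖j i≡j

    -- Exchanging j towards an arbitrary basis T finds an element of T in D. D is minimal because
    -- for i in D the basis B - j + i meets D in i only.
    fromReplaces : ∀ {D} → (∀ i → i ∈ D ⇔ Replaces i) → IsFundCocircuit Indep B j D
    fromReplaces {D} iff = (meets , minimal) , (λ {i} i∈D → ∉∖⇒∈ (proj₁ (to i i∈D))) , from j j-replaces
      where
      to = λ i → Equivalence.to (iff i)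
      from = λ i → Equivalence.from (iff i)
      meets : MeetsAllBases Indep D
      meets T bT with basis-exchange bB bT j∈B
      ... | x , x∈T , x∉ , b = x , from x (x∉ , proj₁ b) , x∈T
      minimal : ∀ D′ → D′ ⊆ D → MeetsAllBases Indep D′ → D ⊆ D′
      minimal D′ D′⊆D meets′ {i} i∈D with meets′ _ (replaces⇒basis (to i i∈D))
      ... | x , x∈D′ , x∈ with ∈∪⁅⁆⁻ x∈
      ...   | inj₁ x∈B∖j = contradiction x∈B∖j (proj₁ (to x (D′⊆D x∈D′)))
      ...   | inj₂ refl  = x∈D′

    -- In particular the fundamental cocircuit is unique, so the one in a hypothesis may be compared
    -- with the computed one.
    toReplaces : ∀ {D} → IsFundCocircuit Indep B j D → ∀ i → i ∈ D ⇔ Replaces i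
    toReplaces {D} ((meets , minimal) , D⊆ , j∈D) i = mk⇔ to from
      where
      from : Replaces i → i ∈ D
      from rep with meets _ (replaces⇒basis rep)
      ... | x , x∈D , x∈ with ∈∪⁅⁆⁻ x∈
      ...   | inj₁ x∈B∖j = contradiction x∈B∖j (∈⇒∉∖ (D⊆ x∈D))
      ...   | inj₂ refl  = x∈D
      -- Minimality of D says only that `D ∖ i` cannot meet all bases; a basis missed by it is found
      -- by searching all subsets.
      isolates? : ∀ T → Dec ((Indep T × ∣ T ∣ ≡ ∣ B ∣) × (∀ x → x ∈ T → x ∉ D ∖ i))
      isolates? T = (indep? T Dec.×-dec (∣ T ∣ ℕP.≟ ∣ B ∣)) Dec.×-dec
                    FinP.all? λ x → (x SubP.∈? T) Dec.→-dec Dec.¬? (x SubP.∈? (D ∖ i))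
      to : i ∈ D → Replaces i
      to i∈D with SubP.anySubset? isolates?
      ... | no none = contradiction i∈D (λ i∈D → x∉∖x (minimal (D ∖ i) (∈∖⇒∈ i) meets∖ i∈D))
        where
        meets∖ : MeetsAllBases Indep (D ∖ i)
        meets∖ T bT with FinP.any? (λ x → (x SubP.∈? (D ∖ i)) Dec.×-dec (x SubP.∈? T))
        ... | yes found = found
        ... | no none′  = contradiction (T , (proj₁ bT , basis-card bT bB) , λ x x∈T x∈D → none′ (x , x∈D , x∈T)) none
      -- The basis B - j + x meets D, but not in `B ∖ j`, so x is in D. It is also in T, which
      -- avoids `D ∖ i`; hence x is i.
      ... | yes (T , (iT , card) , T∩D∖i) with basis-exchange bB (card⇒basis bB iT card) j∈B
      ...   | x , x∈T , x∉ , b with meets _ b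
      ...     | y , y∈D , y∈ with ∈∪⁅⁆⁻ y∈
      ...       | inj₁ y∈B∖j = contradiction y∈B∖j (∈⇒∉∖ (D⊆ y∈D))
      ...       | inj₂ refl with y FinP.≟ i
      ...         | yes refl = x∉ , proj₁ b
      ...         | no y≢i   = contradiction (∈∖ y∈D y≢i) (T∩D∖i y x∈T)

    fundCocircuit : Subset n
    fundCocircuit = setOf replaces?

    fundCocircuit-isFund : IsFundCocircuit Indep B j fundCocircuit
    fundCocircuit-isFund = fromReplaces (∈setOf replaces?)

  -- If j were the only common element, then `C ∖ j` would be independent and avoid D, and extending
  -- it to a basis by elements of B would have to add j, making C independent.
  orthogonality : ∀ {B j C D} → IsBasis Indep B → IsFundCocircuit Indep B j D → j ∈ B → IsCircuit Indep C → j ∈ C →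
                  ∃[ k ] (k ∈ C × k ∈ D × k ≢ j)
  orthogonality {B} {j} {C} {D} bB ((meets , _) , D⊆ , _) j∈B c j∈C
    with FinP.any? (λ k → (k SubP.∈? C) Dec.×-dec (k SubP.∈? D) Dec.×-dec Dec.¬? (k FinP.≟ j))
  ... | yes found = found
  ... | no none   = contradiction (hereditary (⊆∖∪ j) (extend-through (circuit-remove c j∈C) bB meets avoid only)) (proj₁ c)
    where
    avoid : ∀ {x} → x ∈ C ∖ j → x ∉ D
    avoid {x} x∈ x∈D = none (x , ∈∖⇒∈ j x∈ , x∈D , ∈∖⇒≢ x∈)
    only : ∀ {x} → x ∈ B → x ∈ D → x ≡ j
    only x∈B x∈D with ∈∪⁅⁆⁻ (D⊆ x∈D)
    ... | inj₁ x∈∁B = contradiction x∈B (SubP.x∈∁p⇒x∉p x∈∁B)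
    ... | inj₂ x≡j  = x≡j

-- Broken circuits.

module BrokenCircuits {n : ℕ} {Indep : IndepSys n} (M : IsMatroid Indep) where
  open IsMatroid M
  open Matroid M

  -- A positive form of being a nonface; as it is decidable, it can be exchanged with `¬ IsBCFace`.
  HasBroken : Subset n → Set
  HasBroken F = ∃[ C ] ∃[ c ] (IsCircuit Indep C × IsMin Indep C c × C ∖ c ⊆ F)

  hasBroken? : ∀ F → Dec (HasBroken F)
  hasBroken? F = SubP.anySubset? λ C → FinP.any? λ c → circuit? C Dec.×-dec
    ((c SubP.∈? C) Dec.×-dec FinP.all? (λ x → (x SubP.∈? C) Dec.→-dec (toℕ c ℕP.≤? toℕ x))) Dec.×-dec (C ∖ c) SubP.⊆? F

  HasBroken-mono : ∀ {F F′} → F ⊆ F′ → HasBroken F → HasBroken F′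
  HasBroken-mono F⊆F′ (C , c , isC , isMin , C∖c⊆F) = C , c , isC , isMin , F⊆F′ ∘ C∖c⊆F

  nonface⇒broken : ∀ {F} → ¬ IsBCFace Indep F → HasBroken F
  nonface⇒broken {F} ¬face = Dec.decidable-stable (hasBroken? F) λ none →
    ¬face λ { _ (C , c , isC , isMin , refl) ⊆F → none (C , c , isC , isMin , ⊆F) }

  broken⇒nonface : ∀ {F} → HasBroken F → ¬ IsBCFace Indep F
  broken⇒nonface (C , c , isC , isMin , ⊆F) face = face (C ∖ c) (C , c , isC , isMin , refl) ⊆F

  min-exists : ∀ {C e} → e ∈ C → ∃ (IsMin Indep C)
  min-exists {C} = go _ ℕP.≤-refl
    where
    go : ∀ k {e} → toℕ e ≤ k → e ∈ C → ∃ (IsMin Indep C)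
    go k {e} e≤k e∈C with FinP.any? (λ x → (x SubP.∈? C) Dec.×-dec (toℕ x ℕP.<? toℕ e))
    ... | no none = e , e∈C , λ x x∈C → ℕP.≮⇒≥ λ x<e → none (x , x∈C , x<e)
    go zero    e≤k e∈C | yes (x , x∈C , x<e) = contradiction (ℕP.≤-trans x<e e≤k) λ ()
    go (suc k) e≤k e∈C | yes (x , x∈C , x<e) = go k (ℕP.≤-pred (ℕP.≤-trans x<e e≤k)) x∈C

  circuit-nonempty : ∀ {C} → IsCircuit Indep C → ∃[ e ] e ∈ C
  circuit-nonempty {C} (¬iC , _) with SubP.nonempty? C
  ... | yes found = found
  ... | no empty  = contradiction (hereditary (λ x∈C → contradiction (_ , x∈C) empty) indep-∅) ¬iC

  noBroken⇒indep : ∀ {F} → ¬ HasBroken F → Indep F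
  noBroken⇒indep {F} none = Dec.decidable-stable (indep? F) dependent
    where
    dependent : ¬ ¬ Indep F
    dependent ¬iF with dependent⇒circuit ¬iF
    ... | C , isC , C⊆F with min-exists (proj₂ (circuit-nonempty isC))
    ...   | c , isMin = none (C , c , isC , isMin , C⊆F ∘ ∈∖⇒∈ c)

-- The columns of a cocircuit signing that belong to a basis.

module Representation (K : Field) {n : ℕ} {Indep : IndepSys n} (M : IsMatroid Indep)
                      {B : Subset n} (bB : IsBasis Indep B) (A : Fin n → Fin n → Field.Carrier K) where
  open Field K hiding (zero) renaming (refl to ≈-refl)
  open RingSums commRing
  open IntegerSolver commRing
  open SetoidReasoning setoid
  open IsMatroid M
  open Matroid M

  Unit : Carrier → Set
  Unit x = ∃[ y ] x * y ≈ 1#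

  -- A kernel vector of `A` with support exactly `C`; orthogonality makes the rows of a circuit
  -- signing such vectors.
  CircuitRelation : Subset n → (Fin n → Carrier) → Set
  CircuitRelation C σ = (∀ i → i ∈ C → Unit (σ i)) × (∀ i → i ∉ C → σ i ≈ 0#) × (∀ j → j ∈ B → sum (λ i → A j i * σ i) ≈ 0#)

  module _ (A-diagonal : ∀ j → j ∈ B → Unit (A j j))
           (A-offDiagonal : ∀ j i → j ∈ B → i ∈ B → i ≢ j → A j i ≈ 0#)
           (A-outside : ∀ j i → j ∉ B → A j i ≈ 0#)
           (circuitRelation : ∀ C → IsCircuit Indep C → ∃ (CircuitRelation C)) where

    -- Invertibility of the submatrix with rows B and columns F, stated through vectors supported on
    -- F so that no square matrix has to be cut out.
    record Invertible (F : Subset n) : Set where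
      field
        injective  : ∀ (v : Fin n → Carrier) → (∀ i → i ∉ F → v i ≈ 0#) → (∀ j → j ∈ B → sum (λ i → A j i * v i) ≈ 0#) → ∀ i → v i ≈ 0#
        surjective : ∀ k → k ∈ B → Σ (Fin n → Carrier) λ v →
                     (∀ i → i ∉ F → v i ≈ 0#) × (∀ j → j ∈ B → sum (λ i → A j i * v i) ≈ δ j k)

    private
      sum-only : ∀ {m} (f : Fin m → Carrier) e → (∀ i → i ≢ e → f i ≈ 0#) → sum f ≈ f e
      sum-only f e f≈0 = trans (sum-cong term) (sum-δ e f)
        where
        term : ∀ i → f i ≈ δ i e * f i
        term i with i FinP.≟ e
        ... | yes refl = sym (trans (*-congʳ (δ-refl i)) (*-identityˡ _))
        ... | no i≢e   = trans (f≈0 i i≢e) (sym (trans (*-congʳ (δ-≢ i≢e)) (zeroˡ _)))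

      row-sum : ∀ j → j ∈ B → ∀ (v : Fin n → Carrier) → (∀ i → i ∉ B → v i ≈ 0#) → sum (λ i → A j i * v i) ≈ A j j * v j
      row-sum j j∈B v v≈0 = sum-only (λ i → A j i * v i) j λ i i≢j → vanish i i≢j
        where
        vanish : ∀ i → i ≢ j → A j i * v i ≈ 0#
        vanish i i≢j with i SubP.∈? B
        ... | yes i∈B = trans (*-congʳ (A-offDiagonal j i j∈B i∈B i≢j)) (zeroˡ _)
        ... | no i∉B  = trans (*-congˡ (v≈0 i i∉B)) (zeroʳ _)

      cancel-unit : ∀ {x y} → Unit x → x * y ≈ 0# → y ≈ 0#
      cancel-unit {x} {y} (u , xu≈1) xy≈0 = begin
        y            ≈⟨ *-identityˡ y ⟨
        1# * y       ≈⟨ *-congʳ xu≈1 ⟨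
        x * u * y    ≈⟨ solve 3 (λ x u y → x :* u :* y := u :* (x :* y)) ≈-refl x u y ⟩
        u * (x * y)  ≈⟨ *-congˡ xy≈0 ⟩
        u * 0#       ≈⟨ zeroʳ u ⟩
        0#           ∎

    invertible-B : Invertible B
    invertible-B = record { injective = injective ; surjective = surjective }
      where
      injective : ∀ (v : Fin n → Carrier) → (∀ i → i ∉ B → v i ≈ 0#) → (∀ j → j ∈ B → sum (λ i → A j i * v i) ≈ 0#) → ∀ i → v i ≈ 0#
      injective v v≈0 Av≈0 i with i SubP.∈? B
      ... | no i∉B  = v≈0 i i∉B
      ... | yes i∈B = cancel-unit (A-diagonal i i∈B) (trans (sym (row-sum i i∈B v v≈0)) (Av≈0 i i∈B))
      surjective : ∀ k → k ∈ B → Σ (Fin n → Carrier) λ v →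
                   (∀ i → i ∉ B → v i ≈ 0#) × (∀ j → j ∈ B → sum (λ i → A j i * v i) ≈ δ j k)
      surjective k k∈B with A-diagonal k k∈B
      ... | u , Au≈1 = v , v≈0 , λ j j∈B → trans (row-sum j j∈B v v≈0) (entry j)
        where
        v = λ i → δ i k * u
        v≈0 : ∀ i → i ∉ B → v i ≈ 0#
        v≈0 i i∉B = trans (*-congʳ (δ-≢ {i = i} {k} λ { refl → i∉B k∈B })) (zeroˡ u)
        entry : ∀ j → A j j * (δ j k * u) ≈ δ j k
        entry j with j FinP.≟ k
        ... | yes refl = trans (*-congˡ (trans (*-congʳ (δ-refl j)) (*-identityˡ u))) (trans Au≈1 (sym (δ-refl j)))
        ... | no j≢k   = trans (*-congˡ (trans (*-congʳ (δ-≢ j≢k)) (zeroˡ u))) (trans (zeroʳ _) (sym (δ-≢ j≢k)))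

    -- Adding a multiple of the vector of a circuit through x and e moves the support between F and F − e + x.
    invertible-exchange : ∀ {F e x C} → e ∈ F → x ∉ F → IsCircuit Indep C → C ⊆ F ∪ ⁅ x ⁆ → e ∈ C → x ∈ C →
                          Invertible ((F ∖ e) ∪ ⁅ x ⁆) → Invertible F
    invertible-exchange {F} {e} {x} {C} e∈F x∉F isC C⊆ e∈C x∈C inv = record { injective = injective ; surjective = surjective }
      where
      F₁ = (F ∖ e) ∪ ⁅ x ⁆
      module Inv = Invertible inv
      σ = proj₁ (circuitRelation C isC)
      σ-unit = proj₁ (proj₂ (circuitRelation C isC))
      σ≈0 = proj₁ (proj₂ (proj₂ (circuitRelation C isC)))
      Aσ≈0 = proj₂ (proj₂ (proj₂ (circuitRelation C isC)))

      -- Subtracts the multiple of the circuit vector that cancels the entry at y, where u stands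
      -- for the inverse of `σ y`.
      clear : Fin n → (v : Fin n → Carrier) → Carrier → Fin n → Carrier
      clear y v u i = v i - v y * u * σ i

      clear-row : ∀ y v u j → j ∈ B → sum (λ i → A j i * clear y v u i) ≈ sum (λ i → A j i * v i)
      clear-row y v u j j∈B = begin
        sum (λ i → A j i * (v i - v y * u * σ i))
          ≈⟨ sum-cong (λ i → solve 4 (λ a v w s → a :* (v :- w :* s) := a :* v :- w :* (a :* s)) ≈-refl (A j i) (v i) (v y * u) (σ i)) ⟩
        sum (λ i → A j i * v i - v y * u * (A j i * σ i))
          ≈⟨ sum-sub (λ i → A j i * v i) (λ i → v y * u * (A j i * σ i)) ⟩
        sum (λ i → A j i * v i) - sum (λ i → v y * u * (A j i * σ i))
          ≈⟨ +-congˡ (-‿cong (trans (sym (*-distribˡ-sum (v y * u) (λ i → A j i * σ i))) (trans (*-congˡ (Aσ≈0 j j∈B)) (zeroʳ _)))) ⟩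
        sum (λ i → A j i * v i) - 0#
          ≈⟨ solve 2 (λ s z → s :- z := s :+ (z :- z :- z)) ≈-refl _ 0# ⟩
        sum (λ i → A j i * v i) + (0# - 0# - 0#)
          ≈⟨ +-congˡ (trans (+-congʳ (-‿inverseʳ 0#)) (-‿inverseʳ 0#)) ⟩
        sum (λ i → A j i * v i) + 0#
          ≈⟨ +-identityʳ _ ⟩
        sum (λ i → A j i * v i) ∎

      clear-at : ∀ y v u → σ y * u ≈ 1# → clear y v u y ≈ 0#
      clear-at y v u σu≈1 = begin
        v y - v y * u * σ y    ≈⟨ solve 3 (λ v u s → v :- v :* u :* s := v :- v :* (s :* u)) ≈-refl (v y) u (σ y) ⟩
        v y - v y * (σ y * u)  ≈⟨ +-congˡ (-‿cong (trans (*-congˡ σu≈1) (*-identityʳ _))) ⟩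
        v y - v y              ≈⟨ -‿inverseʳ _ ⟩
        0#                     ∎

      clear-off : ∀ y v u i → v i ≈ 0# → i ∉ C → clear y v u i ≈ 0#
      clear-off y v u i vi≈0 i∉C = trans (+-cong vi≈0 (-‿cong (trans (*-congˡ (σ≈0 i i∉C)) (zeroʳ _)))) (-‿inverseʳ 0#)

      -- Clearing e moves the support of v into `F₁`, so the result is zero. Its entry at x, where v
      -- vanishes, is minus `v e * u * σ x` with u and `σ x` units; so `v e` is zero and nothing was
      -- subtracted.
      injective : ∀ (v : Fin n → Carrier) → (∀ i → i ∉ F → v i ≈ 0#) → (∀ j → j ∈ B → sum (λ i → A j i * v i) ≈ 0#) → ∀ i → v i ≈ 0#
      injective v v≈0 Av≈0 i = trans (sym (trans (+-congˡ (-‿cong (trans (*-congʳ (trans (*-congʳ ve≈0) (zeroˡ _))) (zeroˡ _))))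
                                       (trans (+-congˡ (trans (sym (+-identityˡ _)) (-‿inverseʳ 0#))) (+-identityʳ _))))
                                     (w≈0 i)
        where
        u = proj₁ (σ-unit e e∈C)
        σu≈1 = proj₂ (σ-unit e e∈C)
        w = clear e v u
        w-off : ∀ i → i ∉ F₁ → w i ≈ 0#
        w-off i i∉F₁ with i FinP.≟ e
        ... | yes refl = clear-at e v u σu≈1
        ... | no i≢e   = clear-off e v u i (v≈0 i i∉F) λ i∈C → [ i∉F , (λ { refl → i∉F₁ (x∈∪⁅x⁆ (F ∖ e) x) }) ]′ (∈∪⁅⁆⁻ (C⊆ i∈C))
          where
          i∉F : i ∉ F
          i∉F i∈F = i∉F₁ (∈∪ˡ (∈∖ i∈F i≢e))
        w≈0 : ∀ i → w i ≈ 0#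
        w≈0 = Inv.injective w w-off λ j j∈B → trans (clear-row e v u j j∈B) (Av≈0 j j∈B)
        veuσx≈0 : σ x * (v e * u) ≈ 0#
        veuσx≈0 = begin
          σ x * (v e * u)                ≈⟨ solve 3 (λ s v t → s :* v := t :- (t :- v :* s)) ≈-refl (σ x) (v e * u) (v x) ⟩
          v x - (v x - v e * u * σ x)    ≈⟨ +-cong (v≈0 x x∉F) (-‿cong (w≈0 x)) ⟩
          0# - 0#                        ≈⟨ -‿inverseʳ 0# ⟩
          0#                             ∎
        ve≈0 : v e ≈ 0#
        ve≈0 = begin
          v e                ≈⟨ trans (*-congʳ σu≈1) (*-identityˡ _) ⟨
          σ e * u * v e      ≈⟨ solve 3 (λ s u v → s :* u :* v := s :* (v :* u)) ≈-refl (σ e) u (v e) ⟩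
          σ e * (v e * u)    ≈⟨ *-congˡ (cancel-unit (σ-unit x x∈C) veuσx≈0) ⟩
          σ e * 0#           ≈⟨ zeroʳ _ ⟩
          0#                 ∎

      surjective : ∀ k → k ∈ B → Σ (Fin n → Carrier) λ v →
                   (∀ i → i ∉ F → v i ≈ 0#) × (∀ j → j ∈ B → sum (λ i → A j i * v i) ≈ δ j k)
      surjective k k∈B with Inv.surjective k k∈B
      ... | v , v≈0 , Av≈δ = clear x v u , w-off , λ j j∈B → trans (clear-row x v u j j∈B) (Av≈δ j j∈B)
        where
        u = proj₁ (σ-unit x x∈C)
        w-off : ∀ i → i ∉ F → clear x v u i ≈ 0#
        w-off i i∉F with i FinP.≟ x
        ... | yes refl = clear-at x v u (proj₂ (σ-unit x x∈C))
        ... | no i≢x   = clear-off x v u i (v≈0 i λ i∈F₁ → [ i∉F ∘ ∈∖⇒∈ e , i≢x ]′ (∈∪⁅⁆⁻ i∈F₁))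
                                   λ i∈C → [ i∉F , i≢x ]′ (∈∪⁅⁆⁻ (C⊆ i∈C))

    -- An element e of F outside B is exchanged for some x in B, until F is B. The circuit in F ∪
    -- {x} contains e and x, because F - e + x and F are independent, so invertibility can be pulled
    -- back along it.
    basis⇒invertible : ∀ {F} → IsBasis Indep F → Invertible F
    basis⇒invertible {F} bF = go _ ℕP.≤-refl bF
      where
      go : ∀ k {F} → ∣ F Data.Fin.Subset.─ B ∣ ≤ k → IsBasis Indep F → Invertible F
      go k {F} card bF with F SubP.⊆? B
      ... | yes F⊆B = ≡.subst Invertible (SubP.⊆-antisym (proj₂ bF B F⊆B (proj₁ bB)) F⊆B) invertible-B
      ... | no F⊈B with ⊈⇒∃ F⊈B
      ...   | e , e∈F , e∉B with basis-exchange bF bB e∈F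
      ...     | x , x∈B , x∉F∖e , bF₁ with dependent⇒circuit {F ∪ ⁅ x ⁆} dependent
        where
        x≢e : x ≢ e
        x≢e refl = e∉B x∈B
        dependent : ¬ Indep (F ∪ ⁅ x ⁆)
        dependent i = ℕP.1+n≰n (≡.subst (_≤ ∣ F ∣) (∣∪⁅⁆∣ F x λ x∈F → x∉F∖e (∈∖ x∈F x≢e)) (indep-card≤ bF i))
      ...       | C , isC , C⊆ = invertible-exchange e∈F x∉F isC C⊆ e∈C x∈C (descend k card)
        where
        F₁ = (F ∖ e) ∪ ⁅ x ⁆
        x∉F : x ∉ F
        x∉F x∈F = x∉F∖e (∈∖ x∈F λ { refl → e∉B x∈B })
        e∈C : e ∈ C
        e∈C = Dec.decidable-stable (e SubP.∈? C) λ e∉C → proj₁ isC (hereditary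
          (λ y∈C → [ (λ y∈F → ∈∪ˡ (∈∖ y∈F λ { refl → e∉C y∈C })) , (λ { refl → x∈∪⁅x⁆ (F ∖ e) x }) ]′ (∈∪⁅⁆⁻ (C⊆ y∈C))) (proj₁ bF₁))
        x∈C : x ∈ C
        x∈C = Dec.decidable-stable (x SubP.∈? C) λ x∉C → proj₁ isC (hereditary
          (λ y∈C → [ id , (λ { refl → contradiction y∈C x∉C }) ]′ (∈∪⁅⁆⁻ (C⊆ y∈C))) (proj₁ bF))
        closer : F₁ Data.Fin.Subset.─ B ⊂ F Data.Fin.Subset.─ B
        closer = (λ y∈ → SubP.x∈p∧x∉q⇒x∈p─q (old y∈) (∈─⇒∉ F₁ B y∈)) ,
                 e , SubP.x∈p∧x∉q⇒x∈p─q e∈F e∉B , λ e∈ → [ x∉∖x , (λ { refl → e∉B x∈B }) ]′ (∈∪⁅⁆⁻ (SubP.p─q⊆p F₁ B e∈))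
          where
          old : ∀ {y} → y ∈ F₁ Data.Fin.Subset.─ B → y ∈ F
          old y∈ = [ ∈∖⇒∈ e , (λ { refl → contradiction x∈B (∈─⇒∉ F₁ B y∈) }) ]′ (∈∪⁅⁆⁻ (SubP.p─q⊆p F₁ B y∈))
        descend : ∀ k → ∣ F Data.Fin.Subset.─ B ∣ ≤ k → Invertible F₁
        descend zero    card = contradiction (ℕP.≤-trans (SubP.p⊂q⇒∣p∣<∣q∣ closer) card) λ ()
        descend (suc k) card = go k (ℕP.≤-pred (ℕP.≤-trans (SubP.p⊂q⇒∣p∣<∣q∣ closer) card)) bF₁

    record Inverse (F : Subset n) : Set where
      field
        G    : Fin n → Fin n → Carrier
        AG≈δ : ∀ l j → j ∈ B → sum (λ i → A l i * G i j) ≈ δ l j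
        GA≈δ : ∀ k i → k ∈ F → i ∈ F → sum (λ l → G k l * A l i) ≈ δ k i
        G≈0  : ∀ k l → k ∉ F → G k l ≈ 0#

    -- The columns of G are preimages of unit vectors, which gives AG = 1. A column of GA - 1 with
    -- index in F is supported on F and killed by A, so injectivity gives GA = 1 on F.
    inverse-matrix : ∀ {F} → Invertible F → Inverse F
    inverse-matrix {F} inv = record { G = G ; AG≈δ = AG≈δ ; GA≈δ = GA≈δ ; G≈0 = G≈0 }
      where
      open Invertible inv
      column : ∀ j → Σ (Fin n → Carrier) λ v → (∀ i → i ∉ F → v i ≈ 0#) × (j ∈ B → ∀ l → l ∈ B → sum (λ i → A l i * v i) ≈ δ l j)
      column j with j SubP.∈? B
      ... | yes j∈B with surjective j j∈B
      ...   | v , v≈0 , Av≈δ = v , v≈0 , λ _ → Av≈δ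
      -- Columns outside B are unconstrained; zero keeps them supported on F.
      column j | no j∉B = (λ _ → 0#) , (λ _ _ → ≈-refl) , λ j∈B → contradiction j∈B j∉B
      G : Fin n → Fin n → Carrier
      G i j = proj₁ (column j) i
      G≈0 : ∀ k l → k ∉ F → G k l ≈ 0#
      G≈0 k l = proj₁ (proj₂ (column l)) k
      AG≈δ : ∀ l j → j ∈ B → sum (λ i → A l i * G i j) ≈ δ l j
      AG≈δ l j j∈B with l SubP.∈? B
      ... | yes l∈B = proj₂ (proj₂ (column j)) j∈B l l∈B
      ... | no l∉B  = trans (sum-zero λ i → trans (*-congʳ (A-outside l i l∉B)) (zeroˡ (G i j))) (sym (δ-≢ {i = l} {j} λ { refl → l∉B j∈B }))
      GA≈δ : ∀ k i → k ∈ F → i ∈ F → sum (λ l → G k l * A l i) ≈ δ k i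
      GA≈δ k i k∈F i∈F = begin
        sum (λ l → G k l * A l i)                        ≈⟨ solve 2 (λ s d → s := (s :- d) :+ d) ≈-refl _ (δ k i) ⟩
        (sum (λ l → G k l * A l i) - δ k i) + δ k i      ≈⟨ +-congʳ (injective v v≈0 Av≈0 k) ⟩
        0# + δ k i                                       ≈⟨ +-identityˡ _ ⟩
        δ k i                                            ∎
        where
        v : Fin n → Carrier
        v k = sum (λ l → G k l * A l i) - δ k i
        v≈0 : ∀ k → k ∉ F → v k ≈ 0#
        v≈0 k k∉F = trans (+-cong (sum-zero λ l → trans (*-congʳ (G≈0 k l k∉F)) (zeroˡ (A l i))) (-‿cong (δ-≢ {i = k} {i} λ { refl → k∉F i∈F }))) (-‿inverseʳ 0#)
        Av≈0 : ∀ j → j ∈ B → sum (λ k → A j k * v k) ≈ 0#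
        Av≈0 j j∈B = begin
          sum (λ k → A j k * v k)
            ≈⟨ sum-cong (λ k → trans (solve 3 (λ a s d → a :* (s :- d) := a :* s :- a :* d) ≈-refl (A j k) (sum (λ l → G k l * A l i)) (δ k i))
                 (+-congʳ (trans (*-distribˡ-sum (A j k) (λ l → G k l * A l i)) (sum-cong λ l → sym (*-assoc (A j k) (G k l) (A l i)))))) ⟩
          sum (λ k → sum (λ l → A j k * G k l * A l i) - A j k * δ k i)
            ≈⟨ sum-sub (λ k → sum (λ l → A j k * G k l * A l i)) (λ k → A j k * δ k i) ⟩
          sum (λ k → sum (λ l → A j k * G k l * A l i)) - sum (λ k → A j k * δ k i)
            ≈⟨ +-cong (trans (∑-comm (λ k l → A j k * G k l * A l i)) (sum-cong λ l → trans (sym (*-distribʳ-sum (A l i) (λ k → A j k * G k l))) (row l)))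
                      (-‿cong (sum-δʳ i (A j))) ⟩
          sum (λ l → A l i * δ l j) - A j i
            ≈⟨ +-congʳ (sum-δʳ j (λ l → A l i)) ⟩
          A j i - A j i
            ≈⟨ -‿inverseʳ _ ⟩
          0# ∎
          where
          row : ∀ l → sum (λ k → A j k * G k l) * A l i ≈ A l i * δ l j
          row l = byMembership (l SubP.∈? B)
            where
            δ-sym : ∀ i j → δ i j ≈ δ j i
            δ-sym i j with i FinP.≟ j
            ... | yes refl = ≈-refl
            ... | no i≢j   = trans (δ-≢ i≢j) (sym (δ-≢ (i≢j ∘ ≡.sym)))
            byMembership : Dec (l ∈ B) → sum (λ k → A j k * G k l) * A l i ≈ A l i * δ l j
            byMembership (no l∉B)  = trans (trans (*-congˡ (A-outside l i l∉B)) (zeroʳ _)) (sym (trans (*-congʳ (A-outside l i l∉B)) (zeroˡ _)))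
            byMembership (yes l∈B) = trans (*-congʳ (trans (AG≈δ j l l∈B) (δ-sym j l))) (*-comm _ _)

-- Ideals generated by variables.

module SquareFreeIdeals (K : Field) (n : ℕ) where
  open Poly K n
  open Polynomials K n
  open CommutativeRing polyRing hiding (zero) renaming (refl to ≈-refl)
  open KoszulModulo polyRing

  supp : Mono n → Subset n
  supp α = setOf λ i → involves? i α

  ∈supp : ∀ {α i} → Involves i α → i ∈ supp α
  ∈supp {α} {i} = Equivalence.from (∈setOf (λ i → involves? i α) i)

  supp∈ : ∀ {α i} → i ∈ supp α → Involves i α
  supp∈ {α} {i} = Equivalence.to (∈setOf (λ i → involves? i α) i)

  exact-transport : ∀ {m} {T T′ : Mono n → Set} {θ : Fin m → Pol} {S} →
                    (∀ {α} → T α → T′ α) → (∀ {α} → T′ α → T α) → ExactMod (Span T) θ S → ExactMod (Span T′) θ S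
  exact-transport T⇒T′ T′⇒T exact b bθ∈ with exact b (Span-mono T′⇒T bθ∈)
  ... | f , f∈ = f , λ j j∈S → Span-mono T⇒T′ (f∈ j j∈S)

  Outside : Subset n → Mono n → Set
  Outside F α = ∃[ i ] (i ∉ F × Involves i α)

  outside-up : ∀ {F} → UpClosed (Outside F)
  outside-up β (i , i∉F , i∈α) = i , i∉F , involves-⊕ β i∈α

  -- Modulo the variables outside F each xₑ with e in F is a nonzerodivisor, and adding it gives the
  -- ideal for `F ∖ e`; induction on F by `exact-insert`.
  exact-variables : ∀ F → ExactMod (Span (Outside F)) X F
  exact-variables F = go F (SubI.⊂-wellFounded F)
    where
    go : ∀ F → SubI.Acc _⊂_ F → ExactMod (Span (Outside F)) X F
    go F (SubI.acc smaller) with SubP.nonempty? F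
    ... | no empty = λ b _ → (λ _ _ → 0#) , λ j j∈F → contradiction (j , j∈F) empty
    ... | yes (e , e∈F) = exact-insert (Span-isIdeal outside-up) {J = Span (Outside (F ∖ e))} {e}
            (λ y∈ → Span-split e outside-up (Span-mono outside-split y∈))
            (Span-mono (λ { (i , i∉F , i∈α) → i , i∉F ∘ ∈∖⇒∈ e , i∈α }))
            (λ ez∈ → Span-mono outside-regular (Span-colon⁺ e ez∈))
            (λ j j∉F → spanned λ α ¬out → coeff-0 {T = Outside F} ((j , j∉F , involves-self j) ∷ []) ¬out)
            (go (F ∖ e) (smaller (SubP.x∈p⇒p-x⊂p e∈F)))
      where
      outside-split : ∀ {α} → Outside (F ∖ e) α → Outside F α ⊎ Involves e α
      outside-split (i , i∉ , i∈α) with i FinP.≟ e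
      ... | yes refl = inj₂ i∈α
      ... | no i≢e   = inj₁ (i , (λ i∈F → i∉ (∈∖ i∈F i≢e)) , i∈α)
      outside-regular : ∀ {α} → Outside F (unitVec e ⊕ α) → Outside F α
      outside-regular (i , i∉F , i∈) = i , i∉F , involves-unit⁻ {e = e} (λ { refl → i∉F e∈F }) i∈

-- Vanishing of first Koszul homology along deletions and inversions.

module KoszulVanishing (K : Field) {n : ℕ} {Indep : IndepSys n} (M : IsMatroid Indep)
                       {B : Subset n} (bB : IsBasis Indep B) (A : Fin n → Fin n → Field.Carrier K)
                       (A-diagonal : ∀ j → j ∈ B → Representation.Unit K M bB A (A j j))
                       (A-offDiagonal : ∀ j i → j ∈ B → i ∈ B → i ≢ j → Field._≈_ K (A j i) (Field.0# K))
                       (A-outside : ∀ j i → j ∉ B → Field._≈_ K (A j i) (Field.0# K))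
                       (circuitRelation : ∀ C → IsCircuit Indep C → ∃ (Representation.CircuitRelation K M bB A C)) where
  open Representation K M bB A
  open Poly K n
  open Polynomials K n
  open SquareFreeIdeals K n
  open CommutativeRing polyRing hiding (zero) renaming (refl to ≈-refl)
  open RingSums polyRing
  open Ideals polyRing
  open KoszulModulo polyRing
  open Matroid M
  open BrokenCircuits M
  open IsMatroid M using (hereditary; indep?)
  private
    module K = Field K

  θ : Fin n → Pol
  θ j = linForm (A j)

  θ≈0 : ∀ j → j ∉ B → θ j ≈ 0#
  θ≈0 j j∉B = trans (linForm-sum (A j)) (sum-zero λ i → trans (*-congʳ (trans (ι-cong (A-outside j i j∉B)) ι-0)) (zeroˡ (X i)))

  -- The inverse matrix has constant entries: `ι` carries its identities into the polynomial ring
  -- and `≈⇒∈` carries them into the quotient.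
  exact-basis : ∀ {F} → IsBasis Indep F → ExactMod (Span (Outside F)) θ B
  exact-basis {F} bF = exact⇒exactMod isI (Koszul.exact-linear-change (quotient isI)
    (λ j i → ι (A j i)) (λ k l → ι (G k l)) B F
    (λ l j j∈B → ≈⇒∈ (trans (trans (sum-cong λ i → sym (ι-* (A l i) (G i j))) (sym (ι-sum λ i → A l i K.* G i j)))
                       (trans (trans (ι-cong (AG≈δ l j j∈B)) (ι-δ l j)) (≡.subst (δ l j ≈_) (quotient-δ l j) ≈-refl))))
    (λ k i k∈F i∈F → ≈⇒∈ (trans (trans (sum-cong λ l → sym (ι-* (G k l) (A l i))) (sym (ι-sum λ l → G k l K.* A l i)))
                       (trans (trans (ι-cong (GA≈δ k i k∈F i∈F)) (ι-δ k i)) (≡.subst (δ k i ≈_) (quotient-δ k i) ≈-refl))))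
    (λ k l k∉F → ≈⇒∈ (trans (ι-cong (G≈0 k l k∉F)) ι-0))
    (λ i i∉F → resp (sym (trans (+-congˡ {X i} (≡.subst ((- 0#) ≈_) refl ≈-refl)) (+-identityʳ (X i)))) (X∈ i i∉F))
    (λ j → ≈⇒∈ (linForm-sum (A j)))
    (exactMod⇒exact isI (exact-variables F)))
    where
    isI = Span-isIdeal (outside-up {F})
    open IsIdeal isI
    open Inverse (inverse-matrix A-diagonal A-offDiagonal A-outside circuitRelation (basis⇒invertible A-diagonal A-offDiagonal A-outside circuitRelation bF))
    X∈ : ∀ i → i ∉ F → Span (Outside F) (X i)
    X∈ i i∉F = spanned λ α ¬out → coeff-0 {T = Outside F} ((i , i∉F , involves-self i) ∷ []) ¬out
    -- The two deltas have the same clauses, but at variable indices only induction identifies them.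
    quotient-δ : ∀ {m} (i j : Fin m) → δ i j ≡ RingSums.δ (quotient isI) i j
    quotient-δ zero    zero    = refl
    quotient-δ zero    (suc j) = refl
    quotient-δ (suc i) zero    = refl
    quotient-δ (suc i) (suc j) = quotient-δ i j

  -- The ideal obtained from the broken circuit ideal by adding the variables in D and inverting those in C.
  Reached : Subset n → Subset n → Mono n → Set
  Reached D C α = (∃[ d ] (d ∈ D × Involves d α)) ⊎ HasBroken (supp α ∪ C)

  reached-up : ∀ {D C} → UpClosed (Reached D C)
  reached-up β (inj₁ (d , d∈D , d∈α)) = inj₁ (d , d∈D , involves-⊕ β d∈α)
  reached-up {C = C} {α} β (inj₂ broken) = inj₂ (HasBroken-mono supp⊆ broken)
    where
    supp⊆ : supp α ∪ C ⊆ supp (β ⊕ α) ∪ C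
    supp⊆ y∈ = [ (λ y∈α → ∈∪ˡ (∈supp {β ⊕ α} (involves-⊕ β (supp∈ {α} y∈α)))) , ∈∪ʳ ]′ (SubP.x∈p∪q⁻ (supp α) C y∈)

  reached-split : ∀ {D C e α} → Reached (D ∪ ⁅ e ⁆) C α → Reached D C α ⊎ Involves e α
  reached-split (inj₂ broken) = inj₁ (inj₂ broken)
  reached-split (inj₁ (d , d∈ , d∈α)) with ∈∪⁅⁆⁻ d∈
  ... | inj₁ d∈D  = inj₁ (inj₁ (d , d∈D , d∈α))
  ... | inj₂ refl = inj₂ d∈α

  reached-⊆ : ∀ {D C e α} → Reached D C α → Reached (D ∪ ⁅ e ⁆) C α
  reached-⊆ (inj₁ (d , d∈D , d∈α)) = inj₁ (d , ∈∪ˡ d∈D , d∈α)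
  reached-⊆ (inj₂ broken)          = inj₂ broken

  module _ {D C : Subset n} {e : Fin n} (e∉D : e ∉ D) where

    -- With `reached-colon⁻`: the colon by xₑ only adds e to the inverted elements. Here `e ∉ D`
    -- matters, as the colon would be the unit ideal if xₑ were among the added variables.
    reached-colon⁺ : ∀ {α} → Reached D C (unitVec e ⊕ α) → Reached D (C ∪ ⁅ e ⁆) α
    reached-colon⁺ (inj₁ (d , d∈D , d∈)) = inj₁ (d , d∈D , involves-unit⁻ {e = e} (λ { refl → e∉D d∈D }) d∈)
    reached-colon⁺ {α} (inj₂ broken) = inj₂ (HasBroken-mono supp⊆ broken)
      where
      supp⊆ : supp (unitVec e ⊕ α) ∪ C ⊆ supp α ∪ (C ∪ ⁅ e ⁆)
      supp⊆ {y} y∈ with SubP.x∈p∪q⁻ (supp (unitVec e ⊕ α)) C y∈ | y FinP.≟ e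
      ... | _        | yes refl = ∈∪ʳ (x∈∪⁅x⁆ C e)
      ... | inj₂ y∈C | no _     = ∈∪ʳ (∈∪ˡ y∈C)
      ... | inj₁ y∈s | no y≢e   = ∈∪ˡ (∈supp {α} (involves-unit⁻ (y≢e ∘ ≡.sym) (supp∈ {unitVec e ⊕ α} y∈s)))

    reached-colon⁻ : ∀ {α} → Reached D (C ∪ ⁅ e ⁆) α → Reached D C (unitVec e ⊕ α)
    reached-colon⁻ (inj₁ (d , d∈D , d∈α)) = inj₁ (d , d∈D , involves-⊕ (unitVec e) d∈α)
    reached-colon⁻ {α} (inj₂ broken) = inj₂ (HasBroken-mono supp⊆ broken)
      where
      supp⊆ : supp α ∪ (C ∪ ⁅ e ⁆) ⊆ supp (unitVec e ⊕ α) ∪ C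
      supp⊆ y∈ with SubP.x∈p∪q⁻ (supp α) (C ∪ ⁅ e ⁆) y∈
      ... | inj₁ y∈α = ∈∪ˡ (∈supp {unitVec e ⊕ α} (involves-⊕ (unitVec e) (supp∈ {α} y∈α)))
      ... | inj₂ y∈Ce with ∈∪⁅⁆⁻ y∈Ce
      ...   | inj₁ y∈C  = ∈∪ʳ y∈C
      ...   | inj₂ refl = ∈∪ˡ (∈supp {unitVec e ⊕ α} (involves-unit e))

  -- Progress of the recursion from the last element down: the elements below `k` are still
  -- undecided.
  record Stage (k : ℕ) (D C : Subset n) : Set where
    field
      D-above  : ∀ {i} → i ∈ D → k ≤ toℕ i
      C-above  : ∀ {i} → i ∈ C → k ≤ toℕ i
      covered  : ∀ i → k ≤ toℕ i → i ∈ D ⊎ i ∈ C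
      disjoint : ∀ {i} → i ∈ D → i ∉ C

  -- Some basis survives the deletion of D. Bases are recognised by cardinality, so the recursion
  -- can decide this.
  Avoidable : Subset n → Set
  Avoidable D = ∃[ S ] ((Indep S × ∣ S ∣ ≡ ∣ B ∣) × (∀ i → i ∈ S → i ∉ D))

  avoidable? : ∀ D → Dec (Avoidable D)
  avoidable? D = SubP.anySubset? λ S → (indep? S Dec.×-dec (∣ S ∣ ℕP.≟ ∣ B ∣)) Dec.×-dec
                                       FinP.all? λ i → (i SubP.∈? S) Dec.→-dec Dec.¬? (i SubP.∈? D)

  module _ {k : ℕ} {D C : Subset n} {e : Fin n} (e≡k : toℕ e ≡ k) (stage : Stage (suc k) D C) where
    open Stage stage

    private
      e∉D : e ∉ D
      e∉D e∈D = ℕP.1+n≰n (≡.subst (suc k ≤_) e≡k (D-above e∈D))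

      e∉C : e ∉ C
      e∉C e∈C = ℕP.1+n≰n (≡.subst (suc k ≤_) e≡k (C-above e∈C))

      k≤e : k ≤ toℕ e
      k≤e = ℕP.≤-reflexive (≡.sym e≡k)

      ≢e : ∀ {i} → k ≤ toℕ i → i ≢ e → suc k ≤ toℕ i
      ≢e k≤i i≢e = ℕP.≤∧≢⇒< k≤i (λ k≡i → i≢e (FinP.toℕ-injective (≡.trans (≡.sym k≡i) (≡.sym e≡k))))

      above : ∀ {S} → (∀ {i} → i ∈ S → suc k ≤ toℕ i) → ∀ {i} → i ∈ S ∪ ⁅ e ⁆ → k ≤ toℕ i
      above S-above i∈ = [ (λ i∈S → ℕP.≤-trans (ℕP.n≤1+n k) (S-above i∈S)) , (λ { refl → k≤e }) ]′ (∈∪⁅⁆⁻ i∈)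

    stage-delete : Stage k (D ∪ ⁅ e ⁆) C
    stage-delete = record
      { D-above  = above D-above
      ; C-above  = λ i∈C → ℕP.≤-trans (ℕP.n≤1+n k) (C-above i∈C)
      ; covered  = λ i k≤i → cover i k≤i (i FinP.≟ e)
      ; disjoint = λ i∈ → [ disjoint , (λ { refl → e∉C }) ]′ (∈∪⁅⁆⁻ i∈)
      }
      where
      cover : ∀ i → k ≤ toℕ i → Dec (i ≡ e) → i ∈ D ∪ ⁅ e ⁆ ⊎ i ∈ C
      cover i k≤i (yes refl) = inj₁ (x∈∪⁅x⁆ D i)
      cover i k≤i (no i≢e)   = [ inj₁ ∘ ∈∪ˡ , inj₂ ]′ (covered i (≢e k≤i i≢e))

    stage-contract : Stage k D (C ∪ ⁅ e ⁆)
    stage-contract = record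
      { D-above  = λ i∈D → ℕP.≤-trans (ℕP.n≤1+n k) (D-above i∈D)
      ; C-above  = above C-above
      ; covered  = λ i k≤i → cover i k≤i (i FinP.≟ e)
      ; disjoint = λ i∈D i∈ → [ disjoint i∈D , (λ { refl → e∉D i∈D }) ]′ (∈∪⁅⁆⁻ i∈)
      }
      where
      cover : ∀ i → k ≤ toℕ i → Dec (i ≡ e) → i ∈ D ⊎ i ∈ C ∪ ⁅ e ⁆
      cover i k≤i (yes refl) = inj₂ (x∈∪⁅x⁆ C i)
      cover i k≤i (no i≢e)   = [ inj₁ , inj₂ ∘ ∈∪ˡ ]′ (covered i (≢e k≤i i≢e))

    -- If every basis avoiding D contains e, then a circuit through e meets D; its minimum lies below e, outside D.
    reached-coloop : Avoidable D → ¬ Avoidable (D ∪ ⁅ e ⁆) → ∀ {α} → Reached D (C ∪ ⁅ e ⁆) α → Reached D C α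
    reached-coloop _ _ (inj₁ meets) = inj₁ meets
    reached-coloop (S , (iS , card) , S∩D) ¬avoid {α} (inj₂ (C′ , c , isC , isMin , C′∖c⊆)) with e SubP.∈? (C′ ∖ c)
    ... | no e∉ = inj₂ (C′ , c , isC , isMin , λ y∈ → [ ∈∪ˡ , (λ y∈Ce → [ ∈∪ʳ , (λ { refl → contradiction y∈ e∉ }) ]′ (∈∪⁅⁆⁻ y∈Ce)) ]′ (SubP.x∈p∪q⁻ (supp α) (C ∪ ⁅ e ⁆) (C′∖c⊆ y∈)))
    ... | yes e∈ with FinP.any? (λ d → (d SubP.∈? D) Dec.×-dec involves? d α)
    ...   | yes meets = inj₁ meets
    ...   | no none with extend-to-basis (circuit-remove isC e∈C′) (card⇒basis bB iS card)
      where
      e∈C′ = ∈∖⇒∈ c e∈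
    ...     | S′ , bS′ , C′∖e⊆S′ , S′⊆ = contradiction (S′ , (proj₁ bS′ , basis-card bS′ bB) , avoid) ¬avoid
      where
      e∈C′ = ∈∖⇒∈ c e∈
      c<e : toℕ c < toℕ e
      c<e = ℕP.≤∧≢⇒< (proj₂ isMin e e∈C′) (λ c≡e → ∈∖⇒≢ e∈ (FinP.toℕ-injective (≡.sym c≡e)))
      -- Apart from its minimum c, the circuit lies in the support of α, in C or at e, all of which
      -- avoid D; and c is smaller than e, hence below everything in D.
      C′∩D : ∀ {y} → y ∈ C′ → y ∉ D
      C′∩D {y} y∈C′ y∈D with y FinP.≟ c
      ... | yes refl = ℕP.<⇒≱ c<e (≡.subst (_≤ toℕ y) (≡.sym e≡k) (ℕP.≤-trans (ℕP.n≤1+n k) (D-above y∈D)))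
      ... | no y≢c with SubP.x∈p∪q⁻ (supp α) (C ∪ ⁅ e ⁆) (C′∖c⊆ (∈∖ y∈C′ y≢c))
      ...   | inj₁ y∈α  = none (y , y∈D , supp∈ {α} y∈α)
      ...   | inj₂ y∈Ce = [ disjoint y∈D , (λ { refl → e∉D y∈D }) ]′ (∈∪⁅⁆⁻ y∈Ce)
      e∉S′ : e ∉ S′
      e∉S′ e∈S′ = proj₁ isC (hereditary (λ y∈ → ∪⁅⁆⊆ C′∖e⊆S′ e∈S′ (⊆∖∪ e y∈)) (proj₁ bS′))
      avoid : ∀ i → i ∈ S′ → i ∉ D ∪ ⁅ e ⁆
      avoid i i∈S′ i∈ with ∈∪⁅⁆⁻ i∈
      ... | inj₂ refl = e∉S′ i∈S′
      ... | inj₁ i∈D  = [ (λ i∈C′∖e → C′∩D (∈∖⇒∈ e i∈C′∖e) i∈D) , (λ i∈S → S∩D i i∈S i∈D) ]′ (SubP.x∈p∪q⁻ (C′ ∖ e) S (S′⊆ i∈S′))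

    -- If a basis survives without e, both outer terms are available for `exact-extension`. If not,
    -- `reached-coloop` shows that inverting xₑ leaves the ideal unchanged.
    exact-step : Avoidable D →
                 (Avoidable (D ∪ ⁅ e ⁆) → ExactMod (Span (Reached (D ∪ ⁅ e ⁆) C)) θ B) →
                 ExactMod (Span (Reached D (C ∪ ⁅ e ⁆))) θ B → ExactMod (Span (Reached D C)) θ B
    exact-step avoid exactDelete exactContract with avoidable? (D ∪ ⁅ e ⁆)
    ... | no ¬avoid   = exact-transport (reached-coloop avoid ¬avoid) (λ reached → reached-colon⁺ e∉D (reached-up (unitVec e) reached)) exactContract
    ... | yes avoid∪e = exact-extension isI {J = Span (Reached (D ∪ ⁅ e ⁆) C)} {X e}
            (λ y∈ → Span-split e reached-up (Span-mono reached-split y∈)) (exactDelete avoid∪e)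
            (Span-mono reached-⊆) (λ j j∉B → ≈0∈ (θ≈0 j j∉B)) exactColon
      where
      isI = Span-isIdeal (reached-up {D} {C})
      open IsIdeal isI
      exactColon : ExactMod (colon (Span (Reached D C)) (X e)) θ B
      exactColon b bθ∈ with exactContract b (Span-mono (reached-colon⁺ e∉D) (Span-colon⁺ {Reached D C} e bθ∈))
      ... | f , f∈ = f , λ j j∈B → Span-colon⁻ {Reached D C} e (Span-mono (reached-colon⁻ e∉D) (f∈ j j∈B))

  exact-stage : ∀ k {D C} → k ≤ n → Stage k D C → Avoidable D → ExactMod (Span (Reached D C)) θ B
  exact-stage (suc k) k<n stage avoid = exact-step {e = Fin.fromℕ< k<n} e≡k stage avoid
    (exact-stage k k≤n (stage-delete e≡k stage)) (exact-stage k k≤n (stage-contract e≡k stage) avoid)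
    where
    e≡k = FinP.toℕ-fromℕ< k<n
    k≤n = ℕP.≤-trans (ℕP.n≤1+n k) k<n
  exact-stage zero {D} {C} _ stage (S , (iS , card) , S∩D) with hasBroken? C
  -- A broken circuit among the inverted elements gives the unit ideal, modulo which any family is
  -- trivial.
  ... | yes broken = λ b _ → (λ _ _ → 0#) , λ j _ → spanned λ α ¬reached → contradiction (inj₂ (HasBroken-mono ∈∪ʳ broken)) ¬reached
  -- Now C is independent, and it contains the surviving basis S because everything outside C was
  -- deleted. So C is a basis, and only the variables outside C are left as generators.
  ... | no ¬broken = exact-transport outside⇒reached reached⇒outside (exact-basis bC)
    where
    open Stage stage
    S⊆C : S ⊆ C
    S⊆C {i} i∈S = [ (λ i∈D → contradiction i∈D (S∩D i i∈S)) , id ]′ (covered i z≤n)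
    bC : IsBasis Indep C
    bC = noBroken⇒indep ¬broken , λ T C⊆T iT i∈T → S⊆C (proj₂ (card⇒basis bB iS card) T (C⊆T ∘ S⊆C) iT i∈T)
    outside⇒reached : ∀ {α} → Outside C α → Reached D C α
    outside⇒reached (i , i∉C , i∈α) = inj₁ (i , [ id , (λ i∈C → contradiction i∈C i∉C) ]′ (covered i z≤n) , i∈α)
    reached⇒outside : ∀ {α} → Reached D C α → Outside C α
    reached⇒outside (inj₁ (d , d∈D , d∈α)) = d , disjoint d∈D , d∈α
    reached⇒outside {α} (inj₂ broken) with supp α SubP.⊆? C
    ... | yes s⊆C = contradiction (HasBroken-mono (λ y∈ → [ s⊆C , id ]′ (SubP.x∈p∪q⁻ (supp α) C y∈)) broken) ¬broken
    ... | no s⊈C with ⊈⇒∃ s⊈C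
    ...   | i , i∈s , i∉C = i , i∉C , supp∈ {α} i∈s

-- Splitting off the last index.

data LastView {n : ℕ} : Fin (suc n) → Set where
  isLast   : LastView (fromℕ n)
  isInject : (i : Fin n) → LastView (inject₁ i)

lastView : ∀ {n} (i : Fin (suc n)) → LastView i
lastView {zero}  zero = isLast
lastView {suc n} zero = isInject zero
lastView {suc n} (suc i) with lastView i
... | isLast     = isLast
... | isInject j = isInject (suc j)

lookup-∷ʳ-inject : ∀ {A : Set} {n} (v : Vec A n) x i → Vec.lookup (v ∷ʳ x) (inject₁ i) ≡ Vec.lookup v i
lookup-∷ʳ-inject (y ∷ v) x zero    = refl
lookup-∷ʳ-inject (y ∷ v) x (suc i) = lookup-∷ʳ-inject v x i

lookup-∷ʳ-last : ∀ {A : Set} {n} (v : Vec A n) x → Vec.lookup (v ∷ʳ x) (fromℕ n) ≡ x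
lookup-∷ʳ-last []      x = refl
lookup-∷ʳ-last (y ∷ v) x = lookup-∷ʳ-last v x

restrict : ∀ {A : Set} {n} → Vec A (suc n) → Vec A n
restrict v = tabulate λ i → Vec.lookup v (inject₁ i)

lookup-restrict : ∀ {A : Set} {n} (v : Vec A (suc n)) i → Vec.lookup (restrict v) i ≡ Vec.lookup v (inject₁ i)
lookup-restrict v = VecP.lookup∘tabulate _

restrict-∷ʳ : ∀ {A : Set} {n} (v : Vec A n) x → restrict (v ∷ʳ x) ≡ v
restrict-∷ʳ v x = vec-ext λ i → ≡.trans (lookup-restrict (v ∷ʳ x) i) (lookup-∷ʳ-inject v x i)

∷ʳ-eta : ∀ {A : Set} {n} (v : Vec A (suc n)) → v ≡ restrict v ∷ʳ Vec.lookup v (fromℕ n)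
∷ʳ-eta {n = n} v = vec-ext λ i → byView i (lastView i)
  where
  byView : ∀ i → LastView i → Vec.lookup v i ≡ Vec.lookup (restrict v ∷ʳ Vec.lookup v (fromℕ n)) i
  byView _ isLast       = ≡.sym (lookup-∷ʳ-last (restrict v) _)
  byView _ (isInject i) = ≡.sym (≡.trans (lookup-∷ʳ-inject (restrict v) _ i) (lookup-restrict v i))

fromℕ≢inject₁ : ∀ {n} {i : Fin n} → fromℕ n ≢ inject₁ i
fromℕ≢inject₁ {suc n} {zero}  ()
fromℕ≢inject₁ {suc n} {suc i} eq = fromℕ≢inject₁ (FinP.suc-injective eq)

-- Substitutions that send monomials to terms.

module MonomialMap (K : Field) {n m : ℕ} (φ : Mono n → Mono m) (w : Mono n → Field.Carrier K)
                   (φ-⊕ : ∀ α β → φ (zipWith ℕ._+_ α β) ≡ zipWith ℕ._+_ (φ α) (φ β))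
                   (w-⊕ : ∀ α β → Field._≈_ K (w (zipWith ℕ._+_ α β)) (Field._*_ K (w α) (w β))) where
  private
    module K = Field K
    module P = Polynomials K n
    module Q = Polynomials K m
    module R = CommutativeRing P.polyRing
    module S = CommutativeRing Q.polyRing
    module SR = Ideals Q.polyRing
  open Poly K using (Pol)
  open SetoidReasoning K.setoid

  -- The map sending x^β to w(β) x^φ(β); the hypotheses on φ and w are its multiplicativity on
  -- monomials.
  hom : Pol n → Pol m
  hom = List.map λ t → proj₁ t K.* w (proj₂ t) , φ (proj₂ t)

  ev-hom : ∀ p g → Q.ev (hom p) g K.≈ P.ev p (λ β → w β K.* g (φ β))
  ev-hom [] g = K.refl
  ev-hom ((c , β) ∷ p) g = K.+-cong (K.*-assoc _ _ _) (ev-hom p g)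

  hom-cong : ∀ {p q} → p R.≈ q → hom p S.≈ hom q
  hom-cong {p} {q} p≈q = Q.≋⇒≈ᴾ (hom p) (hom q) λ g → K.trans (ev-hom p g) (K.trans (P.≈ᴾ⇒≋ p≈q _) (K.sym (ev-hom q g)))

  hom-+ : ∀ p q → hom (p R.+ q) S.≈ hom p S.+ hom q
  hom-+ p q = S.reflexive (ListP.map-++ _ p q)

  hom-neg : ∀ p → hom (R.- p) S.≈ S.- hom p
  hom-neg p = Q.≋⇒≈ᴾ (hom (R.- p)) (S.- hom p) λ g → K.trans (ev-hom (R.- p) g) (K.trans (P.ev-neg p _)
    (K.trans (K.-‿cong (K.sym (ev-hom p g))) (K.sym (Q.ev-neg (hom p) g))))

  hom-sub : ∀ p q → hom (p R.- q) S.≈ hom p S.- hom q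
  hom-sub p q = S.trans (hom-+ p (R.- q)) (S.+-congˡ {hom p} (hom-neg q))

  hom-* : ∀ p q → hom (p R.* q) S.≈ hom p S.* hom q
  hom-* p q = Q.≋⇒≈ᴾ (hom (p R.* q)) (hom p S.* hom q) λ g → begin
    Q.ev (hom (p R.* q)) g
      ≈⟨ K.trans (ev-hom (p R.* q) g) (P.ev-* p q _) ⟩
    P.ev p (λ β → P.ev q (λ γ → w (β P.⊕ γ) K.* g (φ (β P.⊕ γ))))
      ≈⟨ P.ev-cong p (λ β → K.trans (P.ev-cong q (λ γ → K.trans (K.*-cong (w-⊕ β γ) (K.reflexive (≡.cong g (φ-⊕ β γ)))) (K.*-assoc _ _ _)))
                                    (P.ev-scale q (w β) (λ γ → w γ K.* g (φ β Q.⊕ φ γ)))) ⟩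
    P.ev p (λ β → w β K.* P.ev q (λ γ → w γ K.* g (φ β Q.⊕ φ γ)))
      ≈⟨ P.ev-cong p (λ β → K.*-congˡ (K.sym (ev-hom q (λ γ → g (φ β Q.⊕ γ))))) ⟩
    P.ev p (λ β → w β K.* Q.ev (hom q) (λ γ → g (φ β Q.⊕ γ)))
      ≈⟨ ev-hom p (λ β → Q.ev (hom q) (λ γ → g (β Q.⊕ γ))) ⟨
    Q.ev (hom p) (λ β → Q.ev (hom q) (λ γ → g (β Q.⊕ γ)))
      ≈⟨ Q.ev-* (hom p) (hom q) g ⟨
    Q.ev (hom p S.* hom q) g ∎

  hom-sum : ∀ {k} (f : Fin k → Pol n) → hom (RingSums.sum P.polyRing f) S.≈ RingSums.sum Q.polyRing (λ i → hom (f i))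
  hom-sum {zero}  f = S.refl
  hom-sum {suc k} f = S.trans (hom-+ (f zero) _) (S.+-congˡ {hom (f zero)} (hom-sum (f ∘ suc)))

  preimage : ∀ {J} → SR.IsIdeal J → Ideals.IsIdeal P.polyRing (λ p → J (hom p))
  preimage isJ = record
    { resp = λ p≈q → resp (hom-cong p≈q)
    ; 0∈   = 0∈
    ; +∈   = λ {p} {q} Jp Jq → resp (S.sym (hom-+ p q)) (+∈ Jp Jq)
    ; *∈   = λ p {q} Jq → resp (S.sym (hom-* p q)) (*∈ (hom p) Jq)
    }
    where open SR.IsIdeal isJ

  hom-Span : ∀ {J} → SR.IsIdeal J → ∀ {T} → (∀ α → Dec (T α)) → (∀ c {α} → T α → J (Q.monomial c (φ α))) →
             ∀ {p} → P.Span T p → J (hom p)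
  hom-Span {J} isJ {T} T? monomial∈ p∈ with P.Span-terms T? p∈
  ... | q , p≈q , q∈ = resp (S.sym (hom-cong p≈q)) (terms∈ q q∈)
    where
    open SR.IsIdeal isJ
    terms∈ : ∀ q → All (λ t → T (proj₂ t)) q → J (hom q)
    terms∈ [] [] = 0∈
    terms∈ ((c , β) ∷ q) (Tβ ∷ q∈) = +∈ {Q.monomial (c K.* w β) (φ β)} (monomial∈ _ Tβ) (terms∈ q q∈)

-- The defining ideal of k(Δ).

module NBCIdeal (K : Field) {n : ℕ} {Indep : IndepSys n} (M : IsMatroid Indep) (r : ℕ) (A : Fin n → Fin n → Field.Carrier K) where
  open Poly K n
  open NBC K Indep r
  open Polynomials K n
  open SquareFreeIdeals K n
  open CommutativeRing polyRing hiding (zero) renaming (refl to ≈-refl)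
  open RingSums polyRing
  open Ideals polyRing
  open IntegerSolver polyRing
  open BrokenCircuits M
  private module K = Field K

  J : Pol → Set
  J = Ideal⟨ Generators A ⟩

  J-isIdeal : IsIdeal J
  J-isIdeal = generated-isIdeal

  open IsIdeal J-isIdeal

  linForm∈ : ∀ {j} → j ∈ B → J (linForm (A j))
  linForm∈ j∈B = generator∈ (inj₂ (_ , j∈B , refl))

  lookup-monoOf : ∀ {F : Subset n} {i} → i ∈ F → Vec.lookup (monoOf F) i ≡ 1
  lookup-monoOf {F} {i} i∈F = ≡.trans (VecP.lookup∘tabulate _ i) (≡.cong (if_then 1 else 0) (VecP.[]=⇒lookup i∈F))

  monoOf≤ : ∀ {F : Subset n} {α} → (∀ {i} → i ∈ F → Involves i α) → monoOf F ≤ₘ α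
  monoOf≤ {F} {α} F⊆α i with i SubP.∈? F
  ... | yes i∈F = ≡.subst (_≤ Vec.lookup α i) (≡.sym (lookup-monoOf i∈F)) (exponent>0 (F⊆α i∈F))
  ... | no i∉F  = ≡.subst (_≤ Vec.lookup α i) (≡.sym (≡.trans (VecP.lookup∘tabulate _ i) (≡.cong (if_then 1 else 0) (outside-false i∉F)))) z≤n
    where
    outside-false : i ∉ F → Vec.lookup F i ≡ false
    outside-false i∉F with Vec.lookup F i in eq
    ... | true  = contradiction (VecP.lookup⇒[]= i F eq) i∉F
    ... | false = refl

  monomial∈ : ∀ {F} c {α} → HasBroken F → (∀ {i} → i ∈ F → Involves i α) → J (monomial c α)
  monomial∈ {F} c {α} broken F⊆α with ≤ₘ⇒⊕ (monoOf F) α (monoOf≤ F⊆α)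
  ... | ν , refl = resp (≋⇒≈ᴾ (monomial c ν * monomial K.1# (monoOf F)) (monomial c (ν ⊕ monoOf F)) λ g → K.+-congʳ (K.*-congʳ (K.*-identityʳ c)))
      (*∈ (monomial c ν) (generator∈ (inj₁ (F , broken⇒nonface broken , refl))))

  -- The rows of `A` outside B are arbitrary; with zeros in their place, sums may run over all
  -- indices.
  masked : Fin n → Fin n → K.Carrier
  masked j i with j SubP.∈? B
  ... | yes _ = A j i
  ... | no _  = K.0#

  masked-inside : ∀ {j} → j ∈ B → ∀ i → masked j i ≡ A j i
  masked-inside {j} j∈B i with j SubP.∈? B
  ... | yes _  = refl
  ... | no j∉B = contradiction j∈B j∉B

  masked-outside : ∀ j i → j ∉ B → masked j i K.≈ K.0#
  masked-outside j i j∉B with j SubP.∈? B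
  ... | yes j∈B = contradiction j∈B j∉B
  ... | no _    = K.refl

  masked-linForm : ∀ {j} → j ∈ B → linForm (masked j) ≈ linForm (A j)
  masked-linForm {j} j∈B = trans (linForm-sum (masked j)) (trans
    (sum-cong λ i → *-congʳ {X i} (ι-cong (K.reflexive (masked-inside j∈B i)))) (sym (linForm-sum (A j))))

  masked∈ : ∀ j → J (linForm (masked j))
  masked∈ j with j SubP.∈? B
  ... | yes j∈B = linForm∈ j∈B
  ... | no j∉B  = ≈0∈ (trans (linForm-sum (λ _ → K.0#)) (sum-zero λ i → trans (*-congʳ {X i} ι-0) (zeroˡ (X i))))

  combination : (Fin n → Pol) → Pol
  combination b = sum λ j → b j * linForm (masked j)

  combination∈ : ∀ b → J (combination b)
  combination∈ b = sum∈ _ λ j → *∈ (b j) (masked∈ j)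

  Broken : Mono n → Set
  Broken α = HasBroken (supp α)

  broken-up : UpClosed Broken
  broken-up {α} β = HasBroken-mono λ i∈ → ∈supp {β ⊕ α} (involves-⊕ β (supp∈ {α} i∈))

  -- Separates the broken circuit ideal from (Θ) and so exposes the coefficients of the forms, the
  -- candidates for a Koszul relation.
  decompose : ∀ {f} → J f → ∃[ b ] Span Broken (f - combination b)
  decompose = generated-minimal decomposable-isIdeal generator-decomposes
    where
    module Sp = IsIdeal (Span-isIdeal {Broken} (λ {α} → broken-up {α}))
    decomposable-isIdeal : IsIdeal λ f → ∃[ b ] Span Broken (f - combination b)
    decomposable-isIdeal = record
      { resp = λ f≈g (b , f∈) → b , Sp.resp (+-congʳ { - combination b} f≈g) f∈
      ; 0∈   = (λ _ → 0#) , Sp.neg∈ (Sp.≈0∈ (sum-zero λ j → zeroˡ (linForm (masked j))))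
      ; +∈   = λ {f} {g} (b , f∈) (c , g∈) → (λ j → b j + c j) , Sp.resp
          (trans (solve 4 (λ f s g t → (f :- s) :+ (g :- t) := (f :+ g) :- (s :+ t)) ≈-refl f (combination b) g (combination c))
            (+-congˡ {f + g} (-‿cong (sym (trans (sum-cong λ j → distribʳ (linForm (masked j)) (b j) (c j))
              (∑-distrib-+ (λ j → b j * linForm (masked j)) (λ j → c j * linForm (masked j)))))))) (Sp.+∈ f∈ g∈)
      ; *∈   = λ x {f} (b , f∈) → (λ j → x * b j) , Sp.resp
          (trans (solve 3 (λ x f s → x :* (f :- s) := x :* f :- x :* s) ≈-refl x f (combination b))
            (+-congˡ {x * f} (-‿cong (trans (*-distribˡ-sum x (λ j → b j * linForm (masked j)))
              (sum-cong λ j → sym (*-assoc x (b j) (linForm (masked j)))))))) (Sp.*∈ x f∈)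
      }
    generator-decomposes : ∀ {g} → Generators A g → ∃[ b ] Span Broken (g - combination b)
    generator-decomposes (inj₁ (F , nonface , refl)) = (λ _ → 0#) , Sp.sub∈
      (spanned λ α ¬broken → coeff-0 {T = Broken} (HasBroken-mono (λ i∈F → ∈supp {monoOf F} (positive (≡.subst (0 <_) (≡.sym (lookup-monoOf i∈F)) (s≤s z≤n)))) (nonface⇒broken nonface) ∷ []) ¬broken)
      (Sp.≈0∈ (sum-zero λ j → zeroˡ (linForm (masked j))))
    generator-decomposes (inj₂ (j , j∈B , refl)) = (λ i → δ i j) , Sp.≈⇒∈
      (sym (trans (sum-δ j (λ i → linForm (masked i))) (masked-linForm j∈B)))

-- Subsets with a prescribed last bit.

module _ {n : ℕ} where

  inject∈∷ʳ : ∀ {S : Subset n} {b i} → i ∈ S → inject₁ i ∈ S ∷ʳ b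
  inject∈∷ʳ {S} {b} {i} i∈S = VecP.lookup⇒[]= _ _ (≡.trans (lookup-∷ʳ-inject S b i) (VecP.[]=⇒lookup i∈S))

  inject∈∷ʳ⁻ : ∀ {S : Subset n} {b i} → inject₁ i ∈ S ∷ʳ b → i ∈ S
  inject∈∷ʳ⁻ {S} {b} {i} i∈ = VecP.lookup⇒[]= _ _ (≡.trans (≡.sym (lookup-∷ʳ-inject S b i)) (VecP.[]=⇒lookup i∈))

  last∈∷ʳ : ∀ (S : Subset n) → fromℕ n ∈ S ∷ʳ true
  last∈∷ʳ S = VecP.lookup⇒[]= _ _ (lookup-∷ʳ-last S true)

  last∈∷ʳ⁻ : ∀ {S : Subset n} {b} → fromℕ n ∈ S ∷ʳ b → b ≡ true
  last∈∷ʳ⁻ {S} {b} last∈ = ≡.trans (≡.sym (lookup-∷ʳ-last S b)) (VecP.[]=⇒lookup last∈)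

  last∉∷ʳ : ∀ {S : Subset n} → fromℕ n ∉ S ∷ʳ false
  last∉∷ʳ {S} last∈ with last∈∷ʳ⁻ {S} last∈
  ... | ()

  inject⊆ : ∀ {S T : Subset (suc n)} → (∀ {i} → inject₁ i ∈ S → inject₁ i ∈ T) → (fromℕ n ∈ S → fromℕ n ∈ T) → S ⊆ T
  inject⊆ {S} {T} inj lst {x} x∈ = byView (lastView x) x∈
    where
    byView : ∀ {x} → LastView x → x ∈ S → x ∈ T
    byView isLast       = lst
    byView (isInject i) = inj

  ∷ʳ-mono : ∀ {S T : Subset n} {b} → S ⊆ T → S ∷ʳ b ⊆ T ∷ʳ b
  ∷ʳ-mono {S} {T} {b} S⊆T = inject⊆ (λ i∈ → inject∈∷ʳ (S⊆T (inject∈∷ʳ⁻ {S} i∈))) λ l∈ → ≡.subst (λ c → fromℕ n ∈ T ∷ʳ c) (≡.sym (last∈∷ʳ⁻ {S} l∈)) (last∈∷ʳ T)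

  ∷ʳ-reflect : ∀ {S T : Subset n} {b c} → S ∷ʳ b ⊆ T ∷ʳ c → S ⊆ T
  ∷ʳ-reflect S⊆T i∈S = inject∈∷ʳ⁻ (S⊆T (inject∈∷ʳ i∈S))

  ∷ʳfalse⊆ : ∀ {S : Subset n} {b} → S ∷ʳ false ⊆ S ∷ʳ b
  ∷ʳfalse⊆ {S} = inject⊆ (λ i∈ → inject∈∷ʳ (inject∈∷ʳ⁻ {S} i∈)) λ l∈ → contradiction l∈ (last∉∷ʳ {S})

  ∈restrict : ∀ {S : Subset (suc n)} {i} → inject₁ i ∈ S → i ∈ restrict S
  ∈restrict {S} {i} i∈ = VecP.lookup⇒[]= _ _ (≡.trans (lookup-restrict S i) (VecP.[]=⇒lookup i∈))

  ∈restrict⁻ : ∀ {S : Subset (suc n)} {i} → i ∈ restrict S → inject₁ i ∈ S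
  ∈restrict⁻ {S} {i} i∈ = VecP.lookup⇒[]= _ _ (≡.trans (≡.sym (lookup-restrict S i)) (VecP.[]=⇒lookup i∈))

  restrict-∪⊆ : ∀ {S : Subset n} {b i} → (S ∪ ⁅ i ⁆) ∷ʳ b ⊆ (S ∷ʳ b) ∪ ⁅ inject₁ i ⁆
  restrict-∪⊆ {S} {b} {i} = inject⊆
    (λ j∈ → [ ∈∪ˡ ∘ inject∈∷ʳ , (λ { refl → x∈∪⁅x⁆ (S ∷ʳ b) (inject₁ i) }) ]′ (∈∪⁅⁆⁻ (inject∈∷ʳ⁻ {S ∪ ⁅ i ⁆} j∈)))
    (λ l∈ → ∈∪ˡ (≡.subst (λ c → fromℕ n ∈ S ∷ʳ c) (≡.sym (last∈∷ʳ⁻ {S ∪ ⁅ i ⁆} l∈)) (last∈∷ʳ S)))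

  restrict-∪⊇ : ∀ {S : Subset n} {b i} → (S ∷ʳ b) ∪ ⁅ inject₁ i ⁆ ⊆ (S ∪ ⁅ i ⁆) ∷ʳ b
  restrict-∪⊇ {S} {b} {i} = ∪⁅⁆⊆ (∷ʳ-mono ∈∪ˡ) (inject∈∷ʳ (x∈∪⁅x⁆ S i))

  ∖-∷ʳ⊆ : ∀ {S : Subset n} {b i} → (S ∖ i) ∷ʳ b ⊆ (S ∷ʳ b) ∖ inject₁ i
  ∖-∷ʳ⊆ {S} {b} {i} = inject⊆
    (λ j∈ → ∈∖ (inject∈∷ʳ (∈∖⇒∈ i (inject∈∷ʳ⁻ {S ∖ i} j∈))) λ eq → ∈∖⇒≢ (inject∈∷ʳ⁻ {S ∖ i} j∈) (FinP.inject₁-injective eq))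
    (λ l∈ → ∈∖ (≡.subst (λ c → fromℕ n ∈ S ∷ʳ c) (≡.sym (last∈∷ʳ⁻ {S ∖ i} l∈)) (last∈∷ʳ S)) fromℕ≢inject₁)

  ∖-∷ʳ⊇ : ∀ {S : Subset n} {b i} → (S ∷ʳ b) ∖ inject₁ i ⊆ (S ∖ i) ∷ʳ b
  ∖-∷ʳ⊇ {S} {b} {i} = inject⊆
    (λ j∈ → inject∈∷ʳ (∈∖ (inject∈∷ʳ⁻ {S} (∈∖⇒∈ (inject₁ i) j∈)) λ { refl → ∈∖⇒≢ j∈ refl }))
    (λ l∈ → ≡.subst (λ c → fromℕ n ∈ (S ∖ i) ∷ʳ c) (≡.sym (last∈∷ʳ⁻ {S} (∈∖⇒∈ (inject₁ i) l∈))) (last∈∷ʳ (S ∖ i)))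

bit : Bool → ℕ
bit b = if b then 1 else 0

∣∷ʳ∣ : ∀ {n} (S : Subset n) b → ∣ S ∷ʳ b ∣ ≡ ∣ S ∣ ℕ.+ bit b
∣∷ʳ∣ []            true  = refl
∣∷ʳ∣ []            false = refl
∣∷ʳ∣ (inside ∷ S)  b = ≡.cong suc (∣∷ʳ∣ S b)
∣∷ʳ∣ (outside ∷ S) b = ∣∷ʳ∣ S b

-- Deletion and contraction of the last element, treated together.

-- The bit `b` is false for the deletion and true for the contraction of a nonloop. Exchange never
-- returns the last element, which lies in both sets or in neither.
module Minor {n : ℕ} {Indep : IndepSys (suc n)} (M : IsMatroid Indep) {Indep′ : IndepSys n} (b : Bool)
             (minor : ∀ S → Indep′ S ⇔ Indep (S ∷ʳ b)) (loopless : Indep (⊥ ∷ʳ b)) where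
  open IsMatroid M

  up : ∀ {S} → Indep′ S → Indep (S ∷ʳ b)
  up {S} = Equivalence.to (minor S)

  down : ∀ {S} → Indep (S ∷ʳ b) → Indep′ S
  down {S} = Equivalence.from (minor S)

  isMatroid : IsMatroid Indep′
  isMatroid = record
    { indep?     = λ S → Dec.map′ down up (indep? (S ∷ʳ b))
    ; indep-∅    = down loopless
    ; hereditary = λ S⊆T i → down (hereditary (∷ʳ-mono S⊆T) (up i))
    ; exchange   = λ {S} {T} iS iT lt → exchange′ iS iT (≡.subst₂ _<_ (≡.sym (∣∷ʳ∣ S b)) (≡.sym (∣∷ʳ∣ T b)) (ℕP.+-monoˡ-< (bit b) lt))
    }
    where
    exchange′ : ∀ {S T} → Indep′ S → Indep′ T → ∣ S ∷ʳ b ∣ < ∣ T ∷ʳ b ∣ → ∃[ x ] (x ∈ T × x ∉ S × Indep′ (S ∪ ⁅ x ⁆))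
    exchange′ {S} {T} iS iT lt with exchange (up iS) (up iT) lt
    ... | x , x∈ , x∉ , i = byView (lastView x) x∈ x∉ i
      where
      byView : ∀ {x} → LastView x → x ∈ T ∷ʳ b → x ∉ S ∷ʳ b → Indep ((S ∷ʳ b) ∪ ⁅ x ⁆) → ∃[ x ] (x ∈ T × x ∉ S × Indep′ (S ∪ ⁅ x ⁆))
      byView isLast x∈ x∉ i = contradiction (≡.subst (λ c → fromℕ n ∈ S ∷ʳ c) (≡.sym (last∈∷ʳ⁻ {S = T} x∈)) (last∈∷ʳ S)) x∉
      byView (isInject x) x∈ x∉ i = x , inject∈∷ʳ⁻ x∈ , x∉ ∘ inject∈∷ʳ , down (hereditary restrict-∪⊆ i)

  isBasis : ∀ {S} → IsBasis Indep (S ∷ʳ b) → IsBasis Indep′ S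
  isBasis (i , maximal) = down i , λ T S⊆T iT → ∷ʳ-reflect (maximal (T ∷ʳ b) (∷ʳ-mono S⊆T) (up iT))

  module _ {S : Subset n} (bS : IsBasis Indep (S ∷ʳ b)) {j : Fin n} (j∈S : j ∈ S) where
    private
      module Above = Matroid.FundamentalCocircuit M bS {inject₁ j} (inject∈∷ʳ j∈S)
      module Below = Matroid.FundamentalCocircuit isMatroid (isBasis bS) j∈S

    replaces-up : ∀ {i} → Below.Replaces i → Above.Replaces (inject₁ i)
    replaces-up {i} (i∉ , ind) = (λ i∈ → i∉ (inject∈∷ʳ⁻ {S = S ∖ j} (∖-∷ʳ⊇ i∈))) ,
      hereditary (λ y∈ → restrict-∪⊇ (∪⁅⁆⊆ (∈∪ˡ ∘ ∖-∷ʳ⊇) (x∈∪⁅x⁆ ((S ∖ j) ∷ʳ b) (inject₁ i)) y∈)) (up ind)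

    replaces-down : ∀ {i} → Above.Replaces (inject₁ i) → Below.Replaces i
    replaces-down {i} (i∉ , ind) = (λ i∈ → i∉ (∖-∷ʳ⊆ (inject∈∷ʳ i∈))) ,
      down (hereditary (λ y∈ → ∪⁅⁆⊆ (∈∪ˡ ∘ ∖-∷ʳ⊆) (x∈∪⁅x⁆ ((S ∷ʳ b) ∖ inject₁ j) (inject₁ i)) (restrict-∪⊆ y∈)) ind)

∈lastR : ∀ n r i → i ∈ lastR n r ⇔ n ∸ r ≤ toℕ i
∈lastR n r i = mk⇔
  (λ i∈ → ℕP.≤ᵇ⇒≤ _ _ (Equivalence.from BoolP.T-≡ (≡.trans (≡.sym (VecP.lookup∘tabulate _ i)) (VecP.[]=⇒lookup i∈))))
  (λ le → VecP.lookup⇒[]= i _ (≡.trans (VecP.lookup∘tabulate _ i) (Equivalence.to BoolP.T-≡ (ℕP.≤⇒≤ᵇ le))))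

-- Bases and circuits around the series pair.

module SeriesPair {n r : ℕ} {Indep : IndepSys (suc n)} (M : IsMatroid Indep) (r<n : suc r ≤ n)
                  (bB : IsBasis Indep (lastR (suc n) (suc r))) (cocircuit : IsCocircuit Indep (pairLast n (suc r))) where
  open IsMatroid M
  open Matroid M

  B : Subset (suc n)
  B = lastR (suc n) (suc r)

  -- The standard bases of M / e and M \ e, where e is the last element.
  B/ B∖ : Subset n
  B/ = lastR n r
  B∖ = lastR n (suc r)

  private
    p<n : n ∸ suc r < n
    p<n = ℕP.∸-monoʳ-< {n} {suc r} {0} (s≤s z≤n) r<n

  -- The largest element outside `B`; indices start at 0, hence the position `n ∸ suc r`.
  p : Fin n
  p = Fin.fromℕ< p<n

  private
    toℕ-p : toℕ p ≡ n ∸ suc r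
    toℕ-p = FinP.toℕ-fromℕ< p<n

    n∸r : n ∸ r ≡ suc (toℕ p)
    n∸r = ≡.trans (ℕP.+-∸-assoc 1 r<n) (≡.cong suc (≡.sym toℕ-p))

  ι : Fin n → Fin (suc n)
  ι = inject₁

  e : Fin (suc n)
  e = fromℕ n

  ∈B/ : ∀ {i} → i ∈ B/ ⇔ toℕ p < toℕ i
  ∈B/ {i} = ≡.subst (λ k → i ∈ B/ ⇔ k ≤ toℕ i) n∸r (∈lastR n r i)

  ∈B∖ : ∀ {i} → i ∈ B∖ ⇔ toℕ p ≤ toℕ i
  ∈B∖ {i} = ≡.subst (λ k → i ∈ B∖ ⇔ k ≤ toℕ i) (≡.sym toℕ-p) (∈lastR n (suc r) i)

  e∈B : e ∈ B
  e∈B = Equivalence.from (∈lastR (suc n) (suc r) e) (≡.subst (n ∸ r ≤_) (≡.sym (FinP.toℕ-fromℕ n)) (ℕP.m∸n≤m n r))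

  ι∈B : ∀ {i} → i ∈ B/ → ι i ∈ B
  ι∈B {i} i∈ = Equivalence.from (∈lastR (suc n) (suc r) (ι i)) (≡.subst (n ∸ r ≤_) (≡.sym (FinP.toℕ-inject₁ i)) (Equivalence.to (∈lastR n r i) i∈))

  ι∈B⁻ : ∀ {i} → ι i ∈ B → i ∈ B/
  ι∈B⁻ {i} i∈ = Equivalence.from (∈lastR n r i) (≡.subst (n ∸ r ≤_) (FinP.toℕ-inject₁ i) (Equivalence.to (∈lastR (suc n) (suc r) (ι i)) i∈))

  p∉B/ : p ∉ B/
  p∉B/ p∈ = ℕP.<-irrefl refl (Equivalence.to ∈B/ p∈)

  ιp∉B : ι p ∉ B
  ιp∉B = p∉B/ ∘ ι∈B⁻

  ∉B/⇒≤p : ∀ {i} → i ∉ B/ → toℕ i ≤ toℕ p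
  ∉B/⇒≤p i∉ = ℕP.≮⇒≥ λ p<i → i∉ (Equivalence.from ∈B/ p<i)

  p∈B∖ : p ∈ B∖
  p∈B∖ = Equivalence.from ∈B∖ ℕP.≤-refl

  B/⊆B∖ : B/ ⊆ B∖
  B/⊆B∖ i∈ = Equivalence.from ∈B∖ (ℕP.<⇒≤ (Equivalence.to ∈B/ i∈))

  ∈B∖⁻ : ∀ {i} → i ∈ B∖ → i ≢ p → i ∈ B/
  ∈B∖⁻ i∈ i≢p = Equivalence.from ∈B/ (ℕP.≤∧≢⇒< (Equivalence.to ∈B∖ i∈) λ p≡i → i≢p (FinP.toℕ-injective (≡.sym p≡i)))

  B≡ : B ≡ B/ ∷ʳ true
  B≡ = SubP.⊆-antisym (inject⊆ (λ i∈ → inject∈∷ʳ (ι∈B⁻ i∈)) (λ _ → last∈∷ʳ B/))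
                      (inject⊆ (λ i∈ → ι∈B (inject∈∷ʳ⁻ i∈)) (λ _ → e∈B))

  pair : Subset (suc n)
  pair = pairLast n (suc r)

  private
    lookup-pair : ∀ i → Vec.lookup pair i ≡ ((toℕ i ≡ᵇ n) ∨ (toℕ i ≡ᵇ (n ∸ suc r)))
    lookup-pair = VecP.lookup∘tabulate _

  e∈pair : e ∈ pair
  e∈pair = VecP.lookup⇒[]= e pair (≡.trans (lookup-pair e) (≡.cong (_∨ (toℕ e ≡ᵇ (n ∸ suc r))) (≡.trans (≡.cong (_≡ᵇ n) (FinP.toℕ-fromℕ n)) (≡ᵇ-refl n))))

  p∈pair : ι p ∈ pair
  p∈pair = VecP.lookup⇒[]= (ι p) pair (≡.trans (lookup-pair (ι p)) (≡.trans
    (≡.cong ((toℕ (ι p) ≡ᵇ n) ∨_) (≡.trans (≡.cong (_≡ᵇ (n ∸ suc r)) (≡.trans (FinP.toℕ-inject₁ p) toℕ-p)) (≡ᵇ-refl (n ∸ suc r))))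
    (BoolP.∨-zeroʳ (toℕ (ι p) ≡ᵇ n))))

  ∈pair⁻ : ∀ {i} → i ∈ pair → i ≡ e ⊎ i ≡ ι p
  ∈pair⁻ {i} i∈ with i FinP.≟ e | i FinP.≟ ι p
  ... | yes i≡e | _       = inj₁ i≡e
  ... | no _    | yes i≡p = inj₂ i≡p
  ... | no i≢e  | no i≢p  with ≡.trans (≡.sym (VecP.[]=⇒lookup i∈)) (≡.trans (lookup-pair i) (≡.cong₂ _∨_
          (≡ᵇ-≢ (λ i≡n → i≢e (FinP.toℕ-injective (≡.trans i≡n (≡.sym (FinP.toℕ-fromℕ n))))))
          (≡ᵇ-≢ (λ i≡p → i≢p (FinP.toℕ-injective (≡.trans i≡p (≡.sym (≡.trans (FinP.toℕ-inject₁ p) toℕ-p))))))))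
  ...   | ()

  pair-fund : IsFundCocircuit Indep B e pair
  pair-fund = cocircuit , (λ i∈ → [ (λ { refl → x∈∪⁅x⁆ (∁ B) e }) , (λ { refl → ∈∪ˡ (SubP.x∉p⇒x∈∁p ιp∉B) }) ]′ (∈pair⁻ i∈)) , e∈pair

  private
    module AtLast = FundamentalCocircuit bB e∈B

  -- The pair is the fundamental cocircuit of e, so p may replace e in `B`.
  basis∖ : IsBasis Indep (B∖ ∷ʳ false)
  basis∖ = ≡.subst (IsBasis Indep) (SubP.⊆-antisym swap⊆ ⊆swap) (AtLast.replaces⇒basis (Equivalence.to (AtLast.toReplaces pair-fund (ι p)) p∈pair))
    where
    swap⊆ : (B ∖ e) ∪ ⁅ ι p ⁆ ⊆ B∖ ∷ʳ false
    swap⊆ = ∪⁅⁆⊆ (inject⊆ (λ i∈ → inject∈∷ʳ (B/⊆B∖ (ι∈B⁻ (∈∖⇒∈ e i∈)))) (λ e∈ → contradiction e∈ x∉∖x)) (inject∈∷ʳ p∈B∖)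
    member : ∀ {i} → i ∈ B∖ → ι i ∈ (B ∖ e) ∪ ⁅ ι p ⁆
    member {i} i∈ with i FinP.≟ p
    ... | yes refl = x∈∪⁅x⁆ (B ∖ e) (ι i)
    ... | no i≢p   = ∈∪ˡ (∈∖ (ι∈B (∈B∖⁻ i∈ i≢p)) (fromℕ≢inject₁ ∘ ≡.sym))
    ⊆swap : B∖ ∷ʳ false ⊆ (B ∖ e) ∪ ⁅ ι p ⁆
    ⊆swap = inject⊆ (λ i∈ → member (inject∈∷ʳ⁻ i∈)) (λ e∈ → contradiction e∈ (last∉∷ʳ {S = B∖}))

  basis/ : IsBasis Indep (B/ ∷ʳ true)
  basis/ = ≡.subst (IsBasis Indep) B≡ bB

  -- Every basis meets the pair. One that extends S by elements of `B` cannot contain p and so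
  -- contains e; `series-p` uses `B∖` in the same way.
  series-e : ∀ {S} → Indep S → ι p ∉ S → Indep (S ∪ ⁅ e ⁆)
  series-e {S} iS p∉S with e SubP.∈? S
  ... | yes e∈S = hereditary (∪⁅⁆⊆ id e∈S) iS
  ... | no e∉S  = extend-through iS bB (proj₁ cocircuit)
    (λ x∈S x∈pair → [ (λ { refl → e∉S x∈S }) , (λ { refl → p∉S x∈S }) ]′ (∈pair⁻ x∈pair))
    (λ x∈B x∈pair → [ id , (λ { refl → contradiction x∈B ιp∉B }) ]′ (∈pair⁻ x∈pair))

  series-p : ∀ {S} → Indep S → e ∉ S → Indep (S ∪ ⁅ ι p ⁆)
  series-p {S} iS e∉S with ι p SubP.∈? S
  ... | yes p∈S = hereditary (∪⁅⁆⊆ id p∈S) iS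
  ... | no p∉S  = extend-through iS basis∖ (proj₁ cocircuit)
    (λ x∈S x∈pair → [ (λ { refl → e∉S x∈S }) , (λ { refl → p∉S x∈S }) ]′ (∈pair⁻ x∈pair))
    (λ x∈B x∈pair → [ (λ { refl → contradiction x∈B (last∉∷ʳ {S = B∖}) }) , id ]′ (∈pair⁻ x∈pair))

  circuit-e⇒p : ∀ {C} → IsCircuit Indep C → e ∈ C → ι p ∈ C
  circuit-e⇒p {C} isC e∈C = Dec.decidable-stable (ι p SubP.∈? C) λ p∉C →
    proj₁ isC (hereditary (⊆∖∪ e) (series-e (circuit-remove isC e∈C) (p∉C ∘ ∈∖⇒∈ e)))

  circuit-p⇒e : ∀ {C} → IsCircuit Indep C → ι p ∈ C → e ∈ C
  circuit-p⇒e {C} isC p∈C = Dec.decidable-stable (e SubP.∈? C) λ e∉C →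
    proj₁ isC (hereditary (⊆∖∪ (ι p)) (series-p (circuit-remove isC p∈C) (e∉C ∘ ∈∖⇒∈ (ι p))))

  Indep∖ Indep/ : IndepSys n
  Indep∖ = deleteLast Indep
  Indep/ = contractLast Indep

  private
    indep-e : Indep (⊥ ∷ʳ true)
    indep-e = hereditary (inject⊆ (λ i∈ → contradiction (inject∈∷ʳ⁻ i∈) SubP.∉⊥) (λ _ → e∈B)) (proj₁ bB)

    contract⇔ : ∀ S → Indep/ S ⇔ Indep (S ∷ʳ true)
    contract⇔ S = mk⇔ [ proj₂ , (λ (loop , _) → contradiction indep-e loop) ]′ (λ i → inj₁ (indep-e , i))

  module Deletion = Minor M {Indep∖} false (λ S → mk⇔ id id) (hereditary (inject⊆ (λ i∈ → contradiction (inject∈∷ʳ⁻ i∈) SubP.∉⊥) (λ e∈ → contradiction e∈ (last∉∷ʳ {S = ⊥}))) indep-∅)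
  module Contraction = Minor M {Indep/} true contract⇔ indep-e

  module M∖ = Matroid Deletion.isMatroid
  module M/ = Matroid Contraction.isMatroid

  bB∖ : IsBasis Indep∖ B∖
  bB∖ = Deletion.isBasis basis∖

  bB/ : IsBasis Indep/ B/
  bB/ = Contraction.isBasis basis/

  circuit∖-up : ∀ {C} → IsCircuit Indep∖ C → IsCircuit Indep (C ∷ʳ false)
  circuit∖-up {C} isC = circuit-intro (proj₁ isC) λ x x∈ → byView (lastView x) x∈
    where
    byView : ∀ {x} → LastView x → x ∈ C ∷ʳ false → Indep ((C ∷ʳ false) ∖ x)
    byView isLast x∈       = contradiction x∈ (last∉∷ʳ {S = C})
    byView (isInject x) x∈ = hereditary ∖-∷ʳ⊇ (M∖.circuit-remove isC (inject∈∷ʳ⁻ x∈))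

  circuit∖-down : ∀ {C} → IsCircuit Indep (C ∷ʳ false) → IsCircuit Indep∖ C
  circuit∖-down isC = M∖.circuit-intro (proj₁ isC) λ x x∈C → hereditary ∖-∷ʳ⊆ (circuit-remove isC (inject∈∷ʳ x∈C))

  p∉circuit∖ : ∀ {C} → IsCircuit Indep (C ∷ʳ false) → p ∉ C
  p∉circuit∖ {C} isC p∈C = last∉∷ʳ {S = C} (circuit-p⇒e isC (inject∈∷ʳ p∈C))

  p∈circuit/ : ∀ {C} → IsCircuit Indep (C ∷ʳ true) → p ∈ C
  p∈circuit/ {C} isC = inject∈∷ʳ⁻ (circuit-e⇒p isC (last∈∷ʳ C))

  private
    ∷ʳtrue⊆ : ∀ {S : Subset n} → S ∷ʳ true ⊆ (S ∷ʳ false) ∪ ⁅ e ⁆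
    ∷ʳtrue⊆ {S} = inject⊆ (λ i∈ → ∈∪ˡ (inject∈∷ʳ (inject∈∷ʳ⁻ {S = S} i∈))) (λ _ → x∈∪⁅x⁆ (S ∷ʳ false) e)

    add-e : ∀ {S} → p ∉ S → Indep (S ∷ʳ false) → Indep (S ∷ʳ true)
    add-e p∉S i = hereditary ∷ʳtrue⊆ (series-e i (p∉S ∘ inject∈∷ʳ⁻))

  -- A circuit avoiding e avoids p as well. By `series-e` its subsets with one element removed stay
  -- independent when e is added, so it remains a circuit after contraction.
  circuit/-down : ∀ {C} b → IsCircuit Indep (C ∷ʳ b) → IsCircuit Indep/ C
  circuit/-down {C} true isC = M/.circuit-intro (proj₁ isC ∘ Contraction.up) λ x x∈C → Contraction.down (hereditary ∖-∷ʳ⊆ (circuit-remove isC (inject∈∷ʳ x∈C)))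
  circuit/-down {C} false isC = M/.circuit-intro (λ i → proj₁ isC (hereditary ∷ʳfalse⊆ (Contraction.up i))) λ x x∈C →
    Contraction.down (add-e (p∉circuit∖ isC ∘ ∈∖⇒∈ x) (hereditary ∖-∷ʳ⊆ (circuit-remove isC (inject∈∷ʳ x∈C))))

  -- Circuits of M contain both elements of the pair or neither, so p decides whether e has to be
  -- restored.
  circuit/-up : ∀ {C} → IsCircuit Indep/ C → ∃[ b ] IsCircuit Indep (C ∷ʳ b)
  circuit/-up {C} isC with p SubP.∈? C
  ... | no p∉C = false , circuit-intro (λ i → proj₁ isC (Contraction.down (add-e p∉C i))) λ x x∈ → byView (lastView x) x∈
    where
    byView : ∀ {x} → LastView x → x ∈ C ∷ʳ false → Indep ((C ∷ʳ false) ∖ x)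
    byView isLast x∈       = contradiction x∈ (last∉∷ʳ {S = C})
    byView (isInject x) x∈ = hereditary (∷ʳfalse⊆ ∘ ∖-∷ʳ⊇) (Contraction.up (M/.circuit-remove isC (inject∈∷ʳ⁻ x∈)))
  ... | yes p∈C = true , circuit-intro (proj₁ isC ∘ Contraction.down) λ x x∈ → byView (lastView x) x∈
    where
    without-p : Indep ((C ∖ p) ∷ʳ false)
    without-p = hereditary ∷ʳfalse⊆ (Contraction.up (M/.circuit-remove isC p∈C))
    byView : ∀ {x} → LastView x → x ∈ C ∷ʳ true → Indep ((C ∷ʳ true) ∖ x)
    byView isLast x∈ = hereditary (inject⊆ put (λ e∈ → contradiction e∈ x∉∖x)) (series-p without-p (last∉∷ʳ {S = C ∖ p}))
      where
      put : ∀ {i} → ι i ∈ (C ∷ʳ true) ∖ e → ι i ∈ ((C ∖ p) ∷ʳ false) ∪ ⁅ ι p ⁆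
      put {i} i∈ with i FinP.≟ p
      ... | yes refl = x∈∪⁅x⁆ _ (ι i)
      ... | no i≢p   = ∈∪ˡ (inject∈∷ʳ (∈∖ (inject∈∷ʳ⁻ {S = C} (∈∖⇒∈ e i∈)) i≢p))
    byView (isInject x) x∈ = hereditary ∖-∷ʳ⊇ (Contraction.up (M/.circuit-remove isC (inject∈∷ʳ⁻ x∈)))

  min-inject : ∀ {C b c} → IsMin Indep/ C c ⇔ IsMin Indep (C ∷ʳ b) (ι c)
  min-inject {C} {b} {c} = mk⇔
    (λ (c∈C , least) → inject∈∷ʳ c∈C , λ x x∈ → byView least (lastView x) x∈)
    (λ (c∈ , least) → inject∈∷ʳ⁻ c∈ , λ x x∈C → ≡.subst₂ _≤_ (FinP.toℕ-inject₁ c) (FinP.toℕ-inject₁ x) (least (ι x) (inject∈∷ʳ x∈C)))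
    where
    byView : (∀ x → x ∈ C → toℕ c ≤ toℕ x) → ∀ {x} → LastView x → x ∈ C ∷ʳ b → toℕ (ι c) ≤ toℕ x
    byView least isLast       x∈ = ≡.subst₂ _≤_ (≡.sym (FinP.toℕ-inject₁ c)) (≡.sym (FinP.toℕ-fromℕ n)) (ℕP.<⇒≤ (FinP.toℕ<n c))
    byView least (isInject x) x∈ = ≡.subst₂ _≤_ (≡.sym (FinP.toℕ-inject₁ c)) (≡.sym (FinP.toℕ-inject₁ x)) (least x (inject∈∷ʳ⁻ x∈))

  circuit-min≢e : ∀ {C c} → IsCircuit Indep C → IsMin Indep C c → c ≢ e
  circuit-min≢e isC (e∈C , least) refl = ℕP.<⇒≱ (FinP.toℕ<n p)
    (≡.subst₂ _≤_ (FinP.toℕ-fromℕ n) (FinP.toℕ-inject₁ p) (least (ι p) (circuit-e⇒p isC e∈C)))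

-- Fundamental circuits, cocircuits and d_j in the two minors.

module SeriesMonomials (K : Field) {n r : ℕ} {Indep : IndepSys (suc n)} (M : IsMatroid Indep) (r<n : suc r ≤ n)
                       (bB : IsBasis Indep (lastR (suc n) (suc r))) (cocircuit : IsCocircuit Indep (pairLast n (suc r))) where
  open IsMatroid M
  open Matroid M
  open SeriesPair M r<n bB cocircuit
  private
    module N  = NBC K Indep (suc r)
    module N∖ = NBC K Indep∖ (suc r)
    module N/ = NBC K Indep/ r
    ¬e∈ : ∀ {S : Subset n} {A : Set} → e ∈ S ∷ʳ false → A
    ¬e∈ {S} e∈ = contradiction e∈ (last∉∷ʳ {S = S})

  -- A circuit inside `B` ∪ {p} that avoids p would lie in the basis `B`.
  fund-avoiding : ∀ {C i} → p ∉ C → IsFundCircuit Indep B (ι i) (C ∷ʳ false) → i ≢ p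
  fund-avoiding {C} p∉C (_ , isC , C⊆) refl = proj₁ isC (hereditary (inject⊆ below ¬e∈) (proj₁ bB))
    where
    below : ∀ {x} → ι x ∈ C ∷ʳ false → ι x ∈ B
    below x∈ with ∈∪⁅⁆⁻ (C⊆ x∈)
    ... | inj₁ x∈B = x∈B
    ... | inj₂ x≡p with FinP.inject₁-injective x≡p
    ...   | refl = contradiction (inject∈∷ʳ⁻ x∈) p∉C

  fund-through : ∀ {C i} → IsFundCircuit Indep B (ι i) (C ∷ʳ true) → i ≡ p
  fund-through (_ , isC , C⊆) with ∈∪⁅⁆⁻ (C⊆ (inject∈∷ʳ (p∈circuit/ isC)))
  ... | inj₁ p∈B = contradiction p∈B ιp∉B
  ... | inj₂ p≡i = ≡.sym (FinP.inject₁-injective p≡i)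

  fundCircuit/ : ∀ {C b} → IsCircuit Indep (C ∷ʳ b) → ∀ i → IsFundCircuit Indep/ B/ i C ⇔ IsFundCircuit Indep B (ι i) (C ∷ʳ b)
  fundCircuit/ {C} {b} isC i = mk⇔
    (λ (i∉ , _ , C⊆) → i∉ ∘ ι∈B⁻ , isC , inject⊆ (λ x∈ → lift (∈∪⁅⁆⁻ (C⊆ (inject∈∷ʳ⁻ x∈)))) (λ _ → ∈∪ˡ e∈B))
    (λ (i∉ , _ , C⊆) → i∉ ∘ ι∈B , circuit/-down b isC , λ x∈C → drop (∈∪⁅⁆⁻ (C⊆ (inject∈∷ʳ x∈C))))
    where
    lift : ∀ {x} → x ∈ B/ ⊎ x ≡ i → ι x ∈ B ∪ ⁅ ι i ⁆
    lift (inj₁ x∈)   = ∈∪ˡ (ι∈B x∈)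
    lift (inj₂ refl) = x∈∪⁅x⁆ B (ι i)
    drop : ∀ {x} → ι x ∈ B ⊎ ι x ≡ ι i → x ∈ B/ ∪ ⁅ i ⁆
    drop (inj₁ x∈) = ∈∪ˡ (ι∈B⁻ x∈)
    drop (inj₂ eq) with FinP.inject₁-injective eq
    ... | refl = x∈∪⁅x⁆ B/ i

  -- The bases `B` and `B∖` differ only in e and p, neither of which lies in this circuit.
  fundCircuit∖ : ∀ {C} → IsCircuit Indep (C ∷ʳ false) → ∀ i → IsFundCircuit Indep∖ B∖ i C ⇔ IsFundCircuit Indep B (ι i) (C ∷ʳ false)
  fundCircuit∖ {C} isC i = mk⇔
    (λ (i∉ , _ , C⊆) → i∉ ∘ B/⊆B∖ ∘ ι∈B⁻ , isC , inject⊆ (λ x∈ → lift (inject∈∷ʳ⁻ x∈) (∈∪⁅⁆⁻ (C⊆ (inject∈∷ʳ⁻ x∈)))) ¬e∈)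
    (λ fund@(i∉ , _ , C⊆) → (λ i∈ → i∉ (ι∈B (∈B∖⁻ i∈ (fund-avoiding (p∉circuit∖ isC) fund)))) , circuit∖-down isC ,
                             λ x∈C → drop (∈∪⁅⁆⁻ (C⊆ (inject∈∷ʳ x∈C))))
    where
    lift : ∀ {x} → x ∈ C → x ∈ B∖ ⊎ x ≡ i → ι x ∈ B ∪ ⁅ ι i ⁆
    lift x∈C (inj₁ x∈)   = ∈∪ˡ (ι∈B (∈B∖⁻ x∈ λ { refl → p∉circuit∖ isC x∈C }))
    lift x∈C (inj₂ refl) = x∈∪⁅x⁆ B (ι i)
    drop : ∀ {x} → ι x ∈ B ⊎ ι x ≡ ι i → x ∈ B∖ ∪ ⁅ i ⁆
    drop (inj₁ x∈) = ∈∪ˡ (B/⊆B∖ (ι∈B⁻ x∈))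
    drop (inj₂ eq) with FinP.inject₁-injective eq
    ... | refl = x∈∪⁅x⁆ B∖ i

  module _ {j : Fin n} (j∈B/ : j ∈ B/) where
    private
      module At  = FundamentalCocircuit bB (ι∈B j∈B/)
      module At/ = M/.FundamentalCocircuit bB/ j∈B/
      module At∖ = M∖.FundamentalCocircuit bB∖ (B/⊆B∖ j∈B/)

      cast-up : ∀ {i} → Matroid.FundamentalCocircuit.Replaces M basis/ {ι j} (inject∈∷ʳ j∈B/) i → At.Replaces i
      cast-up {i} = ≡.subst (λ S → i ∉ S ∖ ι j × Indep ((S ∖ ι j) ∪ ⁅ i ⁆)) (≡.sym B≡)

      cast-down : ∀ {i} → At.Replaces i → Matroid.FundamentalCocircuit.Replaces M basis/ {ι j} (inject∈∷ʳ j∈B/) i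
      cast-down {i} = ≡.subst (λ S → i ∉ S ∖ ι j × Indep ((S ∖ ι j) ∪ ⁅ i ⁆)) B≡

    e-not-replaces : ¬ At.Replaces e
    e-not-replaces (e∉ , _) = e∉ (∈∖ e∈B fromℕ≢inject₁)

    fundCocircuit/-up : ∀ {D} → IsFundCocircuit Indep/ B/ j D → IsFundCocircuit Indep B (ι j) (D ∷ʳ false)
    fundCocircuit/-up {D} fund = At.fromReplaces λ x → byView (lastView x)
      where
      byView : ∀ {x} → LastView x → x ∈ D ∷ʳ false ⇔ At.Replaces x
      byView isLast       = mk⇔ ¬e∈ (λ rep → contradiction rep e-not-replaces)
      byView (isInject i) = mk⇔
        (λ i∈ → cast-up (Contraction.replaces-up basis/ j∈B/ (Equivalence.to (At/.toReplaces fund i) (inject∈∷ʳ⁻ i∈))))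
        (λ rep → inject∈∷ʳ (Equivalence.from (At/.toReplaces fund i) (Contraction.replaces-down basis/ j∈B/ (cast-down rep))))

    fundCocircuit/-down : ∀ {D} → IsFundCocircuit Indep B (ι j) D → IsFundCocircuit Indep/ B/ j (restrict D)
    fundCocircuit/-down {D} fund = At/.fromReplaces λ i → mk⇔
      (λ i∈ → Contraction.replaces-down basis/ j∈B/ (cast-down (Equivalence.to (At.toReplaces fund (ι i)) (∈restrict⁻ i∈))))
      (λ rep → ∈restrict (Equivalence.from (At.toReplaces fund (ι i)) (cast-up (Contraction.replaces-up basis/ j∈B/ rep))))

    e∉fundCocircuit : ∀ {D} → IsFundCocircuit Indep B (ι j) D → e ∉ D
    e∉fundCocircuit fund e∈D = e-not-replaces (Equivalence.to (At.toReplaces fund e) e∈D)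

    private
      -- The common part of two exchanges: adding e gives B - j + i, adding p gives the same for
      -- `B∖`. For i other than p, the series property makes either independent exactly if the core
      -- is.
      core : Fin n → Subset (suc n)
      core i = ((B/ ∖ j) ∪ ⁅ i ⁆) ∷ʳ false

      p∉core : ∀ {i} → i ≢ p → ι p ∉ core i
      p∉core i≢p p∈ = [ p∉B/ ∘ ∈∖⇒∈ j , i≢p ∘ ≡.sym ]′ (∈∪⁅⁆⁻ (inject∈∷ʳ⁻ p∈))

      core⊆ : ∀ {i} → core i ⊆ (B ∖ ι j) ∪ ⁅ ι i ⁆
      core⊆ {i} = inject⊆ (λ x∈ → put (∈∪⁅⁆⁻ (inject∈∷ʳ⁻ x∈))) ¬e∈
        where
        put : ∀ {x} → x ∈ B/ ∖ j ⊎ x ≡ i → ι x ∈ (B ∖ ι j) ∪ ⁅ ι i ⁆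
        put (inj₁ x∈)   = ∈∪ˡ (∈∖ (ι∈B (∈∖⇒∈ j x∈)) (∈∖⇒≢ x∈ ∘ FinP.inject₁-injective))
        put (inj₂ refl) = x∈∪⁅x⁆ (B ∖ ι j) (ι i)

      core⊆∖ : ∀ {i} → core i ⊆ ((B∖ ∖ j) ∪ ⁅ i ⁆) ∷ʳ false
      core⊆∖ {i} = ∷ʳ-mono (λ x∈ → [ ∈∪ˡ ∘ ∖-mono B/⊆B∖ , (λ { refl → x∈∪⁅x⁆ (B∖ ∖ j) i }) ]′ (∈∪⁅⁆⁻ x∈))

      ⊆core-e : ∀ {i} → (B ∖ ι j) ∪ ⁅ ι i ⁆ ⊆ core i ∪ ⁅ e ⁆
      ⊆core-e {i} = ∪⁅⁆⊆ (inject⊆ (λ x∈ → ∈∪ˡ (inject∈∷ʳ (∈∪ˡ (∈∖ (ι∈B⁻ (∈∖⇒∈ (ι j) x∈)) λ { refl → ∈∖⇒≢ x∈ refl })))) (λ _ → x∈∪⁅x⁆ (core i) e))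
                         (∈∪ˡ (inject∈∷ʳ (x∈∪⁅x⁆ (B/ ∖ j) i)))

      ∖⊆core-p : ∀ {i} → ((B∖ ∖ j) ∪ ⁅ i ⁆) ∷ʳ false ⊆ core i ∪ ⁅ ι p ⁆
      ∖⊆core-p {i} = inject⊆ (λ x∈ → put (∈∪⁅⁆⁻ (inject∈∷ʳ⁻ x∈))) ¬e∈
        where
        put : ∀ {x} → x ∈ B∖ ∖ j ⊎ x ≡ i → ι x ∈ core i ∪ ⁅ ι p ⁆
        put (inj₂ refl) = ∈∪ˡ (inject∈∷ʳ (x∈∪⁅x⁆ (B/ ∖ j) i))
        put {x} (inj₁ x∈) with x FinP.≟ p
        ... | yes refl = x∈∪⁅x⁆ (core i) (ι x)
        ... | no x≢p   = ∈∪ˡ (inject∈∷ʳ (∈∪ˡ (∈∖ (∈B∖⁻ (∈∖⇒∈ j x∈) x≢p) (∈∖⇒≢ x∈))))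

    replaces∖≢p : ∀ {i} → At∖.Replaces i → i ≢ p
    replaces∖≢p (p∉ , _) refl = p∉ (∈∖ p∈B∖ λ { refl → p∉B/ j∈B/ })

    replaces∖-up : ∀ {i} → At∖.Replaces i → At.Replaces (ι i)
    replaces∖-up {i} rep@(i∉ , ind) = (λ i∈ → i∉ (∈∖ (B/⊆B∖ (ι∈B⁻ (∈∖⇒∈ (ι j) i∈))) λ { refl → ∈∖⇒≢ i∈ refl })) ,
      hereditary ⊆core-e (series-e (hereditary core⊆∖ ind) (p∉core (replaces∖≢p rep)))

    replaces∖-down : ∀ {i} → i ≢ p → At.Replaces (ι i) → At∖.Replaces i
    replaces∖-down {i} i≢p (i∉ , ind) = (λ i∈ → i∉ (∈∖ (ι∈B (∈B∖⁻ (∈∖⇒∈ j i∈) i≢p)) (∈∖⇒≢ i∈ ∘ FinP.inject₁-injective))) ,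
      hereditary ∖⊆core-p (series-p (hereditary core⊆ ind) (last∉∷ʳ {S = (B/ ∖ j) ∪ ⁅ i ⁆}))

    fundCocircuit∖-∈ : ∀ {D D′} → IsFundCocircuit Indep B (ι j) D → IsFundCocircuit Indep∖ B∖ j D′ →
                       ∀ i → i ∈ D′ ⇔ (ι i ∈ D × i ≢ p)
    fundCocircuit∖-∈ fund fund′ i = mk⇔
      (λ i∈ → let rep = Equivalence.to (At∖.toReplaces fund′ i) i∈ in Equivalence.from (At.toReplaces fund (ι i)) (replaces∖-up rep) , replaces∖≢p rep)
      (λ (i∈ , i≢p) → Equivalence.from (At∖.toReplaces fund′ i) (replaces∖-down i≢p (Equivalence.to (At.toReplaces fund (ι i)) i∈)))

    fund : IsFundCocircuit Indep B (ι j) At.fundCocircuit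
    fund = At.fundCocircuit-isFund

    fund∖ : IsFundCocircuit Indep∖ B∖ j At∖.fundCocircuit
    fund∖ = At∖.fundCocircuit-isFund

    -- By orthogonality C meets the cocircuit of j again. The second element lies outside `B` and is
    -- not p, so it precedes p; hence dropping p from the cocircuit does not change its minimum.
    below-p : ∀ {C D} → IsCircuit Indep (C ∷ʳ false) → j ∈ C → IsFundCocircuit Indep B (ι j) D → ∃[ k ] (ι k ∈ D × toℕ k < toℕ p)
    below-p {C} {D} isC j∈C fund@(_ , D⊆ , _) with orthogonality bB fund (ι∈B j∈B/) isC (inject∈∷ʳ j∈C)
    ... | k , k∈C , k∈D , k≢j = byView (lastView k) k∈C k∈D k≢j
      where
      byView : ∀ {k} → LastView k → k ∈ C ∷ʳ false → k ∈ D → k ≢ ι j → ∃[ k ] (ι k ∈ D × toℕ k < toℕ p)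
      byView isLast       k∈C k∈D k≢j = ¬e∈ k∈C
      byView (isInject k) k∈C k∈D k≢j = k , k∈D , ℕP.≤∧≢⇒< (∉B/⇒≤p k∉B) λ k≡p → p∉circuit∖ isC (≡.subst (_∈ C) (FinP.toℕ-injective k≡p) (inject∈∷ʳ⁻ k∈C))
        where
        k∉B : k ∉ B/
        k∉B k∈B with ∈∪⁅⁆⁻ (D⊆ k∈D)
        ... | inj₁ k∈∁B = SubP.x∈∁p⇒x∉p k∈∁B (ι∈B k∈B)
        ... | inj₂ k≡j  = k≢j k≡j

  isD/ : ∀ j l → N/.IsD j l ⇔ N.IsD (ι j) (ι l)
  isD/ j l = mk⇔ to from
    where
    to : N/.IsD j l → N.IsD (ι j) (ι l)
    to (inj₁ (j∉ , refl)) = inj₁ (j∉ ∘ ι∈B⁻ , refl)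
    to (inj₂ (j∈ , D , fund , isMin)) = inj₂ (ι∈B j∈ , D ∷ʳ false , fundCocircuit/-up j∈ fund , Equivalence.to min-inject isMin)
    from : N.IsD (ι j) (ι l) → N/.IsD j l
    from (inj₁ (j∉ , eq)) = inj₁ (j∉ ∘ ι∈B , FinP.inject₁-injective eq)
    from (inj₂ (j∈ , D , fund , isMin)) = inj₂ (ι∈B⁻ j∈ , restrict D , fundCocircuit/-down (ι∈B⁻ j∈) fund ,
      Equivalence.from (min-inject {b = Vec.lookup D e}) (≡.subst (λ D → IsMin Indep D (ι l)) (∷ʳ-eta D) isMin))

  -- The restriction to j in a circuit of the deletion matters: if the cocircuit of j is {j, p}, its
  -- minimum is p in M but j in the deletion.
  isD∖ : ∀ {C} → IsCircuit Indep (C ∷ʳ false) → ∀ j → j ∈ C → ∀ l → N∖.IsD j l ⇔ N.IsD (ι j) (ι l)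
  isD∖ {C} isC j j∈C l = mk⇔ to from
    where
    to : N∖.IsD j l → N.IsD (ι j) (ι l)
    to (inj₁ (j∉ , refl)) = inj₁ (j∉ ∘ B/⊆B∖ ∘ ι∈B⁻ , refl)
    to (inj₂ (j∈B∖ , D′ , fund′ , l∈ , least)) = inj₂ (ι∈B j∈ , _ , fund j∈ , proj₁ (there-and-back l l∈) , λ x x∈ → byView (lastView x) x∈)
      where
      j∈ = ∈B∖⁻ j∈B∖ λ { refl → p∉circuit∖ isC j∈C }
      there-and-back = λ i → Equivalence.to (fundCocircuit∖-∈ j∈ (fund j∈) fund′ i)
      back = λ i → Equivalence.from (fundCocircuit∖-∈ j∈ (fund j∈) fund′ i)
      l≤p : toℕ l ≤ toℕ p
      l≤p = let (k , k∈ , k<p) = below-p j∈ isC j∈C (fund j∈) in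
        ℕP.≤-trans (least k (back k (k∈ , λ k≡p → ℕP.<-irrefl (≡.cong toℕ k≡p) k<p))) (ℕP.<⇒≤ k<p)
      least′ : ∀ {x} → Dec (x ≡ p) → ι x ∈ _ → toℕ l ≤ toℕ x
      least′ (no x≢p)  x∈ = least _ (back _ (x∈ , x≢p))
      least′ (yes x≡p) x∈ = ≡.subst (λ x → toℕ l ≤ toℕ x) (≡.sym x≡p) l≤p
      byView : ∀ {x} → LastView x → x ∈ _ → toℕ (ι l) ≤ toℕ x
      byView isLast       x∈ = contradiction x∈ (e∉fundCocircuit j∈ (fund j∈))
      byView (isInject x) x∈ = ≡.subst₂ _≤_ (≡.sym (FinP.toℕ-inject₁ l)) (≡.sym (FinP.toℕ-inject₁ x)) (least′ (x FinP.≟ p) x∈)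
    from : N.IsD (ι j) (ι l) → N∖.IsD j l
    from (inj₁ (j∉ , eq)) = inj₁ ((λ j∈ → j∉ (ι∈B (∈B∖⁻ j∈ λ { refl → p∉circuit∖ isC j∈C }))) , FinP.inject₁-injective eq)
    from (inj₂ (ιj∈B , D , fundD , l∈ , least)) = inj₂ (B/⊆B∖ j∈ , _ , fund∖ j∈ , back l (l∈ , l≢p) ,
        λ x x∈ → ≡.subst₂ _≤_ (FinP.toℕ-inject₁ l) (FinP.toℕ-inject₁ x) (least (ι x) (proj₁ (there-and-back x x∈))))
      where
      j∈ = ι∈B⁻ ιj∈B
      there-and-back = λ i → Equivalence.to (fundCocircuit∖-∈ j∈ fundD (fund∖ j∈) i)
      back = λ i → Equivalence.from (fundCocircuit∖-∈ j∈ fundD (fund∖ j∈) i)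
      l≢p : l ≢ p
      l≢p l≡p = let (k , k∈ , k<p) = below-p j∈ isC j∈C fundD in
        ℕP.<⇒≱ k<p (≡.subst₂ _≤_ (≡.trans (FinP.toℕ-inject₁ l) (≡.cong toℕ l≡p)) (FinP.toℕ-inject₁ k) (least (ι k) k∈))

  isD-last : ∀ j → ¬ N.IsD (ι j) e
  isD-last j (inj₁ (_ , eq)) = fromℕ≢inject₁ eq
  isD-last j (inj₂ (j∈ , D , fund , e∈D , _)) = e∉fundCocircuit (ι∈B⁻ j∈) fund e∈D

  isD-p : ∀ {C} → IsCircuit Indep (C ∷ʳ false) → ∀ j → j ∈ C → ¬ N.IsD (ι j) (ι p)
  isD-p isC j j∈C (inj₁ (_ , eq)) = p∉circuit∖ isC (≡.subst (_∈ _) (≡.sym (FinP.inject₁-injective eq)) j∈C)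
  isD-p isC j j∈C (inj₂ (j∈ , D , fund , _ , least)) with below-p (ι∈B⁻ j∈) isC j∈C fund
  ... | k , k∈ , k<p = ℕP.<⇒≱ k<p (≡.subst₂ _≤_ (FinP.toℕ-inject₁ p) (FinP.toℕ-inject₁ k) (least (ι k) k∈))

  -- The origin of the extra factor xₚ: the cocircuit of e is the pair, whose minimum is p.
  isD-e : ∀ {l} → N.IsD e l ⇔ l ≡ ι p
  isD-e {l} = mk⇔ to λ { refl → inj₂ (e∈B , pair , pair-fund , p∈pair , λ x x∈ → [ (λ { refl → p≤e }) , (λ { refl → ℕP.≤-refl }) ]′ (∈pair⁻ x∈)) }
    where
    p≤e : toℕ (ι p) ≤ toℕ e
    p≤e = ≡.subst₂ _≤_ (≡.sym (FinP.toℕ-inject₁ p)) (≡.sym (FinP.toℕ-fromℕ n)) (ℕP.<⇒≤ (FinP.toℕ<n p))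
    module At = FundamentalCocircuit bB e∈B
    to : N.IsD e l → l ≡ ι p
    to (inj₁ (e∉ , _)) = contradiction e∈B e∉
    to (inj₂ (_ , D , fund , l∈D , least)) = [ (λ { refl → contradiction (≡.subst (_≤ toℕ p) (FinP.toℕ-fromℕ n) l≤p) (ℕP.<⇒≱ (FinP.toℕ<n p)) }) , id ]′
      (∈pair⁻ (Equivalence.from (At.toReplaces pair-fund l) (Equivalence.to (At.toReplaces fund l) l∈D)))
      where
      l≤p : toℕ l ≤ toℕ p
      l≤p = ≡.subst (toℕ l ≤_) (FinP.toℕ-inject₁ p)
        (least (ι p) (Equivalence.from (At.toReplaces fund (ι p)) (Equivalence.to (At.toReplaces pair-fund (ι p)) p∈pair)))

-- Comparison of the monomials m_C and of the sets U and L.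

module SeriesUpperSets (K : Field) {n r : ℕ} {Indep : IndepSys (suc n)} (M : IsMatroid Indep) (r<n : suc r ≤ n)
                       (bB : IsBasis Indep (lastR (suc n) (suc r))) (cocircuit : IsCocircuit Indep (pairLast n (suc r))) where
  open SeriesPair M r<n bB cocircuit
  open SeriesMonomials K M r<n bB cocircuit
  open Polynomials K n using (_⊕_; 𝟎; lookup-⊕; lookup-unit-refl; lookup-unit-≢)
  open Poly K n using (unitVec; _≤ₘ_)
  private
    module N  = NBC K Indep (suc r)
    module N∖ = NBC K Indep∖ (suc r)
    module N/ = NBC K Indep/ r

    -- Removing e from a circuit through e divides its monomial by the variable of p.
    bump : Bool → Mono n
    bump b = if b then unitVec p else 𝟎

    lookup-𝟎 : ∀ l → Vec.lookup 𝟎 l ≡ 0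
    lookup-𝟎 l = VecP.lookup-replicate l 0

    lookup-bump-p : ∀ b → Vec.lookup (bump b) p ≡ bit b
    lookup-bump-p true  = lookup-unit-refl p
    lookup-bump-p false = lookup-𝟎 p

    lookup-bump-≢ : ∀ b {l} → l ≢ p → Vec.lookup (bump b) l ≡ 0
    lookup-bump-≢ true  l≢p = lookup-unit-≢ (l≢p ∘ ≡.sym)
    lookup-bump-≢ false l≢p = lookup-𝟎 _

    lookup-bump-bit : ∀ b l x → x ≡ true ⇔ (b ≡ true × l ≡ p) → bit x ≡ Vec.lookup (bump b) l
    lookup-bump-bit true l x iff with l FinP.≟ p
    ... | yes refl = ≡.trans (≡.cong bit (Equivalence.from iff (refl , refl))) (≡.sym (lookup-bump-p true))
    lookup-bump-bit true l true  iff | no l≢p = contradiction (proj₂ (Equivalence.to iff refl)) l≢p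
    lookup-bump-bit true l false iff | no l≢p = ≡.sym (lookup-bump-≢ true l≢p)
    lookup-bump-bit false l true  iff with proj₁ (Equivalence.to iff refl)
    ... | ()
    lookup-bump-bit false l false iff = ≡.sym (lookup-𝟎 l)

    -- The bit to append to the set of elements counted at l: e is counted exactly if it is in the
    -- circuit and l is d_e = p.
    tag : ∀ b l → ∃[ x ] (x ≡ true ⇔ (b ≡ true × l ≡ p))
    tag false l = false , mk⇔ (λ ()) (λ ())
    tag true  l with l FinP.≟ p
    ... | yes l≡p = true , mk⇔ (λ _ → refl , l≡p) (λ _ → refl)
    ... | no l≢p  = false , mk⇔ (λ ()) (λ (_ , l≡p) → contradiction l≡p l≢p)

    power : ∀ {m} → Fin m → ℕ → Mono m
    power i k = tabulate λ l → if toℕ i ≡ᵇ toℕ l then k else 0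

    lookup-power-refl : ∀ {m} (i : Fin m) k → Vec.lookup (power i k) i ≡ k
    lookup-power-refl i k = ≡.trans (VecP.lookup∘tabulate _ i) (≡.cong (if_then k else 0) (≡ᵇ-refl (toℕ i)))

    lookup-power-≢ : ∀ {m} {i l : Fin m} k → i ≢ l → Vec.lookup (power i k) l ≡ 0
    lookup-power-≢ {l = l} k i≢l = ≡.trans (VecP.lookup∘tabulate _ l) (≡.cong (if_then k else 0) (≡ᵇ-≢ (i≢l ∘ FinP.toℕ-injective)))

    -- A fundamental circuit through e is the one of p, so the element e raises a pure power of xₚ
    -- by one.
    power-bump : ∀ b i k → (b ≡ true → i ≡ p) → power (ι i) (bit b ℕ.+ k) ≡ (bump b ⊕ power i k) ∷ʳ 0
    power-bump b i k through = vec-ext λ l → byView (lastView l)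
      where
      at : ∀ l → Vec.lookup (power (ι i) (bit b ℕ.+ k)) (ι l) ≡ Vec.lookup (bump b) l ℕ.+ Vec.lookup (power i k) l
      at l with i FinP.≟ l
      ... | yes refl = ≡.trans (lookup-power-refl (ι i) _) (≡.cong₂ ℕ._+_ (≡.sym (bump-i b through)) (≡.sym (lookup-power-refl i k)))
        where
        bump-i : ∀ b → (b ≡ true → i ≡ p) → Vec.lookup (bump b) i ≡ bit b
        bump-i true  through = ≡.trans (≡.cong (Vec.lookup (bump true)) (through refl)) (lookup-bump-p true)
        bump-i false through = lookup-𝟎 i
      ... | no i≢l   = ≡.trans (lookup-power-≢ _ (i≢l ∘ FinP.inject₁-injective)) (≡.sym (≡.cong₂ ℕ._+_ (bump-l b through) (lookup-power-≢ k i≢l)))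
        where
        bump-l : ∀ b → (b ≡ true → i ≡ p) → Vec.lookup (bump b) l ≡ 0
        bump-l true  through = lookup-bump-≢ true λ l≡p → i≢l (≡.trans (through refl) (≡.sym l≡p))
        bump-l false through = lookup-𝟎 l
      byView : ∀ {l} → LastView l → Vec.lookup (power (ι i) (bit b ℕ.+ k)) l ≡ Vec.lookup ((bump b ⊕ power i k) ∷ʳ 0) l
      byView isLast       = ≡.trans (lookup-power-≢ {i = ι i} {e} _ (fromℕ≢inject₁ ∘ ≡.sym)) (≡.sym (lookup-∷ʳ-last (bump b ⊕ power i k) 0))
      byView (isInject l) = ≡.trans (at l) (≡.sym (≡.trans (lookup-∷ʳ-inject (bump b ⊕ power i k) 0 l) (lookup-⊕ (bump b) (power i k) l)))

    ∣∖∷ʳ∣ : ∀ (C : Subset n) b c → ∣ (C ∷ʳ b) ∖ ι c ∣ ≡ bit b ℕ.+ ∣ C ∖ c ∣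
    ∣∖∷ʳ∣ C b c = ≡.trans (≡.cong ∣_∣ (SubP.⊆-antisym {i = (C ∷ʳ b) ∖ ι c} {(C ∖ c) ∷ʳ b} (∖-∷ʳ⊇ {S = C}) (∖-∷ʳ⊆ {S = C}))) (≡.trans (∣∷ʳ∣ (C ∖ c) b) (ℕP.+-comm ∣ C ∖ c ∣ (bit b)))

  -- The data on which m_C depends. Both minors supply it, so the comparison is made once.
  record Comparable (Indep′ : IndepSys n) (r′ : ℕ) (C : Subset n) (b : Bool) : Set where
    field
      isCircuit   : IsCircuit Indep (C ∷ʳ b)
      fundCircuit : ∀ i → IsFundCircuit Indep′ (lastR n r′) i C ⇔ IsFundCircuit Indep B (ι i) (C ∷ʳ b)
      isD         : ∀ j → j ∈ C → ∀ l → NBC.IsD K Indep′ r′ j l ⇔ N.IsD (ι j) (ι l)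

  comparable/ : ∀ {C b} → IsCircuit Indep (C ∷ʳ b) → Comparable Indep/ r C b
  comparable/ isC = record { isCircuit = isC ; fundCircuit = fundCircuit/ isC ; isD = λ j _ → isD/ j }

  comparable∖ : ∀ {C} → IsCircuit Indep (C ∷ʳ false) → Comparable Indep∖ (suc r) C false
  comparable∖ isC = record { isCircuit = isC ; fundCircuit = fundCircuit∖ isC ; isD = isD∖ isC }

  module _ {Indep′ : IndepSys n} {r′ : ℕ} {C : Subset n} {b : Bool} (comparable : Comparable Indep′ r′ C b) where
    open Comparable comparable

    private
      through : ∀ {i} → IsFundCircuit Indep B (ι i) (C ∷ʳ b) → b ≡ true → i ≡ p
      through fund refl = fund-through fund

      e∈∖ : ∀ {c} → e ∈ (C ∷ʳ b) ∖ ι c ⇔ b ≡ true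
      e∈∖ {c} = mk⇔ (λ e∈ → last∈∷ʳ⁻ {S = C} (∈∖⇒∈ (ι c) e∈)) λ { refl → ∈∖ (last∈∷ʳ C) fromℕ≢inject₁ }

      ι∈∖ : ∀ {c j} → ι j ∈ (C ∷ʳ b) ∖ ι c ⇔ j ∈ C ∖ c
      ι∈∖ {c} = mk⇔ (λ j∈ → inject∈∷ʳ⁻ {S = C ∖ c} (∖-∷ʳ⊇ j∈)) (λ j∈ → ∖-∷ʳ⊆ (inject∈∷ʳ j∈))

    -- The only element gained by the circuit is e, which contributes one factor xₚ; the exponent of
    -- xₑ is 0 since no d_j equals e.
    mC-up : ∀ {μ} → NBC.IsMC K Indep′ r′ C μ → N.IsMC (C ∷ʳ b) ((bump b ⊕ μ) ∷ʳ 0)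
    mC-up (c , isMin , inj₁ (i , fund , refl)) = ι c , Equivalence.to min-inject isMin , inj₁ (ι i , fund′ ,
        ≡.sym (≡.trans (≡.cong (power (ι i)) (∣∖∷ʳ∣ C b c)) (power-bump b i ∣ C ∖ c ∣ (through fund′))))
      where
      fund′ = Equivalence.to (fundCircuit i) fund
    mC-up {μ} (c , isMin , inj₂ (notFund , count)) = ι c , Equivalence.to min-inject isMin , inj₂ ((λ i → notFund′ (lastView i)) , λ l → count′ (lastView l))
      where
      notFund′ : ∀ {i} → LastView i → ¬ IsFundCircuit Indep B i (C ∷ʳ b)
      notFund′ isLast       (e∉B , _) = e∉B e∈B
      notFund′ (isInject i) fund      = notFund i (Equivalence.from (fundCircuit i) fund)
      count′ : ∀ {l} → LastView l → ∃[ S ] ((∀ j → j ∈ S ⇔ (j ∈ (C ∷ʳ b) ∖ ι c × N.IsD j l)) × Vec.lookup ((bump b ⊕ μ) ∷ʳ 0) l ≡ ∣ S ∣)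
      count′ isLast = ⊥ , (λ j → mk⇔ (λ j∈ → contradiction j∈ SubP.∉⊥) (λ (_ , d) → none (lastView j) d)) ,
                      ≡.trans (lookup-∷ʳ-last (bump b ⊕ μ) 0) (≡.sym (SubP.∣⊥∣≡0 (suc n)))
        where
        none : ∀ {j} → LastView j → N.IsD j e → j ∈ ⊥
        none isLast       d = contradiction (Equivalence.to isD-e d) fromℕ≢inject₁
        none (isInject j) d = contradiction d (isD-last j)
      count′ (isInject l) with count l | tag b l
      ... | S , S-iff , μl | x , x-iff = S ∷ʳ x , (λ j → byView (lastView j)) , value
        where
        byView : ∀ {j} → LastView j → j ∈ S ∷ʳ x ⇔ (j ∈ (C ∷ʳ b) ∖ ι c × N.IsD j (ι l))
        byView isLast = mk⇔
          (λ e∈ → let (b≡true , l≡p) = Equivalence.to x-iff (last∈∷ʳ⁻ {S = S} e∈) in Equivalence.from e∈∖ b≡true , Equivalence.from isD-e (≡.cong ι l≡p))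
          (λ (e∈ , d) → ≡.subst (λ y → e ∈ S ∷ʳ y) (≡.sym (Equivalence.from x-iff (Equivalence.to e∈∖ e∈ , FinP.inject₁-injective (Equivalence.to isD-e d)))) (last∈∷ʳ S))
        byView (isInject j) = mk⇔
          (λ j∈ → let (j∈C , d) = Equivalence.to (S-iff j) (inject∈∷ʳ⁻ j∈) in Equivalence.from ι∈∖ j∈C , Equivalence.to (isD j (∈∖⇒∈ c j∈C) l) d)
          (λ (j∈ , d) → let j∈C = Equivalence.to ι∈∖ j∈ in inject∈∷ʳ (Equivalence.from (S-iff j) (j∈C , Equivalence.from (isD j (∈∖⇒∈ c j∈C) l) d)))
        value : Vec.lookup ((bump b ⊕ μ) ∷ʳ 0) (ι l) ≡ ∣ S ∷ʳ x ∣
        value = ≡.trans (lookup-∷ʳ-inject (bump b ⊕ μ) 0 l) (≡.trans (lookup-⊕ (bump b) μ l)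
          (≡.trans (≡.cong₂ ℕ._+_ (≡.sym (lookup-bump-bit b l x x-iff)) μl) (≡.trans (ℕP.+-comm (bit x) ∣ S ∣) (≡.sym (∣∷ʳ∣ S x)))))

    mC-down : ∀ {μ} → N.IsMC (C ∷ʳ b) μ → ∃[ μ′ ] (NBC.IsMC K Indep′ r′ C μ′ × restrict μ ≡ bump b ⊕ μ′)
    mC-down (c , isMin , rest) with lastView c
    ... | isLast = contradiction refl (circuit-min≢e isCircuit isMin)
    mC-down {μ} (_ , isMin , inj₁ (i , fund , μ≡)) | isInject c = byView (lastView i) fund μ≡
      where
      byView : ∀ {i} → LastView i → IsFundCircuit Indep B i (C ∷ʳ b) → μ ≡ power i ∣ (C ∷ʳ b) ∖ ι c ∣ →
               ∃[ μ′ ] (NBC.IsMC K Indep′ r′ C μ′ × restrict μ ≡ bump b ⊕ μ′)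
      byView isLast       (e∉B , _) _ = contradiction e∈B e∉B
      byView (isInject i) fund μ≡ = power i ∣ C ∖ c ∣ , (c , Equivalence.from min-inject isMin , inj₁ (i , Equivalence.from (fundCircuit i) fund , refl)) ,
        ≡.trans (≡.cong restrict (≡.trans μ≡ (≡.trans (≡.cong (power (ι i)) (∣∖∷ʳ∣ C b c)) (power-bump b i ∣ C ∖ c ∣ (through fund))))) (restrict-∷ʳ _ 0)
    mC-down {μ} (_ , isMin , inj₂ (notFund , count)) | isInject c = μ′ ,
        (c , Equivalence.from min-inject isMin , inj₂ ((λ i fund → notFund (ι i) (Equivalence.to (fundCircuit i) fund)) ,
          λ l → restrict (S l) , S′-iff l , VecP.lookup∘tabulate _ l)) , vec-ext value
      where
      S : Fin n → Subset (suc n)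
      S l = proj₁ (count (ι l))
      S-iff : ∀ l j → j ∈ S l ⇔ (j ∈ (C ∷ʳ b) ∖ ι c × N.IsD j (ι l))
      S-iff l = proj₁ (proj₂ (count (ι l)))
      μ′ : Mono n
      μ′ = tabulate λ l → ∣ restrict (S l) ∣
      S′-iff : ∀ l j → j ∈ restrict (S l) ⇔ (j ∈ C ∖ c × NBC.IsD K Indep′ r′ j l)
      S′-iff l j = mk⇔
        (λ j∈ → let (j∈∖ , d) = Equivalence.to (S-iff l (ι j)) (∈restrict⁻ j∈) ; j∈C = Equivalence.to ι∈∖ j∈∖ in j∈C , Equivalence.from (isD j (∈∖⇒∈ c j∈C) l) d)
        (λ (j∈C , d) → ∈restrict (Equivalence.from (S-iff l (ι j)) (Equivalence.from ι∈∖ j∈C , Equivalence.to (isD j (∈∖⇒∈ c j∈C) l) d)))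
      e-iff : ∀ l → Vec.lookup (S l) e ≡ true ⇔ (b ≡ true × l ≡ p)
      e-iff l = mk⇔
        (λ eq → let (e∈ , d) = Equivalence.to (S-iff l e) (VecP.lookup⇒[]= e (S l) eq) in Equivalence.to e∈∖ e∈ , FinP.inject₁-injective (Equivalence.to isD-e d))
        (λ (b≡true , l≡p) → VecP.[]=⇒lookup (Equivalence.from (S-iff l e) (Equivalence.from e∈∖ b≡true , Equivalence.from isD-e (≡.cong ι l≡p))))
      value : ∀ l → Vec.lookup (restrict μ) l ≡ Vec.lookup (bump b ⊕ μ′) l
      value l = ≡.trans (lookup-restrict μ l) (≡.trans (proj₂ (proj₂ (count (ι l)))) (≡.trans (≡.cong ∣_∣ (∷ʳ-eta (S l)))
        (≡.trans (∣∷ʳ∣ (restrict (S l)) _) (≡.trans (ℕP.+-comm ∣ restrict (S l) ∣ _)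
          (≡.trans (≡.cong₂ ℕ._+_ (lookup-bump-bit b l _ (e-iff l)) (≡.sym (VecP.lookup∘tabulate _ l))) (≡.sym (lookup-⊕ (bump b) μ′ l)))))))

  -- A circuit avoiding the pair is not the fundamental circuit of p, and none of its elements j has
  -- d_j = p.
  mC-avoids-p : ∀ {C μ} → IsCircuit Indep (C ∷ʳ false) → N.IsMC (C ∷ʳ false) μ → Vec.lookup μ (ι p) ≡ 0
  mC-avoids-p {C} {μ} isC (c , isMin , inj₁ (i , fund , refl)) = byView (lastView i) fund
    where
    byView : ∀ {i} → LastView i → IsFundCircuit Indep B i (C ∷ʳ false) → Vec.lookup (power i ∣ (C ∷ʳ false) ∖ c ∣) (ι p) ≡ 0
    byView isLast       (e∉B , _) = contradiction e∈B e∉B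
    byView (isInject i) fund      = lookup-power-≢ _ (fund-avoiding (p∉circuit∖ isC) fund ∘ FinP.inject₁-injective)
  mC-avoids-p {C} isC (c , isMin , inj₂ (_ , count)) with count (ι p)
  ... | S , S-iff , μp = ≡.trans μp (≡.trans (≡.cong ∣_∣ (SubP.Empty-unique λ (j , j∈) → byView (lastView j) (Equivalence.to (S-iff j) j∈))) (SubP.∣⊥∣≡0 (suc n)))
    where
    byView : ∀ {j} → LastView j → ¬ (j ∈ (C ∷ʳ false) ∖ c × N.IsD j (ι p))
    byView isLast       (e∈ , _) = last∉∷ʳ {S = C} (∈∖⇒∈ c e∈)
    byView (isInject j) (j∈ , d) = isD-p isC j (inject∈∷ʳ⁻ (∈∖⇒∈ c j∈)) d

  private
    ∷ʳ-≤ : ∀ {μ α : Mono n} → μ ≤ₘ α → Poly._≤ₘ_ K (suc n) (μ ∷ʳ 0) (α ∷ʳ 0)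
    ∷ʳ-≤ {μ} {α} μ≤α i = byView (lastView i)
      where
      byView : ∀ {i} → LastView i → Vec.lookup (μ ∷ʳ 0) i ≤ Vec.lookup (α ∷ʳ 0) i
      byView isLast       = ℕP.≤-reflexive (≡.trans (lookup-∷ʳ-last μ 0) (≡.sym (lookup-∷ʳ-last α 0)))
      byView (isInject i) = ≡.subst₂ _≤_ (≡.sym (lookup-∷ʳ-inject μ 0 i)) (≡.sym (lookup-∷ʳ-inject α 0 i)) (μ≤α i)

    ⊕-≤ : ∀ ν {μ α : Mono n} → μ ≤ₘ α → (ν ⊕ μ) ≤ₘ (ν ⊕ α)
    ⊕-≤ ν {μ} {α} μ≤α i = ≡.subst₂ _≤_ (≡.sym (lookup-⊕ ν μ i)) (≡.sym (lookup-⊕ ν α i)) (ℕP.+-monoʳ-≤ (Vec.lookup ν i) (μ≤α i))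

    𝟎⊕ : ∀ (μ : Mono n) → 𝟎 ⊕ μ ≡ μ
    𝟎⊕ = VecP.zipWith-identityˡ ℕP.+-identityˡ

    restrict-≤ : ∀ {μ : Mono (suc n)} {α : Mono n} → Poly._≤ₘ_ K (suc n) μ (α ∷ʳ 0) → restrict μ ≤ₘ α
    restrict-≤ {μ} {α} μ≤ i = ≡.subst₂ _≤_ (≡.sym (lookup-restrict μ i)) (lookup-∷ʳ-inject α 0 i) (μ≤ (ι i))

  U∖-up : ∀ {α} → N∖.InU α → N.InU (α ∷ʳ 0)
  U∖-up {α} (C , μ , isC , isMC , μ≤α) = C ∷ʳ false , _ , circuit∖-up isC , mC-up (comparable∖ (circuit∖-up isC)) isMC ,
    ∷ʳ-≤ {bump false ⊕ μ} {α} (≡.subst (_≤ₘ α) (≡.sym (𝟎⊕ μ)) μ≤α)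

  U/-up : ∀ {α} → N/.InU α → N.InU ((unitVec p ⊕ α) ∷ʳ 0)
  U/-up {α} (C , μ , isC , isMC , μ≤α) with circuit/-up isC
  ... | b , isC′ = C ∷ʳ b , _ , isC′ , mC-up (comparable/ isC′) isMC , ∷ʳ-≤ {bump b ⊕ μ} {unitVec p ⊕ α} (bumped b)
    where
    bumped : ∀ b → (bump b ⊕ μ) ≤ₘ (unitVec p ⊕ α)
    bumped true  = ⊕-≤ (unitVec p) {μ} {α} μ≤α
    bumped false i = ≡.subst₂ _≤_ (≡.sym (≡.cong (λ v → Vec.lookup v i) (𝟎⊕ μ))) (≡.sym (lookup-⊕ (unitVec p) α i)) (ℕP.≤-trans (μ≤α i) (ℕP.m≤n+m _ _))

  private
    splitCircuit : ∀ {P : Set} {α μ} C → IsCircuit Indep C → N.IsMC C μ → Poly._≤ₘ_ K (suc n) μ (α ∷ʳ 0) →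
                   (∀ C b → IsCircuit Indep (C ∷ʳ b) → N.IsMC (C ∷ʳ b) μ → restrict μ ≤ₘ α → P) → P
    splitCircuit {P} {α} {μ} C isC isMC μ≤ continue = continue (restrict C) (Vec.lookup C e)
      (≡.subst (IsCircuit Indep) (∷ʳ-eta C) isC) (≡.subst (λ C → N.IsMC C μ) (∷ʳ-eta C) isMC) (restrict-≤ {μ} {α} μ≤)

  -- The monomial of a circuit through e is divisible by xₚ and cannot divide α, so only circuits of
  -- the deletion remain.
  U∖-down : ∀ {α} → Vec.lookup α p ≡ 0 → N.InU (α ∷ʳ 0) → N∖.InU α
  U∖-down {α} αp≡0 (C , μ , isC , isMC , μ≤α) = splitCircuit {α = α} C isC isMC μ≤α continue
    where
    continue : ∀ C b → IsCircuit Indep (C ∷ʳ b) → N.IsMC (C ∷ʳ b) μ → restrict μ ≤ₘ α → N∖.InU α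
    continue C false isC isMC μ≤ with mC-down (comparable∖ isC) isMC
    ... | μ′ , isMC′ , μ≡ = C , μ′ , circuit∖-down isC , isMC′ , ≡.subst (_≤ₘ α) (≡.trans μ≡ (𝟎⊕ μ′)) μ≤
    continue C true isC isMC μ≤ with mC-down (comparable/ isC) isMC
    ... | μ′ , _ , μ≡ = contradiction (≡.subst₂ _≤_ (≡.trans (≡.cong (λ v → Vec.lookup v p) μ≡) (≡.trans (lookup-⊕ (unitVec p) μ′ p) (≡.cong (ℕ._+ Vec.lookup μ′ p) (lookup-unit-refl p)))) αp≡0 (μ≤ p)) λ ()

  -- The dividing monomial either has a factor xₚ, which cancels, or is free of xₚ and then divides
  -- α already.
  U/-down : ∀ {α} → N.InU ((unitVec p ⊕ α) ∷ʳ 0) → N/.InU α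
  U/-down {α} (C , μ , isC , isMC , μ≤α) = splitCircuit {α = unitVec p ⊕ α} C isC isMC μ≤α continue
    where
    continue : ∀ C b → IsCircuit Indep (C ∷ʳ b) → N.IsMC (C ∷ʳ b) μ → restrict μ ≤ₘ (unitVec p ⊕ α) → N/.InU α
    continue C b isC isMC μ≤ with mC-down (comparable/ isC) isMC
    ... | μ′ , isMC′ , μ≡ = C , μ′ , circuit/-down b isC , isMC′ , divided b isC isMC μ≡
      where
      divided : ∀ b → IsCircuit Indep (C ∷ʳ b) → N.IsMC (C ∷ʳ b) μ → restrict μ ≡ bump b ⊕ μ′ → μ′ ≤ₘ α
      divided true isC isMC μ≡ i = ℕP.+-cancelˡ-≤ (Vec.lookup (unitVec p) i) _ _
        (≡.subst₂ _≤_ (≡.trans (≡.cong (λ v → Vec.lookup v i) μ≡) (lookup-⊕ (unitVec p) μ′ i)) (lookup-⊕ (unitVec p) α i) (μ≤ i))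
      divided false isC isMC μ≡ i with i FinP.≟ p
      ... | yes refl = ≡.subst (_≤ Vec.lookup α i) (≡.trans (≡.sym (mC-avoids-p {μ = μ} isC isMC)) (≡.trans (≡.sym (lookup-restrict μ i)) (≡.cong (λ v → Vec.lookup v i) (≡.trans μ≡ (𝟎⊕ μ′))))) z≤n
      ... | no i≢p   = ≡.subst₂ _≤_ (≡.cong (λ v → Vec.lookup v i) (≡.trans μ≡ (𝟎⊕ μ′)))
                         (≡.trans (lookup-⊕ (unitVec p) α i) (≡.cong (ℕ._+ Vec.lookup α i) (lookup-unit-≢ (i≢p ∘ ≡.sym)))) (μ≤ i)

  L∖-up : ∀ {α} → N∖.InL α → N.InL (α ∷ʳ 0)
  L∖-up {α} (zeros , ¬U) = (λ i i∈ → byView (lastView i) i∈) , ¬U ∘ U∖-down {α} (zeros p p∈B∖)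
    where
    byView : ∀ {i} → LastView i → i ∈ B → Vec.lookup (α ∷ʳ 0) i ≡ 0
    byView isLast       _  = lookup-∷ʳ-last α 0
    byView (isInject i) i∈ = ≡.trans (lookup-∷ʳ-inject α 0 i) (zeros i (B/⊆B∖ (ι∈B⁻ i∈)))

  L∖-down : ∀ {α} → Vec.lookup α p ≡ 0 → N.InL (α ∷ʳ 0) → N∖.InL α
  L∖-down {α} αp≡0 (zeros , ¬U) = zeros∖ , ¬U ∘ U∖-up {α}
    where
    zeros∖ : ∀ i → i ∈ B∖ → Vec.lookup α i ≡ 0
    zeros∖ i i∈ with i FinP.≟ p
    ... | yes refl = αp≡0
    ... | no i≢p   = ≡.trans (≡.sym (lookup-∷ʳ-inject α 0 i)) (zeros (ι i) (ι∈B (∈B∖⁻ i∈ i≢p)))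

  private
    lookup-p⊕ : ∀ α {i} → i ∈ B/ → Vec.lookup ((unitVec p ⊕ α) ∷ʳ 0) (ι i) ≡ Vec.lookup α i
    lookup-p⊕ α {i} i∈ = ≡.trans (lookup-∷ʳ-inject (unitVec p ⊕ α) 0 i) (≡.trans (lookup-⊕ (unitVec p) α i)
      (≡.cong (ℕ._+ Vec.lookup α i) (lookup-unit-≢ {p} λ { refl → p∉B/ i∈ })))

  L/-up : ∀ {α} → N/.InL α → N.InL ((unitVec p ⊕ α) ∷ʳ 0)
  L/-up {α} (zeros , ¬U) = (λ i i∈ → byView (lastView i) i∈) , ¬U ∘ U/-down {α}
    where
    byView : ∀ {i} → LastView i → i ∈ B → Vec.lookup ((unitVec p ⊕ α) ∷ʳ 0) i ≡ 0
    byView isLast       _  = lookup-∷ʳ-last (unitVec p ⊕ α) 0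
    byView (isInject i) i∈ = ≡.trans (lookup-p⊕ α (ι∈B⁻ i∈)) (zeros i (ι∈B⁻ i∈))

  L/-down : ∀ {α} → N.InL ((unitVec p ⊕ α) ∷ʳ 0) → N/.InL α
  L/-down {α} (zeros , ¬U) = (λ i i∈ → ≡.trans (≡.sym (lookup-p⊕ α i∈)) (zeros (ι i) (ι∈B i∈))) , ¬U ∘ U/-up {α}

-- Signings induced on the minors.

module SeriesSigning (K : Field) {n r : ℕ} {Indep : IndepSys (suc n)} (M : IsMatroid Indep) (r<n : suc r ≤ n)
                     (bB : IsBasis Indep (lastR (suc n) (suc r))) (cocircuit : IsCocircuit Indep (pairLast n (suc r)))
                     (A : Fin (suc n) → Fin (suc n) → Field.Carrier K) (valid : NBC.IsValidSigning K Indep (suc r) A) where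
  open Field K hiding (zero) renaming (refl to ≈-refl)
  open RingSums commRing
  open IntegerSolver commRing
  open Matroid M
  open SeriesPair M r<n bB cocircuit
  open SeriesMonomials K M r<n bB cocircuit
  private
    module N  = NBC K Indep (suc r)
    module N∖ = NBC K Indep∖ (suc r)
    module N/ = NBC K Indep/ r

  σ = proj₁ (proj₂ valid)

  sumK≈sum : ∀ {m} (f : Fin m → Carrier) → sumK K f ≈ sum f
  sumK≈sum {zero}  f = ≈-refl
  sumK≈sum {suc m} f = +-congˡ (sumK≈sum (f ∘ suc))

  sum-last : ∀ {m} (f : Fin (suc m) → Carrier) → sum f ≈ sum (λ i → f (inject₁ i)) + f (fromℕ m)
  sum-last = sum-init-last

  A-sign : ∀ {j} → j ∈ B → ∀ {D} → IsFundCocircuit Indep B j D → ∀ {i} → i ∈ D → N.PlusMinusOne (A j i)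
  A-sign j∈ fund {i} = proj₁ (proj₁ valid _ j∈ _ fund i)

  A-zero : ∀ {j} → j ∈ B → ∀ {D} → IsFundCocircuit Indep B j D → ∀ {i} → i ∉ D → A j i ≈ 0#
  A-zero j∈ fund {i} = proj₂ (proj₁ valid _ j∈ _ fund i)

  σ-sign : ∀ {C} → IsCircuit Indep C → ∀ {i} → i ∈ C → N.PlusMinusOne (σ C i)
  σ-sign isC {i} = proj₁ (proj₁ (proj₂ (proj₂ valid)) _ isC i)

  σ-zero : ∀ {C} → IsCircuit Indep C → ∀ {i} → i ∉ C → σ C i ≈ 0#
  σ-zero isC {i} = proj₂ (proj₁ (proj₂ (proj₂ valid)) _ isC i)

  orthogonal : ∀ {j} → j ∈ B → ∀ {C} → IsCircuit Indep C → sum (λ i → A j i * σ C i) ≈ 0#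
  orthogonal {j} j∈ {C} isC = trans (sym (sumK≈sum (λ i → A j i * σ C i))) (proj₂ (proj₂ (proj₂ valid)) _ j∈ C isC)

  square-one : ∀ {x} → N.PlusMinusOne x → x * x ≈ 1#
  square-one (inj₁ x≈1)  = trans (*-cong x≈1 x≈1) (*-identityˡ 1#)
  square-one (inj₂ x≈-1) = trans (*-cong x≈-1 x≈-1) (trans (solve 1 (λ o → (:- o) :* (:- o) := o :* o) ≈-refl 1#) (*-identityˡ 1#))

  A-offDiagonal : ∀ {j i} → j ∈ B → i ∈ B → i ≢ j → A j i ≈ 0#
  A-offDiagonal {j} {i} j∈ i∈ i≢j = A-zero j∈ F.fundCocircuit-isFund λ i∈D → proj₁ (Equivalence.to (F.toReplaces F.fundCocircuit-isFund i) i∈D) (∈∖ i∈ i≢j)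
    where module F = FundamentalCocircuit bB j∈

  A-diagonal : ∀ {j} → j ∈ B → N.PlusMinusOne (A j j)
  A-diagonal j∈ = A-sign j∈ F.fundCocircuit-isFund (Equivalence.from (F.toReplaces F.fundCocircuit-isFund _) F.j-replaces)
    where module F = FundamentalCocircuit bB j∈

  A-e : ∀ {j} → j ∈ B/ → A (ι j) e ≈ 0#
  A-e j∈ = A-offDiagonal (ι∈B j∈) e∈B fromℕ≢inject₁

  A-last-row : ∀ {i} → i ≢ p → A e (ι i) ≈ 0#
  A-last-row i≢p = A-zero e∈B pair-fund λ i∈ → [ fromℕ≢inject₁ ∘ ≡.sym , i≢p ∘ FinP.inject₁-injective ]′ (∈pair⁻ i∈)

  A/ : Fin n → Fin n → Carrier
  A/ j i = A (ι j) (ι i)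

  -- In the deletion p is a coloop, because circuits through p contain e. Its cocircuit is {p},
  -- which gives the unit row, and p leaves all other cocircuits, which gives the zero column.
  A∖ : Fin n → Fin n → Carrier
  A∖ j i with j FinP.≟ p | i FinP.≟ p
  ... | yes _ | yes _ = 1#
  ... | yes _ | no _  = 0#
  ... | no _  | yes _ = 0#
  ... | no _  | no _  = A (ι j) (ι i)

  A∖-pp : A∖ p p ≈ 1#
  A∖-pp with p FinP.≟ p
  ... | yes _  = ≈-refl
  ... | no neq = contradiction refl neq

  A∖-p : ∀ {i} → i ≢ p → A∖ p i ≈ 0#
  A∖-p {i} i≢p with p FinP.≟ p | i FinP.≟ p
  ... | _      | yes eq = contradiction eq i≢p
  ... | yes _  | no _   = ≈-refl
  ... | no neq | no _   = contradiction refl neq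

  A∖-column : ∀ {j} → j ≢ p → A∖ j p ≈ 0#
  A∖-column {j} j≢p with j FinP.≟ p | p FinP.≟ p
  ... | yes eq | _      = contradiction eq j≢p
  ... | no _   | yes _  = ≈-refl
  ... | no _   | no neq = contradiction refl neq

  A∖-other : ∀ {j i} → j ≢ p → i ≢ p → A∖ j i ≈ A (ι j) (ι i)
  A∖-other {j} {i} j≢p i≢p with j FinP.≟ p | i FinP.≟ p
  ... | yes eq | _      = contradiction eq j≢p
  ... | no _   | yes eq = contradiction eq i≢p
  ... | no _   | no _   = ≈-refl

  private
    sum-restrict : ∀ (f : Fin (suc n) → Carrier) → f e ≈ 0# → sum f ≈ 0# → sum (λ i → f (ι i)) ≈ 0#
    sum-restrict f fe≈0 sum≈0 = trans (sym (+-identityʳ _)) (trans (+-congˡ (sym fe≈0)) (trans (sym (sum-last f)) sum≈0))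

  valid/ : N/.IsValidSigning A/
  valid/ = (λ j j∈ D fund i →
             (λ i∈ → A-sign (ι∈B j∈) (fundCocircuit/-up j∈ fund) (inject∈∷ʳ i∈)) ,
             (λ i∉ → A-zero (ι∈B j∈) (fundCocircuit/-up j∈ fund) (i∉ ∘ inject∈∷ʳ⁻))) ,
           σ/ ,
           (λ C isC i → (λ i∈ → σ-sign (lifted isC) (inject∈∷ʳ i∈)) , (λ i∉ → σ-zero (lifted isC) (i∉ ∘ inject∈∷ʳ⁻))) ,
           λ j j∈ C isC → trans (sumK≈sum (λ i → A/ j i * σ/ C i))
             (sum-restrict (λ i → A (ι j) i * σ (C ∷ʳ Vec.lookup C p) i) (trans (*-congʳ (A-e j∈)) (zeroˡ _)) (orthogonal (ι∈B j∈) (lifted isC)))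
    where
    σ/ : Subset n → Fin n → Carrier
    -- The lift of C contains e exactly if C contains p.
    σ/ C i = σ (C ∷ʳ Vec.lookup C p) (ι i)
    lifted : ∀ {C} → IsCircuit Indep/ C → IsCircuit Indep (C ∷ʳ Vec.lookup C p)
    lifted {C} isC with circuit/-up isC
    ... | true , isC′ = ≡.subst (λ b → IsCircuit Indep (C ∷ʳ b)) (≡.sym (VecP.[]=⇒lookup (p∈circuit/ isC′))) isC′
    ... | false , isC′ with Vec.lookup C p in eq
    ...   | false = isC′
    ...   | true  = contradiction (VecP.lookup⇒[]= p C eq) (p∉circuit∖ isC′)

  -- Changing column p does not disturb orthogonality, as the vectors of circuits of the deletion
  -- vanish at p.
  valid∖ : N∖.IsValidSigning A∖
  valid∖ = cocircuitSigning , (λ C i → σ (C ∷ʳ false) (ι i)) ,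
           (λ C isC i → (λ i∈ → σ-sign (circuit∖-up isC) (inject∈∷ʳ i∈)) , (λ i∉ → σ-zero (circuit∖-up isC) (i∉ ∘ inject∈∷ʳ⁻))) ,
           λ j j∈ C isC → trans (sumK≈sum (λ i → A∖ j i * σ (C ∷ʳ false) (ι i))) (row j j∈ C isC (j FinP.≟ p))
    where
    row : ∀ j → j ∈ B∖ → ∀ C → IsCircuit Indep∖ C → Dec (j ≡ p) → sum (λ i → A∖ j i * σ (C ∷ʳ false) (ι i)) ≈ 0#
    row j j∈ C isC (yes refl) = sum-zero term
      where
      byEquality : ∀ {i} → Dec (i ≡ j) → A∖ j i * σ (C ∷ʳ false) (ι i) ≈ 0#
      byEquality (yes refl) = trans (*-congˡ (σ-zero (circuit∖-up isC) (p∉circuit∖ (circuit∖-up isC) ∘ inject∈∷ʳ⁻))) (zeroʳ _)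
      byEquality (no i≢p)   = trans (*-congʳ (A∖-p i≢p)) (zeroˡ _)
      term : ∀ i → A∖ j i * σ (C ∷ʳ false) (ι i) ≈ 0#
      term i = byEquality (i FinP.≟ j)
    row j j∈ C isC (no j≢p) = trans (sum-cong term) (sum-restrict (λ i → A (ι j) i * σ (C ∷ʳ false) i)
        (trans (*-congʳ (A-e (∈B∖⁻ j∈ j≢p))) (zeroˡ _)) (orthogonal (ι∈B (∈B∖⁻ j∈ j≢p)) (circuit∖-up isC)))
      where
      byEquality : ∀ {i} → Dec (i ≡ p) → A∖ j i * σ (C ∷ʳ false) (ι i) ≈ A (ι j) (ι i) * σ (C ∷ʳ false) (ι i)
      byEquality (no i≢p)   = *-congʳ (A∖-other j≢p i≢p)
      byEquality (yes refl) = trans (trans (*-congˡ σ≈0) (zeroʳ _)) (sym (trans (*-congˡ σ≈0) (zeroʳ _)))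
        where σ≈0 = σ-zero (circuit∖-up isC) (p∉circuit∖ (circuit∖-up isC) ∘ inject∈∷ʳ⁻)
      term : ∀ i → A∖ j i * σ (C ∷ʳ false) (ι i) ≈ A (ι j) (ι i) * σ (C ∷ʳ false) (ι i)
      term i = byEquality (i FinP.≟ p)

    -- A basis avoiding both e and p does not exist.
    only-p : ∀ {D} → IsFundCocircuit Indep∖ B∖ p D → ∀ {i} → i ∈ D → i ≡ p
    only-p fund {i} i∈D = Dec.decidable-stable (i FinP.≟ p) λ i≢p → absurd i≢p (proj₁ cocircuit _ basis)
      where
      module F = M∖.FundamentalCocircuit bB∖ p∈B∖
      rep = Equivalence.to (F.toReplaces fund i) i∈D
      basis : IsBasis Indep (((B∖ ∖ p) ∪ ⁅ i ⁆) ∷ʳ false)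
      basis = card⇒basis basis∖ (proj₂ rep) (≡.trans (∣∷ʳ∣ ((B∖ ∖ p) ∪ ⁅ i ⁆) false)
        (≡.trans (≡.cong (ℕ._+ 0) (≡.trans (∣∪⁅⁆∣ (B∖ ∖ p) i (proj₁ rep)) (∣∖∣ B∖ p∈B∖))) (≡.sym (∣∷ʳ∣ B∖ false))))
      absurd : i ≢ p → ¬ (∃[ x ] (x ∈ pair × x ∈ ((B∖ ∖ p) ∪ ⁅ i ⁆) ∷ʳ false))
      absurd i≢p (x , x∈pair , x∈) with ∈pair⁻ x∈pair
      ... | inj₁ refl = last∉∷ʳ {S = (B∖ ∖ p) ∪ ⁅ i ⁆} x∈
      ... | inj₂ refl = [ x∉∖x , i≢p ∘ ≡.sym ]′ (∈∪⁅⁆⁻ (inject∈∷ʳ⁻ x∈))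

    cocircuitSigning : N∖.IsCocircuitSigning A∖
    cocircuitSigning j j∈ D fund i with j FinP.≟ p
    cocircuitSigning j j∈ D fund@(_ , _ , p∈D) i | yes refl with i FinP.≟ j
    ... | yes refl = (λ _ → inj₁ ≈-refl) , λ i∉ → contradiction p∈D i∉
    ... | no i≢p   = (λ i∈ → contradiction (only-p fund i∈) i≢p) , λ _ → ≈-refl
    cocircuitSigning j j∈ D fund′ i | no j≢p with i FinP.≟ p
    ... | yes refl = (λ i∈ → contradiction refl (proj₂ (Equivalence.to (fundCocircuit∖-∈ j∈/ (fund j∈/) fund′ i) i∈))) , λ _ → ≈-refl
      where j∈/ = ∈B∖⁻ j∈ j≢p
    ... | no i≢p   = (λ i∈ → A-sign (ι∈B j∈/) (fund j∈/) (proj₁ (Equivalence.to iff i∈))) ,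
                     (λ i∉ → A-zero (ι∈B j∈/) (fund j∈/) λ i∈ → i∉ (Equivalence.from iff (i∈ , i≢p)))
      where
      j∈/ = ∈B∖⁻ j∈ j≢p
      iff = fundCocircuit∖-∈ j∈/ (fund j∈/) fund′ i

-- The Koszul argument for the broken circuit ideal of M.

module SeriesKoszul (K : Field) {n r : ℕ} {Indep : IndepSys (suc n)} (M : IsMatroid Indep) (r<n : suc r ≤ n)
                    (bB : IsBasis Indep (lastR (suc n) (suc r))) (cocircuit : IsCocircuit Indep (pairLast n (suc r)))
                    (A : Fin (suc n) → Fin (suc n) → Field.Carrier K) (valid : NBC.IsValidSigning K Indep (suc r) A) where
  private module K = Field K
  open Poly K (suc n) using (unitVec)
  open Polynomials K (suc n)
  open CommutativeRing polyRing hiding (zero) renaming (refl to ≈-refl)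
  open Ideals polyRing
  open KoszulModulo polyRing
  open IntegerSolver polyRing
  open SquareFreeIdeals K (suc n)
  open Matroid M
  open BrokenCircuits M
  open SeriesPair M r<n bB cocircuit
  open SeriesSigning K M r<n bB cocircuit A valid
  open NBCIdeal K M (suc r) A
  private
    module Sum = RingSums K.commRing
    module R = Representation K M bB masked

    diagonal : ∀ j → j ∈ B → R.Unit (masked j j)
    diagonal j j∈ = masked j j , K.trans (K.reflexive (≡.cong₂ K._*_ (masked-inside j∈ j) (masked-inside j∈ j))) (square-one (A-diagonal j∈))

    offDiagonal : ∀ j i → j ∈ B → i ∈ B → i ≢ j → masked j i K.≈ K.0#
    offDiagonal j i j∈ i∈ i≢j = K.trans (K.reflexive (masked-inside j∈ i)) (A-offDiagonal j∈ i∈ i≢j)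

    relation : ∀ C → IsCircuit Indep C → ∃ (R.CircuitRelation C)
    relation C isC = σ C , (λ i i∈ → σ C i , square-one (σ-sign isC i∈)) , (λ i → σ-zero isC) ,
      λ j j∈ → K.trans (Sum.sum-cong λ i → K.*-congʳ {σ C i} (K.reflexive (masked-inside j∈ i))) (orthogonal j∈ isC)

    module V = KoszulVanishing K M bB masked diagonal offDiagonal masked-outside relation

    -- The recursion is entered with e deleted and nothing inverted, that is, at I + (xₑ).
    stage : V.Stage n ⁅ e ⁆ ⊥
    stage = record
      { D-above  = λ i∈ → ≡.subst (λ i → n ≤ toℕ i) (≡.sym (SubP.x∈⁅y⁆⇒x≡y e i∈)) (ℕP.≤-reflexive (≡.sym (FinP.toℕ-fromℕ n)))
      ; C-above  = λ i∈ → contradiction i∈ SubP.∉⊥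
      ; covered  = λ i n≤i → inj₁ (byView (lastView i) n≤i)
      ; disjoint = λ _ → SubP.∉⊥
      }
      where
      byView : ∀ {i} → LastView i → n ≤ toℕ i → i ∈ ⁅ e ⁆
      byView isLast       _   = SubP.x∈⁅x⁆ e
      byView (isInject i) n≤i = contradiction (≡.subst (n ≤_) (FinP.toℕ-inject₁ i) n≤i) (ℕP.<⇒≱ (FinP.toℕ<n i))

    avoidable : V.Avoidable ⁅ e ⁆
    avoidable = B∖ ∷ʳ false , (proj₁ basis∖ , basis-card basis∖ bB) ,
      λ i i∈ i∈e → last∉∷ʳ {S = B∖} (≡.subst (_∈ B∖ ∷ʳ false) (SubP.x∈⁅y⁆⇒x≡y e i∈e) i∈)

    exact : ExactMod (Span λ α → Broken α ⊎ Involves e α) V.θ B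
    exact = exact-transport {θ = V.θ} to from (V.exact-stage n (ℕP.n≤1+n n) stage avoidable)
      where
      to : ∀ {α} → V.Reached ⁅ e ⁆ ⊥ α → Broken α ⊎ Involves e α
      to {α} (inj₁ (d , d∈ , d∈α)) = inj₂ (≡.subst (λ d → Involves d α) (SubP.x∈⁅y⁆⇒x≡y e d∈) d∈α)
      to {α} (inj₂ broken) = inj₁ (HasBroken-mono (λ i∈ → [ id , (λ i∈⊥ → contradiction i∈⊥ SubP.∉⊥) ]′ (SubP.x∈p∪q⁻ (supp α) ⊥ i∈)) broken)
      from : ∀ {α} → Broken α ⊎ Involves e α → V.Reached ⁅ e ⁆ ⊥ α
      from (inj₁ broken) = inj₂ (HasBroken-mono ∈∪ˡ broken)
      from (inj₂ e∈α)    = inj₁ (e , SubP.x∈⁅x⁆ e , e∈α)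

  -- Snake lemma for multiplication by xₑ.
  colon-decompose : ∀ u → J (X e * u) → ∃[ b ] Span (λ α → Broken (unitVec e ⊕ α)) (u - combination b)
  colon-decompose u Xu∈ = extract (decompose Xu∈)
    where
    isI = Span-isIdeal {Broken} (λ {α} → broken-up {α})
    open IsIdeal isI
    broken-or-e-up : UpClosed λ α → Broken α ⊎ Involves e α
    broken-or-e-up {α} β (inj₁ broken) = inj₁ (broken-up {α} β broken)
    broken-or-e-up β (inj₂ e∈α) = inj₂ (involves-⊕ β e∈α)
    isI⁺ = Span-isIdeal broken-or-e-up
    module I⁺ = IsIdeal isI⁺
    extract : (∃[ b ] Span Broken (X e * u - combination b)) → ∃[ b ] Span (λ α → Broken (unitVec e ⊕ α)) (u - combination b)
    extract (b , Xu-b∈) = quot , Span-colon⁺ {Broken} e (resp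
        (solve 4 (λ x u c q → (x :* u :- c) :+ (c :- x :* q) := x :* (u :- q)) ≈-refl (X e) u (combination b) (combination quot))
        (+∈ Xu-b∈ (division-sum isI {θ = V.θ} (λ j j∉B → ≈0∈ (V.θ≈0 j j∉B)) d)))
      where
      Xu∈⁺ : Span (λ α → Broken α ⊎ Involves e α) (X e * u)
      Xu∈⁺ = Span-colon⁻ {λ α → Broken α ⊎ Involves e α} e (spanned λ α ¬T → contradiction (inj₂ (involves-unit e)) ¬T)
      -- Modulo xₑ the left side `X e * u` disappears, so b is a relation between the forms modulo I
      -- + (xₑ) and can be divided by xₑ.
      b∈⁺ : Span (λ α → Broken α ⊎ Involves e α) (combination b)
      b∈⁺ = I⁺.resp (solve 2 (λ u c → u :- (u :- c) := c) ≈-refl (X e * u) (combination b)) (I⁺.sub∈ Xu∈⁺ (Span-mono inj₁ Xu-b∈))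
      d : Division isI V.θ B (X e) b
      d = divide isI {J = Span λ α → Broken α ⊎ Involves e α} (λ y∈ → Span-split e (λ {α} → broken-up {α}) y∈) exact b b∈⁺
      open Division d

-- Substituting a multiple of xₚ for the last variable.

module LastVariable (K : Field) {n : ℕ} (p : Fin n) where
  private
    module K = Field K
    module P = Polynomials K n
    module Q = Polynomials K (suc n)
    module R = CommutativeRing P.polyRing
    module S = CommutativeRing Q.polyRing
    e : Fin (suc n)
    e = fromℕ n
  open SemiringExp K.semiring using (_^_; ^-homo-*)
  open Poly K using (Pol; unitVec; linForm)

  ∷ʳ-⊕ : ∀ (α β : Mono n) k l → (α P.⊕ β) ∷ʳ (k ℕ.+ l) ≡ (α ∷ʳ k) Q.⊕ (β ∷ʳ l)
  ∷ʳ-⊕ α β k l = vec-ext λ i → ≡.trans (byView (lastView i)) (≡.sym (Q.lookup-⊕ (α ∷ʳ k) (β ∷ʳ l) i))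
    where
    byView : ∀ {i} → LastView i → Vec.lookup ((α P.⊕ β) ∷ʳ (k ℕ.+ l)) i ≡ Vec.lookup (α ∷ʳ k) i ℕ.+ Vec.lookup (β ∷ʳ l) i
    byView isLast       = ≡.trans (lookup-∷ʳ-last (α P.⊕ β) _) (≡.sym (≡.cong₂ ℕ._+_ (lookup-∷ʳ-last α k) (lookup-∷ʳ-last β l)))
    byView (isInject i) = ≡.trans (lookup-∷ʳ-inject (α P.⊕ β) _ i) (≡.trans (P.lookup-⊕ α β i)
                            (≡.sym (≡.cong₂ ℕ._+_ (lookup-∷ʳ-inject α k i) (lookup-∷ʳ-inject β l i))))

  unit-inject : ∀ i → unitVec (suc n) (inject₁ i) ≡ unitVec n i ∷ʳ 0
  unit-inject i = vec-ext λ j → byView (lastView j)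
    where
    at : ∀ j → Vec.lookup (unitVec (suc n) (inject₁ i)) (inject₁ j) ≡ Vec.lookup (unitVec n i) j
    at j with i FinP.≟ j
    ... | yes refl = ≡.trans (Q.lookup-unit-refl (inject₁ i)) (≡.sym (P.lookup-unit-refl i))
    ... | no i≢j   = ≡.trans (Q.lookup-unit-≢ (i≢j ∘ FinP.inject₁-injective)) (≡.sym (P.lookup-unit-≢ i≢j))
    byView : ∀ {j} → LastView j → Vec.lookup (unitVec (suc n) (inject₁ i)) j ≡ Vec.lookup (unitVec n i ∷ʳ 0) j
    byView isLast       = ≡.trans (Q.lookup-unit-≢ {inject₁ i} {e} (fromℕ≢inject₁ ∘ ≡.sym)) (≡.sym (lookup-∷ʳ-last (unitVec n i) 0))
    byView (isInject j) = ≡.trans (at j) (≡.sym (lookup-∷ʳ-inject (unitVec n i) 0 j))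

  unit-last : unitVec (suc n) e ≡ P.𝟎 ∷ʳ 1
  unit-last = vec-ext λ j → byView (lastView j)
    where
    byView : ∀ {j} → LastView j → Vec.lookup (unitVec (suc n) e) j ≡ Vec.lookup (P.𝟎 ∷ʳ 1) j
    byView isLast       = ≡.trans (Q.lookup-unit-refl e) (≡.sym (lookup-∷ʳ-last P.𝟎 1))
    byView (isInject j) = ≡.trans (Q.lookup-unit-≢ {e} {inject₁ j} fromℕ≢inject₁) (≡.sym (≡.trans (lookup-∷ʳ-inject P.𝟎 1 j) (VecP.lookup-replicate j 0)))

  zero-∷ʳ : Q.𝟎 ≡ P.𝟎 ∷ʳ 0
  zero-∷ʳ = vec-ext λ i → ≡.trans (VecP.lookup-replicate i 0) (≡.sym (byView (lastView i)))
    where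
    byView : ∀ {i} → LastView i → Vec.lookup (P.𝟎 ∷ʳ 0) i ≡ 0
    byView isLast       = lookup-∷ʳ-last P.𝟎 0
    byView (isInject i) = ≡.trans (lookup-∷ʳ-inject P.𝟎 0 i) (VecP.lookup-replicate i 0)

  module Lift = MonomialMap K (_∷ʳ 0) (λ _ → K.1#) (λ α β → ∷ʳ-⊕ α β 0 0) (λ _ _ → K.sym (K.*-identityˡ K.1#))

  lift : Pol n → Pol (suc n)
  lift = Lift.hom

  lift-monomial : ∀ c α → lift (P.monomial c α) S.≈ Q.monomial c (α ∷ʳ 0)
  lift-monomial c α = Q.≋⇒≈ᴾ (lift (P.monomial c α)) (Q.monomial c (α ∷ʳ 0)) λ g → K.+-congʳ (K.*-congʳ (K.*-identityʳ c))

  lift-X : ∀ i → lift (P.X i) S.≈ Q.X (inject₁ i)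
  lift-X i = S.trans (lift-monomial K.1# (unitVec n i)) (S.reflexive (≡.cong (Q.monomial K.1#) (≡.sym (unit-inject i))))

  lift-ι : ∀ c → lift (P.ι c) S.≈ Q.ι c
  lift-ι c = S.trans (lift-monomial c P.𝟎) (S.reflexive (≡.cong (Q.monomial c) (≡.sym zero-∷ʳ)))

  linForm-last : ∀ a → linForm (suc n) a S.≈ lift (linForm n (a ∘ inject₁)) S.+ Q.ι (a e) S.* Q.X e
  linForm-last a = S.trans (Q.linForm-sum a) (S.trans (RingSums.sum-init-last Q.polyRing (λ i → Q.ι (a i) S.* Q.X i))
    (S.+-congʳ {Q.ι (a e) S.* Q.X e} (S.sym (S.trans (Lift.hom-cong (P.linForm-sum (a ∘ inject₁)))
      (S.trans (Lift.hom-sum (λ i → P.ι (a (inject₁ i)) R.* P.X i)) (RingSums.sum-cong Q.polyRing λ i →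
        S.trans (Lift.hom-* (P.ι (a (inject₁ i))) (P.X i)) (S.*-cong (lift-ι (a (inject₁ i))) (lift-X i))))))))

  times : ℕ → Mono n → Mono n
  times k = Vec.map (k ℕ.*_)

  lookup-times : ∀ k α i → Vec.lookup (times k α) i ≡ k ℕ.* Vec.lookup α i
  lookup-times k α i = VecP.lookup-map i (k ℕ.*_) α

  -- The effect of xₑ ↦ s xₚ on exponents: that of e is added to that of p. The scalar, a power of
  -- s, is kept as the weight.
  collapse : Mono (suc n) → Mono n
  collapse β = restrict β P.⊕ times (Vec.lookup β e) (unitVec n p)

  lookup-collapse : ∀ β i → Vec.lookup (collapse β) i ≡ Vec.lookup β (inject₁ i) ℕ.+ Vec.lookup β e ℕ.* Vec.lookup (unitVec n p) i
  lookup-collapse β i = ≡.trans (P.lookup-⊕ (restrict β) _ i) (≡.cong₂ ℕ._+_ (lookup-restrict β i) (lookup-times (Vec.lookup β e) (unitVec n p) i))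

  collapse-⊕ : ∀ α β → collapse (α Q.⊕ β) ≡ collapse α P.⊕ collapse β
  collapse-⊕ α β = vec-ext λ i → ≡.trans (lookup-collapse (α Q.⊕ β) i) (≡.trans
    (≡.cong₂ (λ a b → a ℕ.+ b ℕ.* Vec.lookup (unitVec n p) i) (Q.lookup-⊕ α β (inject₁ i)) (Q.lookup-⊕ α β e))
    (≡.trans (rearrange (Vec.lookup α (inject₁ i)) (Vec.lookup β (inject₁ i)) (Vec.lookup α e) (Vec.lookup β e) (Vec.lookup (unitVec n p) i))
      (≡.sym (≡.trans (P.lookup-⊕ (collapse α) (collapse β) i) (≡.cong₂ ℕ._+_ (lookup-collapse α i) (lookup-collapse β i))))))
    where
    rearrange : ∀ a b c d u → (a ℕ.+ b) ℕ.+ (c ℕ.+ d) ℕ.* u ≡ (a ℕ.+ c ℕ.* u) ℕ.+ (b ℕ.+ d ℕ.* u)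
    rearrange a b c d u = ≡.trans (≡.cong ((a ℕ.+ b) ℕ.+_) (ℕP.*-distribʳ-+ u c d)) (ℕ-interchange a b (c ℕ.* u) (d ℕ.* u))
      where
      ℕ-interchange : ∀ a b c d → (a ℕ.+ b) ℕ.+ (c ℕ.+ d) ≡ (a ℕ.+ c) ℕ.+ (b ℕ.+ d)
      ℕ-interchange = CommutativeSemigroupProperties.interchange ℕP.+-commutativeSemigroup

  collapse-∷ʳ0 : ∀ α → collapse (α ∷ʳ 0) ≡ α
  collapse-∷ʳ0 α = vec-ext λ i → ≡.trans (lookup-collapse (α ∷ʳ 0) i) (≡.trans
    (≡.cong₂ (λ a b → a ℕ.+ b ℕ.* Vec.lookup (unitVec n p) i) (lookup-∷ʳ-inject α 0 i) (lookup-∷ʳ-last α 0)) (ℕP.+-identityʳ _))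

  collapse-unit : collapse (unitVec (suc n) e) ≡ unitVec n p
  collapse-unit = vec-ext λ i → ≡.trans (lookup-collapse (unitVec (suc n) e) i) (≡.trans
    (≡.cong₂ (λ a b → a ℕ.+ b ℕ.* Vec.lookup (unitVec n p) i) (Q.lookup-unit-≢ {e} {inject₁ i} fromℕ≢inject₁) (Q.lookup-unit-refl e)) (ℕP.+-identityʳ _))

  collapse-involves : ∀ {β i} → Q.Involves (inject₁ i) β → P.Involves i (collapse β)
  collapse-involves {β} {i} (Q.positive 0<) = P.positive (≡.subst (0 <_) (≡.sym (lookup-collapse β i)) (ℕP.≤-trans 0< (ℕP.m≤m+n _ _)))

  -- hom is the substitution xₑ ↦ s xₚ.
  module Substitute (s : K.Carrier) where
    open MonomialMap K collapse (λ β → s ^ Vec.lookup β e) collapse-⊕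
      (λ α β → K.trans (K.reflexive (≡.cong (s ^_) (Q.lookup-⊕ α β e))) (^-homo-* s (Vec.lookup α e) (Vec.lookup β e))) public

    hom-lift : ∀ f → hom (lift f) R.≈ f
    hom-lift f = P.≋⇒≈ᴾ (hom (lift f)) f λ g → K.trans (ev-hom (lift f) g) (K.trans (Lift.ev-hom f _)
      (P.ev-cong f λ α → K.trans (K.*-identityˡ _) (K.trans (K.*-cong (K.reflexive (≡.cong (s ^_) (lookup-∷ʳ-last α 0))) (K.reflexive (≡.cong g (collapse-∷ʳ0 α))))
        (K.*-identityˡ (g α)))))

    hom-ι : ∀ c → hom (Q.ι c) R.≈ P.ι c
    hom-ι c = R.trans (hom-cong (S.sym (lift-ι c))) (hom-lift (P.ι c))

    hom-X-last : hom (Q.X e) R.≈ P.ι s R.* P.X p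
    hom-X-last = P.≋⇒≈ᴾ (hom (Q.X e)) (P.ι s R.* P.X p) λ g → K.+-congʳ (K.*-cong
      (K.trans (K.*-identityˡ _) (K.trans (K.reflexive (≡.cong (s ^_) (Q.lookup-unit-refl e))) (K.trans (K.*-identityʳ s) (K.sym (K.*-identityʳ s)))))
      (K.reflexive (≡.cong g (≡.trans collapse-unit (≡.sym (P.⊕-identityˡ (unitVec n p)))))))

    hom-linForm : ∀ a → hom (linForm (suc n) a) R.≈ linForm n (a ∘ inject₁) R.+ P.ι (a e) R.* (P.ι s R.* P.X p)
    hom-linForm a = R.trans (hom-cong (linForm-last a)) (R.trans (hom-+ (lift (linForm n (a ∘ inject₁))) (Q.ι (a e) S.* Q.X e))
      (R.+-cong (hom-lift (linForm n (a ∘ inject₁))) (R.trans (hom-* (Q.ι (a e)) (Q.X e)) (R.*-cong (hom-ι (a e)) hom-X-last))))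

    module _ {J : Pol (suc n) → Set} (isJ : Ideals.IsIdeal Q.polyRing J) (X∈ : J (Q.X e S.- Q.ι s S.* Q.X (inject₁ p))) where
      open Ideals.IsIdeal isJ
      open IntegerSolver Q.polyRing

      private
        Stable : Pol (suc n) → Set
        Stable f = J (f S.- lift (hom f))

        stable-resp : ∀ {f g} → f S.≈ g → Stable f → Stable g
        stable-resp f≈g = resp (S.+-cong f≈g (S.-‿cong (Lift.hom-cong (hom-cong f≈g))))

        stable-* : ∀ f g → Stable f → Stable g → Stable (f S.* g)
        stable-* f g sf sg = resp
          (S.trans (solve 4 (λ f f′ g g′ → g :* (f :- f′) :+ f′ :* (g :- g′) := f :* g :- f′ :* g′) S.refl f (lift (hom f)) g (lift (hom g)))
            (S.+-congˡ {f S.* g} (S.-‿cong (S.sym (S.trans (Lift.hom-cong (hom-* f g)) (Lift.hom-* (hom f) (hom g)))))))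
          (+∈ (*∈ g sf) (*∈ (lift (hom f)) sg))

        stable-+ : ∀ f g → Stable f → Stable g → Stable (f S.+ g)
        stable-+ f g sf sg = resp
          (S.trans (solve 4 (λ f f′ g g′ → (f :- f′) :+ (g :- g′) := (f :+ g) :- (f′ :+ g′)) S.refl f (lift (hom f)) g (lift (hom g)))
            (S.+-congˡ {f S.+ g} (S.-‿cong (S.sym (S.trans (Lift.hom-cong (hom-+ f g)) (Lift.hom-+ (hom f) (hom g)))))))
          (+∈ sf sg)

        stable-lift : ∀ f → Stable (lift f)
        stable-lift f = ≈⇒∈ (Lift.hom-cong (R.sym (hom-lift f)))

        stable-X : Stable (Q.X e)
        stable-X = resp (S.+-congˡ {Q.X e} (S.-‿cong (S.sym (S.trans (Lift.hom-cong hom-X-last) (S.trans (Lift.hom-* (P.ι s) (P.X p)) (S.*-cong (lift-ι s) (lift-X p))))))) X∈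

        stable-monomial : ∀ c α k → Stable (Q.monomial c (α ∷ʳ k))
        stable-monomial c α zero    = stable-resp (lift-monomial c α) (stable-lift (P.monomial c α))
        stable-monomial c α (suc k) = stable-resp
          (S.trans (S.sym (Q.monomial-X c e (α ∷ʳ k))) (S.reflexive (≡.cong (Q.monomial c)
            (≡.trans (≡.cong (Q._⊕ (α ∷ʳ k)) unit-last) (≡.trans (≡.sym (∷ʳ-⊕ P.𝟎 α 1 k)) (≡.cong (_∷ʳ suc k) (P.⊕-identityˡ α)))))))
          (stable-* (Q.X e) (Q.monomial c (α ∷ʳ k)) stable-X (stable-monomial c α k))

      -- Polynomials congruent to their substitution are closed under sums and products and include
      -- xₑ and everything lifted, hence all monomials by induction on the exponent of xₑ.
      reduce : ∀ f → J (f S.- lift (hom f))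
      reduce []            = 0∈
      reduce ((c , β) ∷ f) = stable-+ (Q.monomial c β) f
        (≡.subst (λ β → Stable (Q.monomial c β)) (≡.sym (∷ʳ-eta β)) (stable-monomial c (restrict β) (Vec.lookup β e))) (reduce f)

-- The maps between the three rings, and the basis of k(M).

module SeriesStep (K : Field) {n r : ℕ} {Indep : IndepSys (suc n)} (M : IsMatroid Indep) (r<n : suc r ≤ n)
                  (bB : IsBasis Indep (lastR (suc n) (suc r))) (cocircuit : IsCocircuit Indep (pairLast n (suc r)))
                  (A : Fin (suc n) → Fin (suc n) → Field.Carrier K) (valid : NBC.IsValidSigning K Indep (suc r) A) where
  private module K = Field K
  open SeriesPair M r<n bB cocircuit
  open SeriesUpperSets K M r<n bB cocircuit
  open SeriesSigning K M r<n bB cocircuit A valid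
  open SeriesKoszul K M r<n bB cocircuit A valid
  open LastVariable K p
  private
    module P  = Polynomials K n
    module Q  = Polynomials K (suc n)
    module PQ = SquareFreeIdeals K (suc n)
    module R  = CommutativeRing P.polyRing
    module S  = CommutativeRing Q.polyRing
    module RS = RingSums P.polyRing
    module QS = RingSums Q.polyRing
    module SolveK = IntegerSolver K.commRing
    module SolveR = IntegerSolver P.polyRing
    module SolveS = IntegerSolver Q.polyRing
    module I  = NBCIdeal K M (suc r) A
    module I∖ = NBCIdeal K Deletion.isMatroid (suc r) A∖
    module I/ = NBCIdeal K Contraction.isMatroid r A/
    module J  = Ideals.IsIdeal I.J-isIdeal
    module J∖ = Ideals.IsIdeal I∖.J-isIdeal
    module J/ = Ideals.IsIdeal I/.J-isIdeal
    module BC  = BrokenCircuits M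
    module BC∖ = BrokenCircuits Deletion.isMatroid
    module BC/ = BrokenCircuits Contraction.isMatroid
    module N  = NBC K Indep (suc r)
    module N∖ = NBC K Indep∖ (suc r)
    module N/ = NBC K Indep/ r
  open Poly K using (Pol; unitVec; linForm; monoOf; SupportedIn; IsZero)

  broken∖-up : ∀ {F} → BC∖.HasBroken F → BC.HasBroken (F ∷ʳ false)
  broken∖-up (C , c , isC , isMin , ⊆F) = C ∷ʳ false , ι c , circuit∖-up isC , Equivalence.to min-inject isMin , λ x∈ → ∷ʳ-mono ⊆F (∖-∷ʳ⊇ {S = C} x∈)

  -- The lifted circuit may or may not contain e; allowing e in the set covers both.
  broken/-up : ∀ {F} → BC/.HasBroken F → BC.HasBroken (F ∷ʳ true)
  broken/-up {F} (C , c , isC , isMin , ⊆F) with circuit/-up isC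
  ... | b , isC′ = C ∷ʳ b , ι c , isC′ , Equivalence.to min-inject isMin ,
    inject⊆ (λ x∈ → inject∈∷ʳ (⊆F (inject∈∷ʳ⁻ {S = C ∖ c} (∖-∷ʳ⊇ {S = C} x∈)))) (λ _ → last∈∷ʳ F)

  private
    splitBroken : ∀ {P : Set} {G} → BC.HasBroken G →
                  (∀ C b c → IsCircuit Indep (C ∷ʳ b) → IsMin Indep (C ∷ʳ b) (ι c) → (C ∷ʳ b) ∖ ι c ⊆ G → P) → P
    splitBroken {P} {G} (C , c , isC , isMin , ⊆G) continue = byView (lastView c) isMin ⊆G
      where
      byView : ∀ {c} → LastView c → IsMin Indep C c → C ∖ c ⊆ G → P
      byView isLast       isMin ⊆G = contradiction refl (circuit-min≢e isC isMin)
      byView (isInject c) isMin ⊆G = continue (restrict C) (Vec.lookup C e) c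
        (≡.subst (IsCircuit Indep) (∷ʳ-eta C) isC) (≡.subst (λ C → IsMin Indep C (ι c)) (∷ʳ-eta C) isMin)
        (≡.subst (λ C → C ∖ ι c ⊆ G) (∷ʳ-eta C) ⊆G)

  broken∖-down : ∀ {G} → e ∉ G → BC.HasBroken G → BC∖.HasBroken (restrict G)
  broken∖-down {G} e∉G broken = splitBroken broken continue
    where
    continue : ∀ C b c → IsCircuit Indep (C ∷ʳ b) → IsMin Indep (C ∷ʳ b) (ι c) → (C ∷ʳ b) ∖ ι c ⊆ G → BC∖.HasBroken (restrict G)
    continue C true  c isC isMin ⊆G = contradiction (⊆G (∈∖ (last∈∷ʳ C) fromℕ≢inject₁)) e∉G
    continue C false c isC isMin ⊆G = C , c , circuit∖-down isC , Equivalence.from min-inject isMin , λ x∈ → ∈restrict (⊆G (∖-∷ʳ⊆ (inject∈∷ʳ x∈)))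

  broken/-down : ∀ {G} → BC.HasBroken G → BC/.HasBroken (restrict G)
  broken/-down {G} broken = splitBroken {P = BC/.HasBroken (restrict G)} broken λ C b c isC isMin ⊆G →
    C , c , circuit/-down b isC , Equivalence.from min-inject isMin , λ x∈ → ∈restrict (⊆G (∖-∷ʳ⊆ (inject∈∷ʳ x∈)))

  -- The row of e reads θ = a xₑ + c xₚ, so modulo θ the variable xₑ equals s xₚ.

  a c s : K.Carrier
  a = A e e
  c = A e (ι p)
  -- Solves a xₑ + c xₚ = 0, using a² = 1.
  s = K.- (a K.* c)

  y : Pol n
  y = P.X p

  a²≈1 : a K.* a K.≈ K.1#
  a²≈1 = square-one (A-diagonal e∈B)

  c²≈1 : c K.* c K.≈ K.1#
  c²≈1 = square-one (A-sign e∈B pair-fund p∈pair)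

  s²≈1 : s K.* s K.≈ K.1#
  s²≈1 = K.trans (SolveK.solve 2 (λ a c → (SolveK.:- (a SolveK.:* c)) SolveK.:* (SolveK.:- (a SolveK.:* c)) SolveK.:= (a SolveK.:* a) SolveK.:* (c SolveK.:* c)) K.refl a c)
    (K.trans (K.*-cong a²≈1 c²≈1) (K.*-identityˡ K.1#))

  row-e : linForm n (A e ∘ ι) R.≈ P.ι c R.* y
  row-e = R.trans (P.linForm-sum (A e ∘ ι)) (R.trans (RS.sum-cong term) (RS.sum-δ p (λ i → P.ι c R.* y)))
    where
    byEquality : ∀ {i} → Dec (i ≡ p) → P.ι (A e (ι i)) R.* P.X i R.≈ RS.δ i p R.* (P.ι c R.* y)
    byEquality (yes refl) = R.sym (R.trans (R.*-congʳ {P.ι c R.* y} (RS.δ-refl p)) (R.*-identityˡ (P.ι c R.* y)))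
    byEquality {i} (no i≢p) = R.trans (R.trans (R.*-congʳ {P.X i} (R.trans (P.ι-cong (A-last-row i≢p)) P.ι-0)) (R.zeroˡ (P.X i)))
                                      (R.sym (R.trans (R.*-congʳ {P.ι c R.* y} (RS.δ-≢ i≢p)) (R.zeroˡ (P.ι c R.* y))))
    term : ∀ i → P.ι (A e (ι i)) R.* P.X i R.≈ RS.δ i p R.* (P.ι c R.* y)
    term i = byEquality (i FinP.≟ p)

  θₑ : linForm (suc n) (A e) S.≈ Q.ι c S.* Q.X (ι p) S.+ Q.ι a S.* Q.X e
  θₑ = S.trans (linForm-last (A e)) (S.+-congʳ {Q.ι a S.* Q.X e} (S.trans (Lift.hom-cong row-e)
    (S.trans (Lift.hom-* (P.ι c) y) (S.*-cong (lift-ι c) (lift-X p)))))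

  Xₑ≡sXₚ : I.J (Q.X e S.- Q.ι s S.* Q.X (ι p))
  Xₑ≡sXₚ = J.resp (S.trans (S.*-congˡ {Q.ι a} θₑ) (S.trans
      (solve 4 (λ a c x y → a :* (c :* y :+ a :* x) := (a :* a) :* x :- (:- (a :* c)) :* y) S.refl (Q.ι a) (Q.ι c) (Q.X e) (Q.X (ι p)))
      (S.+-cong (S.trans (S.*-congʳ {Q.X e} (S.trans (S.sym (Q.ι-* a a)) (Q.ι-cong a²≈1))) (S.*-identityˡ (Q.X e)))
                (S.-‿cong (S.*-congʳ {Q.X (ι p)} (S.-‿cong (S.sym (Q.ι-* a c))))))))
    (J.*∈ (Q.ι a) (I.linForm∈ e∈B))
    where open SolveS

  y≡sXₑ : I.J (lift y S.- Q.ι s S.* Q.X e)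
  y≡sXₑ = J.resp (S.trans (solve 3 (λ s x y → (:- s) :* (x :- s :* y) := (s :* s) :* y :- s :* x) S.refl (Q.ι s) (Q.X e) (Q.X (ι p)))
      (S.+-congʳ {S.- (Q.ι s S.* Q.X e)} (S.trans (S.*-congʳ {Q.X (ι p)} (S.trans (S.sym (Q.ι-* s s)) (Q.ι-cong s²≈1)))
        (S.trans (S.*-identityˡ (Q.X (ι p))) (S.sym (lift-X p))))))
    (J.*∈ (S.- Q.ι s) Xₑ≡sXₚ)
    where open SolveS

  -- Two substitutions: xₑ ↦ s xₚ holds in k(M) and leads to M / e, while xₑ ↦ 0 leads to the
  -- deletion, where xₚ is zero too.
  module Reduce = Substitute s
  module Kill   = Substitute K.0#

  f≡lift : ∀ f → I.J (f S.- lift (Reduce.hom f))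
  f≡lift = Reduce.reduce I.J-isIdeal Xₑ≡sXₚ

  row∖ : ∀ {j} → j ≢ p → linForm n (A (ι j) ∘ ι) R.≈ linForm n (A∖ j) R.+ P.ι (A (ι j) (ι p)) R.* y
  row∖ {j} j≢p = R.trans (P.linForm-sum (A (ι j) ∘ ι)) (R.trans (RS.sum-cong term) (R.trans
      (RS.∑-distrib-+ (λ i → P.ι (A∖ j i) R.* P.X i) (λ i → RS.δ i p R.* (P.ι (A (ι j) (ι p)) R.* y)))
      (R.+-cong (R.sym (P.linForm-sum (A∖ j))) (RS.sum-δ p (λ i → P.ι (A (ι j) (ι p)) R.* y)))))
    where
    z = P.ι (A (ι j) (ι p)) R.* y
    byEquality : ∀ {i} → Dec (i ≡ p) → P.ι (A (ι j) (ι i)) R.* P.X i R.≈ P.ι (A∖ j i) R.* P.X i R.+ RS.δ i p R.* z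
    byEquality (yes refl) = R.sym (R.trans (R.+-cong (R.trans (R.*-congʳ {y} (R.trans (P.ι-cong (A∖-column j≢p)) P.ι-0)) (R.zeroˡ y))
                                                     (R.trans (R.*-congʳ {z} (RS.δ-refl p)) (R.*-identityˡ z))) (R.+-identityˡ z))
    byEquality {i} (no i≢p) = R.sym (R.trans (R.+-cong (R.*-congʳ {P.X i} (P.ι-cong (A∖-other j≢p i≢p)))
                                                       (R.trans (R.*-congʳ {z} (RS.δ-≢ i≢p)) (R.zeroˡ z))) (R.+-identityʳ _))
    term : ∀ i → P.ι (A (ι j) (ι i)) R.* P.X i R.≈ P.ι (A∖ j i) R.* P.X i R.+ RS.δ i p R.* z
    term i = byEquality (i FinP.≟ p)

  rowₚ : linForm n (A∖ p) R.≈ y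
  rowₚ = R.trans (P.linForm-sum (A∖ p)) (R.trans (RS.sum-cong λ i → term i) (RS.sum-δ p (λ i → y)))
    where
    byEquality : ∀ {i} → Dec (i ≡ p) → P.ι (A∖ p i) R.* P.X i R.≈ RS.δ i p R.* y
    byEquality (yes refl) = R.*-congʳ {y} (R.trans (P.ι-cong A∖-pp) (R.sym (RS.δ-refl p)))
    byEquality {i} (no i≢p) = R.trans (R.trans (R.*-congʳ {P.X i} (R.trans (P.ι-cong (A∖-p i≢p)) P.ι-0)) (R.zeroˡ (P.X i)))
                                      (R.sym (R.trans (R.*-congʳ {y} (RS.δ-≢ i≢p)) (R.zeroˡ y)))
    term : ∀ i → P.ι (A∖ p i) R.* P.X i R.≈ RS.δ i p R.* y
    term i = byEquality (i FinP.≟ p)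

  row-lift : ∀ {j} → j ∈ B/ → linForm (suc n) (A (ι j)) S.≈ lift (linForm n (A (ι j) ∘ ι))
  row-lift {j} j∈ = S.trans (linForm-last (A (ι j))) (S.trans (S.+-congˡ {lift (linForm n (A (ι j) ∘ ι))}
    (S.trans (S.*-congʳ {Q.X e} (S.trans (Q.ι-cong (A-e j∈)) Q.ι-0)) (S.zeroˡ (Q.X e)))) (S.+-identityʳ _))

  y∈J∖ : I∖.J y
  y∈J∖ = J∖.resp rowₚ (I∖.linForm∈ p∈B∖)

  monoOf-involves : ∀ {F : Subset n} {k i} → ι i ∈ F ∷ʳ false → Q.Involves (ι i) (monoOf n F ∷ʳ k)
  monoOf-involves {F} {k} {i} i∈ = Q.positive (≡.subst (0 <_)
    (≡.sym (≡.trans (lookup-∷ʳ-inject (monoOf n F) k i) (I∖.lookup-monoOf (inject∈∷ʳ⁻ {S = F} i∈)))) (s≤s z≤n))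

  -- Relations of the deletion hold in k(M) up to multiples of xₚ: its broken circuits are broken in
  -- M, its form of p is xₚ, and its other forms differ from those of M by a multiple of xₚ.
  deletion-lift : ∀ {h} → I∖.J h → ∃[ q ] I.J (lift h S.- lift y S.* q)
  deletion-lift = P.generated-minimal isIdeal generators
    where
    open SolveS
    isIdeal : Ideals.IsIdeal P.polyRing λ h → ∃[ q ] I.J (lift h S.- lift y S.* q)
    isIdeal = record
      { resp = λ f≈g (q , f∈) → q , J.resp (S.+-congʳ (Lift.hom-cong f≈g)) f∈
      ; 0∈   = S.0# , J.≈0∈ (S.trans (S.+-congˡ {S.0#} (S.-‿cong (S.zeroʳ (lift y)))) (S.-‿inverseʳ S.0#))
      ; +∈   = λ {f} {g} (q , f∈) (q′ , g∈) → q S.+ q′ , J.resp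
          (S.trans (solve 5 (λ f g y q q′ → (f :- y :* q) :+ (g :- y :* q′) := (f :+ g) :- y :* (q :+ q′)) S.refl (lift f) (lift g) (lift y) q q′)
            (S.+-congʳ (S.sym (Lift.hom-+ f g)))) (J.+∈ f∈ g∈)
      ; *∈   = λ x {f} (q , f∈) → lift x S.* q , J.resp
          (S.trans (solve 4 (λ x f y q → x :* (f :- y :* q) := x :* f :- y :* (x :* q)) S.refl (lift x) (lift f) (lift y) q)
            (S.+-congʳ (S.sym (Lift.hom-* x f)))) (J.*∈ (lift x) f∈)
      }
    row : ∀ {j} → j ∈ B∖ → Dec (j ≡ p) → ∃[ q ] I.J (lift (linForm n (A∖ j)) S.- lift y S.* q)
    row _ (yes refl) = S.1# , J.≈0∈ (S.trans (S.+-cong (Lift.hom-cong rowₚ) (S.-‿cong (S.*-identityʳ (lift y)))) (S.-‿inverseʳ (lift y)))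
    row {j} j∈ (no j≢p) = S.- lift k , J.resp
        (S.trans (row-lift j∈/) (S.trans (Lift.hom-cong (row∖ j≢p)) (S.trans (Lift.hom-+ (linForm n (A∖ j)) (k R.* y))
          (S.trans (S.+-congˡ {lift (linForm n (A∖ j))} (Lift.hom-* k y))
            (solve 3 (λ l k y → l :+ k :* y := l :- y :* (:- k)) S.refl (lift (linForm n (A∖ j))) (lift k) (lift y))))))
        (I.linForm∈ (ι∈B j∈/))
      where
      j∈/ = ∈B∖⁻ j∈ j≢p
      k = P.ι (A (ι j) (ι p))
    generators : ∀ {g} → N∖.Generators A∖ g → ∃[ q ] I.J (lift g S.- lift y S.* q)
    generators (inj₁ (F , nonface , refl)) = S.0# , J.resp
        (S.sym (S.trans (S.+-congˡ {lift x} (S.-‿cong (S.zeroʳ (lift y)))) (S.+-identityʳ (lift x))))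
        (J.resp (S.sym (lift-monomial K.1# (monoOf n F))) (I.monomial∈ K.1# (broken∖-up (BC∖.nonface⇒broken nonface)) λ {i} i∈ → byView (lastView i) i∈))
      where
      x = P.monomial K.1# (monoOf n F)
      byView : ∀ {i} → LastView i → i ∈ F ∷ʳ false → Q.Involves i (monoOf n F ∷ʳ 0)
      byView isLast       i∈ = contradiction i∈ (last∉∷ʳ {S = F})
      byView (isInject i) i∈ = monoOf-involves i∈
    generators (inj₂ (j , j∈ , refl)) = row j∈ (j FinP.≟ p)

  -- Makes multiplication by xₚ well defined on k(M / e). A broken circuit of M / e may have lost e,
  -- and the factor xₚ, congruent to s xₑ, restores it.
  contraction-lift : ∀ {h} → I/.J h → I.J (lift y S.* lift h)
  contraction-lift = P.generated-minimal (Lift.preimage (Ideals.colon-isIdeal Q.polyRing I.J-isIdeal (lift y))) generators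
    where
    open SolveS
    generators : ∀ {g} → N/.Generators A/ g → I.J (lift y S.* lift g)
    generators (inj₂ (j , j∈ , refl)) = J.*∈ (lift y) (J.resp (row-lift j∈) (I.linForm∈ (ι∈B j∈)))
    generators (inj₁ (F , nonface , refl)) = J.resp
        (S.trans (solve 4 (λ s x y m → (y :- s :* x) :* m :+ s :* (x :* m) := y :* m) S.refl (Q.ι s) (Q.X e) (lift y) x)
          (S.*-congˡ {lift y} (S.sym (lift-monomial K.1# (monoOf n F)))))
        (J.+∈ (J.*∈ʳ x y≡sXₑ) (J.*∈ (Q.ι s) (J.resp (Q.monomial-X K.1# e (monoOf n F ∷ʳ 0))
          (I.monomial∈ K.1# (broken/-up (BC/.nonface⇒broken nonface)) λ {i} i∈ → byView (lastView i) i∈))))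
      where
      x = Q.monomial K.1# (monoOf n F ∷ʳ 0)
      byView : ∀ {i} → LastView i → i ∈ F ∷ʳ true → Q.Involves i (unitVec (suc n) e Q.⊕ (monoOf n F ∷ʳ 0))
      byView isLast       i∈ = Q.involves-unit e
      byView (isInject i) i∈ = Q.involves-⊕ (unitVec (suc n) e) (monoOf-involves (inject∈∷ʳ (inject∈∷ʳ⁻ {S = F} i∈)))

  -- Monomials with xₑ vanish, the other broken ones are broken in the deletion, and the forms
  -- change by multiples of xₚ, which lies in the ideal of the deletion.
  kill-J : ∀ {f} → I.J f → I∖.J (Kill.hom f)
  kill-J = Q.generated-minimal (Kill.preimage I∖.J-isIdeal) generators
    where
    drop-last : ∀ j → Kill.hom (linForm (suc n) (A j)) R.≈ linForm n (A j ∘ ι)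
    drop-last j = R.trans (Kill.hom-linForm (A j)) (R.trans (R.+-congˡ {linForm n (A j ∘ ι)}
      (R.trans (R.*-congˡ {P.ι (A j e)} (R.trans (R.*-congʳ {y} P.ι-0) (R.zeroˡ y))) (R.zeroʳ (P.ι (A j e))))) (R.+-identityʳ _))
    row : ∀ {j} → LastView j → j ∈ B → I∖.J (linForm n (A j ∘ ι))
    row isLast       _ = J∖.resp (R.sym row-e) (J∖.*∈ (P.ι c) y∈J∖)
    row (isInject j) j∈ = J∖.resp (R.sym (row∖ λ { refl → ιp∉B j∈ })) (J∖.+∈ (I∖.linForm∈ (B/⊆B∖ (ι∈B⁻ j∈))) (J∖.*∈ (P.ι (A (ι j) (ι p))) y∈J∖))
    generators : ∀ {g} → N.Generators A g → I∖.J (Kill.hom g)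
    generators (inj₂ (j , j∈ , refl)) = J∖.resp (R.sym (drop-last j)) (row (lastView j) j∈)
    generators (inj₁ (F , nonface , refl)) = face F nonface (e SubP.∈? F)
      where
      open SemiringExp K.semiring using (_^_)
      face : ∀ F → ¬ IsBCFace Indep F → Dec (e ∈ F) → I∖.J (Kill.hom (Q.monomial K.1# (monoOf (suc n) F)))
      face F nonface (no e∉F) = I∖.monomial∈ _ (broken∖-down e∉F (BC.nonface⇒broken nonface)) λ i∈ →
            collapse-involves {monoOf (suc n) F} (Q.positive (≡.subst (0 <_) (≡.sym (I.lookup-monoOf {F} (∈restrict⁻ i∈))) (s≤s z≤n)))
      face F nonface (yes e∈F) = J∖.≈0∈ (P.≋⇒≈ᴾ (Kill.hom (Q.monomial K.1# (monoOf (suc n) F))) R.0# λ g → K.trans (K.+-identityʳ _) (K.trans (K.*-congʳ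
            (K.trans (K.*-identityˡ _) (K.trans (K.reflexive (≡.cong (K.0# ^_) (I.lookup-monoOf e∈F))) (K.zeroˡ K.1#)))) (K.zeroˡ _)))

  -- Up to forms, u consists of monomials that become broken when multiplied by xₑ; contracting e
  -- leaves them broken in M / e. The substitution kills the form of e and turns the others into
  -- those of M / e.
  colon-reduce : ∀ u → I.J (Q.X e S.* u) → I/.J (Reduce.hom u)
  colon-reduce u Xu∈ = let (b , u-b∈) = colon-decompose u Xu∈ in reduced u b u-b∈
    where
    Colon : Mono (suc n) → Set
    Colon α = I.Broken (unitVec (suc n) e Q.⊕ α)
    monomial∈ : ∀ k {α} → Colon α → I/.J (P.monomial k (collapse α))
    monomial∈ k {α} broken = I/.monomial∈ k (broken/-down broken) λ i∈ →
      collapse-involves (Q.involves-unit⁻ {e = e} fromℕ≢inject₁ (PQ.supp∈ {unitVec (suc n) e Q.⊕ α} (∈restrict⁻ i∈)))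
    reduce-last : Reduce.hom (linForm (suc n) (A e)) R.≈ R.0#
    reduce-last = R.trans (Reduce.hom-linForm (A e)) (R.trans (R.+-cong row-e (R.trans (R.sym (R.*-assoc (P.ι a) (P.ι s) y)) (R.*-congʳ {y} (R.trans (R.sym (P.ι-* a s)) (P.ι-cong as≈-c)))))
      (R.trans (R.sym (R.distribʳ y (P.ι c) (P.ι (K.- c)))) (R.trans (R.*-congʳ {y} (R.-‿inverseʳ (P.ι c))) (R.zeroˡ y))))
      where
      as≈-c : a K.* s K.≈ K.- c
      as≈-c = K.trans (SolveK.solve 2 (λ a c → a SolveK.:* (SolveK.:- (a SolveK.:* c)) SolveK.:= SolveK.:- ((a SolveK.:* a) SolveK.:* c)) K.refl a c)
        (K.-‿cong (K.trans (K.*-congʳ a²≈1) (K.*-identityˡ c)))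
    row : ∀ {j} → LastView j → Dec (j ∈ B) → I/.J (Reduce.hom (linForm (suc n) (I.masked j)))
    row {j} _ (no j∉B) = J/.≈0∈ (Reduce.hom-cong {q = S.0#} (S.trans (Q.linForm-sum (I.masked j)) (QS.sum-zero λ i → S.trans (S.*-congʳ {Q.X i} (S.trans (Q.ι-cong (I.masked-outside j i j∉B)) Q.ι-0)) (S.zeroˡ (Q.X i)))))
    row isLast       (yes e∈) = J/.≈0∈ (R.trans (Reduce.hom-cong (I.masked-linForm e∈)) reduce-last)
    row (isInject j) (yes j∈) = J/.resp (R.sym (R.trans (Reduce.hom-cong (S.trans (I.masked-linForm j∈) (row-lift (ι∈B⁻ j∈)))) (Reduce.hom-lift (linForm n (A/ j))))) (I/.linForm∈ (ι∈B⁻ j∈))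
    reduced : ∀ u b → Q.Span Colon (u S.- I.combination b) → I/.J (Reduce.hom u)
    reduced u b u-b∈ = J/.resp (SolveR.solve 2 (λ u c → (u SolveR.:- c) SolveR.:+ c SolveR.:= u) R.refl (Reduce.hom u) (Reduce.hom (I.combination b)))
      (J/.+∈ (J/.resp (Reduce.hom-sub u (I.combination b)) difference∈) combination∈)
      where
      difference∈ : I/.J (Reduce.hom (u S.- I.combination b))
      difference∈ = Reduce.hom-Span I/.J-isIdeal (λ α → BC.hasBroken? (PQ.supp (unitVec (suc n) e Q.⊕ α))) (λ k {α} → monomial∈ k {α}) u-b∈
      combination∈ : I/.J (Reduce.hom (I.combination b))
      combination∈ = J/.resp (R.sym (Reduce.hom-sum (λ j → b j S.* linForm (suc n) (I.masked j)))) (J/.sum∈ _ λ j →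
        J/.resp (R.sym (Reduce.hom-* (b j) (linForm (suc n) (I.masked j)))) (J/.*∈ (Reduce.hom (b j)) (row (lastView j) (j SubP.∈? B))))
  private
    All-lift : ∀ {L : Mono n → Set} {L′ : Mono (suc n) → Set} → (∀ {α} → L α → L′ (α ∷ʳ 0)) →
               ∀ {f : Pol n} → All (λ t → L (proj₂ t)) f → All (λ t → L′ (proj₂ t)) (lift f)
    All-lift up []       = []
    All-lift up (l ∷ ls) = up l ∷ All-lift up ls

    All-y* : ∀ {L L′ : Mono n → Set} → (∀ {α} → L α → L′ (unitVec n p P.⊕ α)) →
             ∀ {f : Pol n} → All (λ t → L (proj₂ t)) f → All (λ t → L′ (proj₂ t)) (y R.* f)
    All-y* up []       = []
    All-y* up (l ∷ ls) = up l ∷ All-y* up ls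

  -- L(M) = L(M \ e) ⊔ xₚ L(M / e).
  split-L : ∀ g → SupportedIn (suc n) N.InL g →
            ∃[ g₀ ] ∃[ g₁ ] (SupportedIn n N∖.InL g₀ × SupportedIn n N/.InL g₁ × g S.≈ lift g₀ S.+ lift (y R.* g₁))
  split-L [] [] = [] , [] , [] , [] , S.refl
  split-L ((k , β) ∷ g) (βL ∷ gL) =
    let (g₀ , g₁ , g₀L , g₁L , g≈) = split-L g gL in byExponent g₀ g₁ g₀L g₁L g≈ (P.involves? p (restrict β))
    where
    open SolveS
    β≡ : β ≡ restrict β ∷ʳ 0
    β≡ = ≡.trans (∷ʳ-eta β) (≡.cong (restrict β ∷ʳ_) (proj₁ βL e e∈B))
    βL′ : N.InL (restrict β ∷ʳ 0)
    βL′ = ≡.subst N.InL β≡ βL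
    head≈ : Q.monomial k β S.≈ lift (P.monomial k (restrict β))
    head≈ = S.trans (S.reflexive (≡.cong (Q.monomial k) β≡)) (S.sym (lift-monomial k (restrict β)))
    byExponent : ∀ g₀ g₁ → SupportedIn n N∖.InL g₀ → SupportedIn n N/.InL g₁ → g S.≈ lift g₀ S.+ lift (y R.* g₁) → Dec (P.Involves p (restrict β)) →
                 ∃[ g₀ ] ∃[ g₁ ] (SupportedIn n N∖.InL g₀ × SupportedIn n N/.InL g₁ × (Q.monomial k β S.+ g) S.≈ lift g₀ S.+ lift (y R.* g₁))
    byExponent g₀ g₁ g₀L g₁L g≈ (no ¬p) = P.monomial k (restrict β) R.+ g₀ , g₁ ,
      L∖-down {restrict β} (ℕP.n≤0⇒n≡0 (ℕP.≮⇒≥ (¬p ∘ P.positive))) βL′ ∷ g₀L , g₁L ,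
      S.trans (S.+-cong head≈ g≈) (S.sym (S.+-assoc (lift (P.monomial k (restrict β))) (lift g₀) (lift (y R.* g₁))))
    byExponent g₀ g₁ g₀L g₁L g≈ (yes (P.positive p>0)) = let (ν , β≡ν⊕p) = P.≤ₘ⇒⊕ (unitVec n p) (restrict β) (P.unit≤ p (restrict β) p>0) in
      g₀ , P.monomial k ν R.+ g₁ , g₀L , divided ν (≡.trans β≡ν⊕p (P.⊕-comm ν (unitVec n p)))
      where
      divided : ∀ ν → restrict β ≡ unitVec n p P.⊕ ν →
                SupportedIn n N/.InL (P.monomial k ν R.+ g₁) × (Q.monomial k β S.+ g) S.≈ lift g₀ S.+ lift (y R.* (P.monomial k ν R.+ g₁))
      divided ν β≡p⊕ν = L/-down {ν} (≡.subst (λ α → N.InL (α ∷ʳ 0)) β≡p⊕ν βL′) ∷ g₁L ,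
        S.trans (S.+-cong (S.trans head≈ (Lift.hom-cong (R.trans (R.reflexive (≡.cong (P.monomial k) β≡p⊕ν)) (P.monomial-X k p ν)))) g≈)
          (S.trans (solve 3 (λ m a b → m :+ (a :+ b) := a :+ (m :+ b)) S.refl (lift (y R.* P.monomial k ν)) (lift g₀) (lift (y R.* g₁)))
            (S.+-congˡ {lift g₀} (S.trans (S.sym (Lift.hom-+ (y R.* P.monomial k ν) (y R.* g₁))) (Lift.hom-cong (R.sym (R.distribˡ y (P.monomial k ν) g₁))))))

  -- The basis of the deletion reduces f up to a multiple of xₚ, and the basis of M / e then reduces
  -- the cofactor q.
  spanning : N∖.HasNBCBasis → N/.HasNBCBasis → ∀ f → ∃[ g ] (SupportedIn (suc n) N.InL g × I.J (f S.- g))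
  spanning hyp∖ hyp/ f =
    let (g₀ , g₀L , f-g₀∈) = proj₁ (hyp∖ A∖ valid∖) (Reduce.hom f)
        (q , fg₀-yq∈)      = deletion-lift {Reduce.hom f R.- g₀} (P.member f-g₀∈)
        (g₁ , g₁L , q-g₁∈) = proj₁ (hyp/ A/ valid/) (Reduce.hom q)
    in lift g₀ S.+ lift (y R.* g₁) ,
       AllP.++⁺ (All-lift {N∖.InL} {N.InL} (λ {α} → L∖-up {α}) g₀L) (All-lift {λ α → N.InL (α ∷ʳ 0)} id (All-y* {N/.InL} (λ {α} → L/-up {α}) g₁L)) ,
       assemble g₀ q g₁ fg₀-yq∈ (contraction-lift {Reduce.hom q R.- g₁} (P.member q-g₁∈))
    where
    open SolveS
    f′ = lift (Reduce.hom f)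
    assemble : ∀ g₀ q g₁ → I.J (lift (Reduce.hom f R.- g₀) S.- lift y S.* q) → I.J (lift y S.* lift (Reduce.hom q R.- g₁)) →
               I.J (f S.- (lift g₀ S.+ lift (y R.* g₁)))
    assemble g₀ q g₁ fg₀-yq∈ yqg₁∈ = J.resp
      (S.trans (S.+-cong (S.+-congˡ {f S.- f′} (S.+-congʳ {S.- (lift y S.* q)} (Lift.hom-sub (Reduce.hom f) g₀)))
                         (S.+-congˡ {lift y S.* (q S.- q′)} (S.*-congˡ {lift y} (Lift.hom-sub (Reduce.hom q) g₁))))
        (S.trans (solve 7 (λ f f′ g₀ y q q′ g₁ → ((f :- f′) :+ ((f′ :- g₀) :- y :* q)) :+ (y :* (q :- q′) :+ y :* (q′ :- g₁)) := f :- (g₀ :+ y :* g₁))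
                    S.refl f f′ (lift g₀) (lift y) q q′ (lift g₁))
          (S.+-congˡ {f} (S.-‿cong (S.+-congˡ {lift g₀} (S.sym (Lift.hom-* y g₁)))))))
      (J.+∈ (J.+∈ (f≡lift f) fg₀-yq∈) (J.+∈ (J.*∈ (lift y) (f≡lift q)) yqg₁∈))
      where q′ = lift (Reduce.hom q)

  -- Setting xₑ = 0 isolates `g₀`, because xₚ is zero in the deletion, so `g₀` vanishes. The rest is
  -- xₚ `g₁`; multiplied by s it is congruent to xₑ `g₁`, and `colon-reduce` puts `g₁` into the
  -- ideal of M / e.
  independent : N∖.HasNBCBasis → N/.HasNBCBasis → ∀ g → SupportedIn (suc n) N.InL g → I.J g → IsZero (suc n) g
  independent hyp∖ hyp/ g gL g∈ = let (g₀ , g₁ , g₀L , g₁L , g≈) = split-L g gL in Q.coeffs (g≈0 g₀ g₁ g₀L g₁L g≈)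
    where
    open SolveS
    module _ (g₀ g₁ : Pol n) (g₀L : SupportedIn n N∖.InL g₀) (g₁L : SupportedIn n N/.InL g₁) (g≈ : g S.≈ lift g₀ S.+ lift (y R.* g₁)) where
      killed : Kill.hom g R.≈ g₀ R.+ y R.* g₁
      killed = R.trans (Kill.hom-cong g≈) (R.trans (Kill.hom-+ (lift g₀) (lift (y R.* g₁))) (R.+-cong (Kill.hom-lift g₀) (Kill.hom-lift (y R.* g₁))))
      g₀∈ : I∖.J g₀
      g₀∈ = J∖.resp (SolveR.solve 2 (λ a b → (a SolveR.:+ b) SolveR.:- b SolveR.:= a) R.refl g₀ (y R.* g₁))
        (J∖.sub∈ (J∖.resp killed (kill-J g∈)) (J∖.*∈ʳ g₁ y∈J∖))
      g₀≈0 : g₀ R.≈ R.0#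
      g₀≈0 = P.coeffwise (proj₂ (hyp∖ A∖ valid∖) g₀ g₀L (P.inIdeal g₀∈))
      g≈yg₁ : g S.≈ lift (y R.* g₁)
      g≈yg₁ = S.trans g≈ (S.+-congʳ {lift (y R.* g₁)} (Lift.hom-cong {q = R.0#} g₀≈0))
      xg₁∈ : I.J (Q.X e S.* lift g₁)
      xg₁∈ = J.resp (S.trans (S.+-congˡ {(Q.X e S.- Q.ι s S.* Q.X (ι p)) S.* lift g₁} (S.*-congˡ {Q.ι s} (S.trans g≈yg₁ (S.trans (Lift.hom-* y g₁) (S.*-congʳ {lift g₁} (lift-X p))))))
          (solve 4 (λ x s y u → (x :- s :* y) :* u :+ s :* (y :* u) := x :* u) S.refl (Q.X e) (Q.ι s) (Q.X (ι p)) (lift g₁)))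
        (J.+∈ (J.*∈ʳ (lift g₁) Xₑ≡sXₚ) (J.*∈ (Q.ι s) g∈))
      g₁≈0 : g₁ R.≈ R.0#
      g₁≈0 = P.coeffwise (proj₂ (hyp/ A/ valid/) g₁ g₁L (P.inIdeal (J/.resp (Reduce.hom-lift g₁) (colon-reduce (lift g₁) xg₁∈))))
      g≈0 : g S.≈ S.0#
      g≈0 = S.trans g≈yg₁ (Lift.hom-cong {q = R.0#} (R.trans (R.*-congˡ {y} g₁≈0) (R.zeroʳ y)))

theorem4p6 : (k : Field) (n′ r : ℕ) (Indep : IndepSys (suc n′)) →
    IsMatroid Indep → IsRegular Indep →
    1 ≤ r → r ≤ n′ →
    IsBasis Indep (lastR (suc n′) r) →
    IsCocircuit Indep (pairLast n′ r) →
    NBC.HasNBCBasis k (deleteLast Indep) r →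
    NBC.HasNBCBasis k (contractLast Indep) (r ∸ 1) →
    NBC.HasNBCBasis k Indep r
-- As 1 ≤ r, the rank has the form `suc r`, and the rank `suc r ∸ 1` of the contraction reduces to
-- `r`.
theorem4p6 k n′ (suc r) Indep M _ _ r<n bB cocircuit hyp∖ hyp/ A valid =
  (λ f → let (g , gL , f-g∈) = spanning hyp∖ hyp/ f in g , gL , Polynomials.inIdeal f-g∈) ,
  (λ g gL g∈ → independent hyp∖ hyp/ g gL (Polynomials.member g∈))
  where open SeriesStep k M r<n bB cocircuit A valid
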